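{- Let $p<q$ be square-free integers $\ge 2$ with $p\equiv 2\pmod 4$ and $q\equiv 3\pmod 4$, put $r=pq/\gcd(p,q)^2$ and assume $p<q<r$. Let $K=\mathbb{Q}(\sqrt p,\sqrt q)$. Let $m,t,\kappa$ be positive integers and let $$I_1=\left[\frac{m\kappa}{2t}+\frac{\sqrt m}{\sqrt t},\ \frac{m\kappa}{2(t-1)}-\frac{\sqrt m}{\sqrt{t-1}}\right]\ \text{ if } t>1,\qquad I_1=\left[\frac{m\kappa}{2}+\sqrt m,\ \infty\right)\ \text{ if } t=1.$$ If $m\le\min\{\frac{r}{4\lceil\kappa\sqrt r\rceil},\,p,\,q\}$ and $\sqrt p,\sqrt q\in I_1$, then not all elements of $m\mathcal{O}_K^+$ are sums of squares of elements of $\mathcal{O}_K$. Moreover, the interval $I_1$ is non-empty for $m\ge\frac{4t(t-1)\left(2t-1+2\sqrt{t(t-1)}\right)}{\kappa^2}$.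
   Context: $\mathcal{O}_K$ is the ring of integers of $K$, $\mathcal{O}_K^+$ is the set of its totally positive elements (all four real embeddings positive), and $m\mathcal{O}_K^+=\{m\alpha:\alpha\in\mathcal{O}_K^+\}$. A sum of squares in $\mathcal{O}_K$ is a finite sum $\sum_i\alpha_i^2$ with $\alpha_i\in\mathcal{O}_K$. -}

module Defs where

open import Data.Nat as ℕ using (ℕ; zero; suc)
import Data.Nat.Properties as ℕP
open import Data.Nat.Divisibility using (_∣_)
open import Data.Integer as ℤ using (ℤ; +_)
import Data.Integer.Properties as ℤP
open import Data.Rational as ℚ using (ℚ; 0ℚ; 1ℚ; ½; mkℚ)
import Data.Rational.Properties as ℚP
open import Data.Rational.Solver using (module +-*-Solver)
open import Data.Rational.Unnormalised.Base as ℚᵘ using (mkℚᵘ; *≡*; *≤*)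
import Data.Rational.Unnormalised.Properties as ℚᵘP
open import Data.Sign using (Sign)
open import Data.List using (List; []; _∷_; map; foldr)
open import Data.List.Relation.Unary.All using (All)
open import Data.Product using (∃; _×_; _,_; proj₁; proj₂)
open import Data.Sum using (inj₁; inj₂)
open import Relation.Nullary using (yes; no; contradiction)
open import Relation.Binary.PropositionalEquality
  using (_≡_; refl; sym; trans; cong; cong₂; subst; subst₂; module ≡-Reasoning)

ℕ→ℚ : ℕ → ℚ
ℕ→ℚ n = (+ n) ℚ./ 1

ℤ→ℚ : ℤ → ℚ
ℤ→ℚ z = z ℚ./ 1

-- Totalised reciprocal (recip 0 = 0); it is only ever evaluated at 0
-- on an irrelevant initial segment of a sequence.
recip : ℚ → ℚ
recip x with x ℚP.≟ 0ℚ
... | yes _  = 0ℚ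
... | no x≢0 = (ℚ.1/ x) {{ℚ.≢-nonZero x≢0}}

recip-inverseʳ : ∀ {x} → 0ℚ ℚ.< x → x ℚ.* recip x ≡ 1ℚ
recip-inverseʳ {x} 0<x with x ℚP.≟ 0ℚ
... | yes x≡0 = contradiction (sym x≡0) (ℚP.<⇒≢ 0<x)
... | no x≢0  = ℚP.*-inverseʳ x {{ℚ.≢-nonZero x≢0}}

recip-pos : ∀ {x} → 0ℚ ℚ.< x → 0ℚ ℚ.< recip x
recip-pos {x} 0<x with x ℚP.≟ 0ℚ
... | yes x≡0 = contradiction (sym x≡0) (ℚP.<⇒≢ 0<x)
... | no x≢0  = ℚP.positive⁻¹ _ {{ℚP.1/pos⇒pos x {{ℚ.positive 0<x}}}}

*-pos : ∀ {x y} → 0ℚ ℚ.< x → 0ℚ ℚ.< y → 0ℚ ℚ.< x ℚ.* y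
*-pos {x} {y} 0<x 0<y =
  ℚP.positive⁻¹ _ {{ℚP.pos*pos⇒pos x {{ℚ.positive 0<x}} y {{ℚ.positive 0<y}}}}

*-mono-≤₀ : ∀ {a b c d} → 0ℚ ℚ.≤ c → 0ℚ ℚ.≤ b → a ℚ.≤ b → c ℚ.≤ d →
            a ℚ.* c ℚ.≤ b ℚ.* d
*-mono-≤₀ {a} {b} {c} {d} 0≤c 0≤b a≤b c≤d = ℚP.≤-trans
  (ℚP.*-monoʳ-≤-nonNeg c {{ℚ.nonNegative 0≤c}} a≤b)
  (ℚP.*-monoˡ-≤-nonNeg b {{ℚ.nonNegative 0≤b}} c≤d)

½-pos : ∀ {ε} → 0ℚ ℚ.< ε → 0ℚ ℚ.< ε ℚ.* ½
½-pos 0<ε = *-pos 0<ε (ℚP.positive⁻¹ ½)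

½+½ : ∀ ε → ε ℚ.* ½ ℚ.+ ε ℚ.* ½ ≡ ε
½+½ ε = trans (sym (ℚP.*-distribˡ-+ ε ½ ½)) (ℚP.*-identityʳ ε)

∣x-y∣≤ : ∀ {x y ε} → x ℚ.≤ y ℚ.+ ε → y ℚ.≤ x ℚ.+ ε → ℚ.∣ x ℚ.- y ∣ ℚ.≤ ε
∣x-y∣≤ {x} {y} {ε} x≤ y≤ with ℚP.∣p∣≡p∨∣p∣≡-p (x ℚ.- y)
... | inj₁ e = subst (ℚ._≤ ε) (sym e)
  (subst (x ℚ.- y ℚ.≤_) (l y ε) (ℚP.+-monoˡ-≤ (ℚ.- y) x≤))
  where
  open +-*-Solver
  l : ∀ y ε → y ℚ.+ ε ℚ.- y ≡ ε
  l = solve 2 (λ y ε → y :+ ε :+ (:- y) := ε) refl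
... | inj₂ e = subst (ℚ._≤ ε) (sym e)
  (subst₂ ℚ._≤_ (l₁ x y) (l₂ x ε) (ℚP.+-monoˡ-≤ (ℚ.- x) y≤))
  where
  open +-*-Solver
  l₁ : ∀ x y → y ℚ.- x ≡ ℚ.- (x ℚ.- y)
  l₁ = solve 2 (λ x y → y :+ (:- x) := :- (x :+ (:- y))) refl
  l₂ : ∀ x ε → x ℚ.+ ε ℚ.- x ≡ ε
  l₂ = solve 2 (λ x ε → x :+ ε :+ (:- x) := ε) refl

-- Real numbers: Cauchy sequences of rationals.  No quotient is taken;
-- everything below is stated through the relations _<ʳ_ and _≤ʳ_,
-- which only depend on the limits.

IsCauchy : (ℕ → ℚ) → Set
IsCauchy x = ∀ ε → 0ℚ ℚ.< ε →
  ∃ λ N → ∀ i j → N ℕ.≤ i → N ℕ.≤ j → ℚ.∣ x i ℚ.- x j ∣ ℚ.≤ ε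

record ℝ : Set where
  constructor mkℝ
  field
    seq    : ℕ → ℚ
    cauchy : IsCauchy seq
open ℝ public

infix  4 _<ʳ_ _≤ʳ_
infixl 6 _+ʳ_ _-ʳ_
infixl 7 _*ʳ_ _/ʳ_
infix  8 -ʳ_

_<ʳ_ : ℝ → ℝ → Set
x <ʳ y = ∃ λ ε → 0ℚ ℚ.< ε × ∃ λ N → ∀ n → N ℕ.≤ n → seq x n ℚ.+ ε ℚ.≤ seq y n

_≤ʳ_ : ℝ → ℝ → Set
x ≤ʳ y = ∀ ε → 0ℚ ℚ.< ε → ∃ λ N → ∀ n → N ℕ.≤ n → seq x n ℚ.≤ seq y n ℚ.+ ε

ℚ→ℝ : ℚ → ℝ
ℚ→ℝ a = mkℝ (λ _ → a) λ ε 0<ε → 0 , λ _ _ _ _ →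
  subst (ℚ._≤ ε) (sym (cong ℚ.∣_∣ (ℚP.+-inverseʳ a))) (ℚP.<⇒≤ 0<ε)

ℕ→ℝ : ℕ → ℝ
ℕ→ℝ n = ℚ→ℝ (ℕ→ℚ n)

ℤ→ℝ : ℤ → ℝ
ℤ→ℝ z = ℚ→ℝ (ℤ→ℚ z)

0ʳ : ℝ
0ʳ = ℚ→ℝ 0ℚ

_+ʳ_ : ℝ → ℝ → ℝ
x +ʳ y = mkℝ (λ n → seq x n ℚ.+ seq y n) λ ε 0<ε →
  let N₁ , h₁ = cauchy x _ (½-pos 0<ε)
      N₂ , h₂ = cauchy y _ (½-pos 0<ε)
  in N₁ ℕ.⊔ N₂ , λ i j N≤i N≤j → begin
    ℚ.∣ (seq x i ℚ.+ seq y i) ℚ.- (seq x j ℚ.+ seq y j) ∣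
      ≡⟨ cong ℚ.∣_∣ (regroup (seq x i) (seq y i) (seq x j) (seq y j)) ⟩
    ℚ.∣ (seq x i ℚ.- seq x j) ℚ.+ (seq y i ℚ.- seq y j) ∣
      ≤⟨ ℚP.∣p+q∣≤∣p∣+∣q∣ (seq x i ℚ.- seq x j) (seq y i ℚ.- seq y j) ⟩
    ℚ.∣ seq x i ℚ.- seq x j ∣ ℚ.+ ℚ.∣ seq y i ℚ.- seq y j ∣
      ≤⟨ ℚP.+-mono-≤
           (h₁ i j (ℕP.m⊔n≤o⇒m≤o N₁ N₂ N≤i) (ℕP.m⊔n≤o⇒m≤o N₁ N₂ N≤j))
           (h₂ i j (ℕP.m⊔n≤o⇒n≤o N₁ N₂ N≤i) (ℕP.m⊔n≤o⇒n≤o N₁ N₂ N≤j)) ⟩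
    ε ℚ.* ½ ℚ.+ ε ℚ.* ½ ≡⟨ ½+½ ε ⟩
    ε ∎
  where
  open ℚP.≤-Reasoning
  regroup : ∀ a b c d → (a ℚ.+ b) ℚ.- (c ℚ.+ d) ≡ (a ℚ.- c) ℚ.+ (b ℚ.- d)
  regroup = solve 4 (λ a b c d →
    (a :+ b) :+ (:- (c :+ d)) := (a :+ (:- c)) :+ (b :+ (:- d))) refl
    where open +-*-Solver

-ʳ_ : ℝ → ℝ
-ʳ x = mkℝ (λ n → ℚ.- seq x n) λ ε 0<ε →
  let N , h = cauchy x ε 0<ε
  in N , λ i j N≤i N≤j → subst (ℚ._≤ ε)
       (trans (sym (ℚP.∣-p∣≡∣p∣ (seq x i ℚ.- seq x j)))
              (cong ℚ.∣_∣ (ℚP.neg-distrib-+ (seq x i) (ℚ.- seq x j))))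
       (h i j N≤i N≤j)

_-ʳ_ : ℝ → ℝ → ℝ
x -ʳ y = x +ʳ (-ʳ y)

eventuallyBounded : ∀ x → ∃ λ B → 0ℚ ℚ.< B ×
  ∃ λ N → ∀ n → N ℕ.≤ n → ℚ.∣ seq x n ∣ ℚ.≤ B
eventuallyBounded x =
  let N , h = cauchy x 1ℚ (ℚP.positive⁻¹ 1ℚ)
      xN    = seq x N
  in 1ℚ ℚ.+ ℚ.∣ xN ∣ ,
     ℚP.+-mono-<-≤ (ℚP.positive⁻¹ 1ℚ) (ℚP.0≤∣p∣ xN) ,
     N , λ n N≤n → begin
       ℚ.∣ seq x n ∣                            ≡⟨ cong ℚ.∣_∣ (split (seq x n) xN) ⟩
       ℚ.∣ (seq x n ℚ.- xN) ℚ.+ xN ∣            ≤⟨ ℚP.∣p+q∣≤∣p∣+∣q∣ (seq x n ℚ.- xN) xN ⟩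
       ℚ.∣ seq x n ℚ.- xN ∣ ℚ.+ ℚ.∣ xN ∣        ≤⟨ ℚP.+-monoˡ-≤ ℚ.∣ xN ∣ (h n N N≤n ℕP.≤-refl) ⟩
       1ℚ ℚ.+ ℚ.∣ xN ∣                          ∎
  where
  open ℚP.≤-Reasoning
  split : ∀ a b → a ≡ (a ℚ.- b) ℚ.+ b
  split = solve 2 (λ a b → a := (a :+ (:- b)) :+ b) refl
    where open +-*-Solver

_*ʳ_ : ℝ → ℝ → ℝ
x *ʳ y = mkℝ (λ n → seq x n ℚ.* seq y n) λ ε 0<ε →
  let B , 0<B , N₁ , b = eventuallyBounded x
      C , 0<C , N₂ , c = eventuallyBounded y
      N₃ , h = cauchy x (ε ℚ.* ½ ℚ.* recip C) (*-pos (½-pos 0<ε) (recip-pos 0<C))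
      N₄ , k = cauchy y (ε ℚ.* ½ ℚ.* recip B) (*-pos (½-pos 0<ε) (recip-pos 0<B))
      M₁ = N₁ ℕ.⊔ N₂
      M₂ = N₃ ℕ.⊔ N₄
  in M₁ ℕ.⊔ M₂ , λ i j M≤i M≤j →
    let xi = seq x i ; xj = seq x j ; yi = seq y i ; yj = seq y j
        M₁≤i = ℕP.m⊔n≤o⇒m≤o M₁ M₂ M≤i
        M₁≤j = ℕP.m⊔n≤o⇒m≤o M₁ M₂ M≤j
        M₂≤i = ℕP.m⊔n≤o⇒n≤o M₁ M₂ M≤i
        M₂≤j = ℕP.m⊔n≤o⇒n≤o M₁ M₂ M≤j
    in begin
    ℚ.∣ xi ℚ.* yi ℚ.- xj ℚ.* yj ∣
      ≡⟨ cong ℚ.∣_∣ (regroup xi yi xj yj) ⟩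
    ℚ.∣ xi ℚ.* (yi ℚ.- yj) ℚ.+ yj ℚ.* (xi ℚ.- xj) ∣
      ≤⟨ ℚP.∣p+q∣≤∣p∣+∣q∣ (xi ℚ.* (yi ℚ.- yj)) (yj ℚ.* (xi ℚ.- xj)) ⟩
    ℚ.∣ xi ℚ.* (yi ℚ.- yj) ∣ ℚ.+ ℚ.∣ yj ℚ.* (xi ℚ.- xj) ∣
      ≡⟨ cong₂ ℚ._+_ (ℚP.∣p*q∣≡∣p∣*∣q∣ xi (yi ℚ.- yj)) (ℚP.∣p*q∣≡∣p∣*∣q∣ yj (xi ℚ.- xj)) ⟩
    ℚ.∣ xi ∣ ℚ.* ℚ.∣ yi ℚ.- yj ∣ ℚ.+ ℚ.∣ yj ∣ ℚ.* ℚ.∣ xi ℚ.- xj ∣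
      ≤⟨ ℚP.+-mono-≤
           (*-mono-≤₀ (ℚP.0≤∣p∣ (yi ℚ.- yj)) (ℚP.<⇒≤ 0<B)
              (b i (ℕP.m⊔n≤o⇒m≤o N₁ N₂ M₁≤i))
              (k i j (ℕP.m⊔n≤o⇒n≤o N₃ N₄ M₂≤i) (ℕP.m⊔n≤o⇒n≤o N₃ N₄ M₂≤j)))
           (*-mono-≤₀ (ℚP.0≤∣p∣ (xi ℚ.- xj)) (ℚP.<⇒≤ 0<C)
              (c j (ℕP.m⊔n≤o⇒n≤o N₁ N₂ M₁≤j))
              (h i j (ℕP.m⊔n≤o⇒m≤o N₃ N₄ M₂≤i) (ℕP.m⊔n≤o⇒m≤o N₃ N₄ M₂≤j))) ⟩
    B ℚ.* (ε ℚ.* ½ ℚ.* recip B) ℚ.+ C ℚ.* (ε ℚ.* ½ ℚ.* recip C)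
      ≡⟨ cong₂ ℚ._+_ (cancel B (ε ℚ.* ½) 0<B) (cancel C (ε ℚ.* ½) 0<C) ⟩
    ε ℚ.* ½ ℚ.+ ε ℚ.* ½ ≡⟨ ½+½ ε ⟩
    ε ∎
  where
  open ℚP.≤-Reasoning
  regroup : ∀ a b c d → a ℚ.* b ℚ.- c ℚ.* d ≡ a ℚ.* (b ℚ.- d) ℚ.+ d ℚ.* (a ℚ.- c)
  regroup = solve 4 (λ a b c d →
    a :* b :+ (:- (c :* d)) := a :* (b :+ (:- d)) :+ d :* (a :+ (:- c))) refl
    where open +-*-Solver
  swap : ∀ B e R → B ℚ.* (e ℚ.* R) ≡ e ℚ.* (B ℚ.* R)
  swap = solve 3 (λ B e R → B :* (e :* R) := e :* (B :* R)) refl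
    where open +-*-Solver
  cancel : ∀ B e → 0ℚ ℚ.< B → B ℚ.* (e ℚ.* recip B) ≡ e
  cancel B e 0<B = trans (swap B e (recip B))
    (trans (cong (e ℚ.*_) (recip-inverseʳ 0<B)) (ℚP.*-identityʳ e))

inv : (x : ℝ) → 0ʳ <ʳ x → ℝ
inv x (e , 0<e , N₁ , h) = mkℝ (λ n → recip (seq x n)) λ ε 0<ε →
  let N₂ , k = cauchy x (ε ℚ.* (e ℚ.* e)) (*-pos 0<ε (*-pos 0<e 0<e))
  in N₁ ℕ.⊔ N₂ , λ i j N≤i N≤j →
    let u  = seq x i ; v = seq x j
        ru = recip u ; rv = recip v
        e≤u : e ℚ.≤ u
        e≤u = subst (ℚ._≤ u) (ℚP.+-identityˡ e) (h i (ℕP.m⊔n≤o⇒m≤o N₁ N₂ N≤i))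
        e≤v : e ℚ.≤ v
        e≤v = subst (ℚ._≤ v) (ℚP.+-identityˡ e) (h j (ℕP.m⊔n≤o⇒m≤o N₁ N₂ N≤j))
        0<u = ℚP.<-≤-trans 0<e e≤u
        0<v = ℚP.<-≤-trans 0<e e≤v
        0≤w = ℚP.<⇒≤ (*-pos (recip-pos 0<u) (recip-pos 0<v))
        instance _ = ℚ.nonNegative 0≤w
                 _ = ℚ.nonNegative (ℚP.<⇒≤ 0<ε)
    in begin
    ℚ.∣ ru ℚ.- rv ∣
      ≡⟨ cong ℚ.∣_∣ (difference 0<u 0<v) ⟩
    ℚ.∣ (v ℚ.- u) ℚ.* (ru ℚ.* rv) ∣
      ≡⟨ ℚP.∣p*q∣≡∣p∣*∣q∣ (v ℚ.- u) (ru ℚ.* rv) ⟩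
    ℚ.∣ v ℚ.- u ∣ ℚ.* ℚ.∣ ru ℚ.* rv ∣
      ≡⟨ cong (ℚ.∣ v ℚ.- u ∣ ℚ.*_) (ℚP.0≤p⇒∣p∣≡p 0≤w) ⟩
    ℚ.∣ v ℚ.- u ∣ ℚ.* (ru ℚ.* rv)
      ≤⟨ ℚP.*-monoʳ-≤-nonNeg (ru ℚ.* rv)
           (k j i (ℕP.m⊔n≤o⇒n≤o N₁ N₂ N≤j) (ℕP.m⊔n≤o⇒n≤o N₁ N₂ N≤i)) ⟩
    ε ℚ.* (e ℚ.* e) ℚ.* (ru ℚ.* rv)
      ≤⟨ ℚP.*-monoʳ-≤-nonNeg (ru ℚ.* rv)
           (ℚP.*-monoˡ-≤-nonNeg ε
             (*-mono-≤₀ (ℚP.<⇒≤ 0<e) (ℚP.<⇒≤ 0<u) e≤u e≤v)) ⟩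
    ε ℚ.* (u ℚ.* v) ℚ.* (ru ℚ.* rv)
      ≡⟨ regroup ε u v ru rv ⟩
    ε ℚ.* ((u ℚ.* ru) ℚ.* (v ℚ.* rv))
      ≡⟨ cong₂ (λ a b → ε ℚ.* (a ℚ.* b)) (recip-inverseʳ 0<u) (recip-inverseʳ 0<v) ⟩
    ε ℚ.* 1ℚ ≡⟨ ℚP.*-identityʳ ε ⟩
    ε ∎
  where
  open ℚP.≤-Reasoning
  regroup : ∀ ε u v r s → ε ℚ.* (u ℚ.* v) ℚ.* (r ℚ.* s) ≡ ε ℚ.* ((u ℚ.* r) ℚ.* (v ℚ.* s))
  regroup = solve 5 (λ ε u v r s →
    ε :* (u :* v) :* (r :* s) := ε :* ((u :* r) :* (v :* s))) refl
    where open +-*-Solver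
  expand : ∀ u v r s → (v ℚ.- u) ℚ.* (r ℚ.* s) ≡ (v ℚ.* s) ℚ.* r ℚ.- (u ℚ.* r) ℚ.* s
  expand = solve 4 (λ u v r s →
    (v :+ (:- u)) :* (r :* s) := (v :* s) :* r :+ (:- ((u :* r) :* s))) refl
    where open +-*-Solver
  difference : ∀ {u v} → 0ℚ ℚ.< u → 0ℚ ℚ.< v →
    recip u ℚ.- recip v ≡ (v ℚ.- u) ℚ.* (recip u ℚ.* recip v)
  difference {u} {v} 0<u 0<v = sym (trans (expand u v (recip u) (recip v))
    (cong₂ (λ a b → a ℚ.- b)
      (trans (cong (ℚ._* recip u) (recip-inverseʳ 0<v)) (ℚP.*-identityˡ (recip u)))
      (trans (cong (ℚ._* recip v) (recip-inverseʳ 0<u)) (ℚP.*-identityˡ (recip v)))))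

_/ʳ_ : ℝ → (n : ℕ) .{{_ : ℕ.NonZero n}} → ℝ
x /ʳ n = x *ʳ ℚ→ℝ (+ 1 ℚ./ n)

IsCeiling : ℝ → ℤ → Set
IsCeiling x c = ℤ→ℝ (c ℤ.- + 1) <ʳ x × x ≤ʳ ℤ→ℝ c

-- ⌊√ n ⌋ is the integer part of √n; the real √ n below is the limit of
-- ⌊√(n(k+1)²)⌋ / (k+1), each term being within 1/(k+1) below √n.
⌊√_⌋ : ℕ → ℕ
⌊√ zero ⌋ = 0
⌊√ suc n ⌋ with suc ⌊√ n ⌋ ℕ.* suc ⌊√ n ⌋ ℕ.≤? suc n
... | yes _ = suc ⌊√ n ⌋
... | no  _ = ⌊√ n ⌋

⌊√⌋-spec : ∀ n → ⌊√ n ⌋ ℕ.* ⌊√ n ⌋ ℕ.≤ n × n ℕ.< suc ⌊√ n ⌋ ℕ.* suc ⌊√ n ⌋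
⌊√⌋-spec zero = ℕ.z≤n , ℕ.s≤s ℕ.z≤n
⌊√⌋-spec (suc n) with suc ⌊√ n ⌋ ℕ.* suc ⌊√ n ⌋ ℕ.≤? suc n
... | yes s²≤ = s²≤ , ℕP.≤-<-trans (proj₂ (⌊√⌋-spec n))
                        (ℕP.*-mono-< (ℕP.n<1+n (suc ⌊√ n ⌋)) (ℕP.n<1+n (suc ⌊√ n ⌋)))
... | no  s²≰ = ℕP.m≤n⇒m≤1+n (proj₁ (⌊√⌋-spec n)) , ℕP.≰⇒> s²≰

√-approx : ℕ → ℕ → ℚ
√-approx n k = + ⌊√ n ℕ.* (suc k ℕ.* suc k) ⌋ ℚ./ suc k

/-mono-≤ : ∀ a b c d → a ℕ.* suc d ℕ.≤ c ℕ.* suc b →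
           (+ a) ℚ./ suc b ℚ.≤ (+ c) ℚ./ suc d
/-mono-≤ a b c d h = ℚP.toℚᵘ-cancel-≤
  (ℚᵘP.≤-respˡ-≃ (ℚᵘP.≃-sym (ℚP.toℚᵘ-fromℚᵘ (mkℚᵘ (+ a) b)))
  (ℚᵘP.≤-respʳ-≃ (ℚᵘP.≃-sym (ℚP.toℚᵘ-fromℚᵘ (mkℚᵘ (+ c) d)))
  (*≤* (subst₂ ℤ._≤_ (ℤP.pos-* a (suc d)) (ℤP.pos-* c (suc b)) (ℤ.+≤+ h)))))

/-suc : ∀ a b → (+ suc a) ℚ./ suc b ≡ (+ a) ℚ./ suc b ℚ.+ (+ 1) ℚ./ suc b
/-suc a b = ℚP.toℚᵘ-injective
  (ℚᵘP.≃-trans (ℚP.toℚᵘ-fromℚᵘ (mkℚᵘ (+ suc a) b))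
  (ℚᵘP.≃-trans (*≡* eq)
  (ℚᵘP.≃-sym
  (ℚᵘP.≃-trans (ℚP.toℚᵘ-homo-+ ((+ a) ℚ./ suc b) ((+ 1) ℚ./ suc b))
  (ℚᵘP.+-cong (ℚP.toℚᵘ-fromℚᵘ (mkℚᵘ (+ a) b)) (ℚP.toℚᵘ-fromℚᵘ (mkℚᵘ (+ 1) b)))))))
  where
  d = + suc b
  eq : + suc a ℤ.* (d ℤ.* d) ≡ (+ a ℤ.* d ℤ.+ + 1 ℤ.* d) ℤ.* d
  eq = begin
    + suc a ℤ.* (d ℤ.* d)               ≡⟨ sym (ℤP.*-assoc (+ suc a) d d) ⟩
    + suc a ℤ.* d ℤ.* d                 ≡⟨ cong (λ z → z ℤ.* d ℤ.* d) (ℤP.+-comm (+ 1) (+ a)) ⟩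
    (+ a ℤ.+ + 1) ℤ.* d ℤ.* d           ≡⟨ cong (ℤ._* d) (ℤP.*-distribʳ-+ d (+ a) (+ 1)) ⟩
    (+ a ℤ.* d ℤ.+ + 1 ℤ.* d) ℤ.* d     ∎
    where open ≡-Reasoning

√-approx-close : ∀ n i j → √-approx n i ℚ.≤ √-approx n j ℚ.+ (+ 1) ℚ./ suc j
√-approx-close n i j = subst (√-approx n i ℚ.≤_) (/-suc t j)
  (/-mono-≤ s i (suc t) j (ℕP.<⇒≤ (ℕP.≰⇒> λ le → ℕP.<-irrefl refl (begin-strict
    (s ℕ.* J) ℕ.* (s ℕ.* J)             ≡⟨ sq s J ⟩
    (s ℕ.* s) ℕ.* (J ℕ.* J)             ≤⟨ ℕP.*-monoˡ-≤ (J ℕ.* J) (proj₁ (⌊√⌋-spec (n ℕ.* (I ℕ.* I)))) ⟩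
    n ℕ.* (I ℕ.* I) ℕ.* (J ℕ.* J)       ≡⟨ swap n (I ℕ.* I) (J ℕ.* J) ⟩
    n ℕ.* (J ℕ.* J) ℕ.* (I ℕ.* I)       <⟨ ℕP.*-monoˡ-< (I ℕ.* I) (proj₂ (⌊√⌋-spec (n ℕ.* (J ℕ.* J)))) ⟩
    suc t ℕ.* suc t ℕ.* (I ℕ.* I)       ≡⟨ sym (sq (suc t) I) ⟩
    (suc t ℕ.* I) ℕ.* (suc t ℕ.* I)     ≤⟨ ℕP.*-mono-≤ le le ⟩
    (s ℕ.* J) ℕ.* (s ℕ.* J)             ∎))))
  where
  open ℕP.≤-Reasoning
  I = suc i
  J = suc j
  s = ⌊√ n ℕ.* (I ℕ.* I) ⌋
  t = ⌊√ n ℕ.* (J ℕ.* J) ⌋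
  sq : ∀ a b → (a ℕ.* b) ℕ.* (a ℕ.* b) ≡ (a ℕ.* a) ℕ.* (b ℕ.* b)
  sq a b = ℕP.[m*n]*[o*p]≡[m*o]*[n*p] a b a b
  swap : ∀ a b c → a ℕ.* b ℕ.* c ≡ a ℕ.* c ℕ.* b
  swap a b c = trans (ℕP.*-assoc a b c)
    (trans (cong (a ℕ.*_) (ℕP.*-comm b c)) (sym (ℕP.*-assoc a c b)))

1/suc-small : ∀ ε → 0ℚ ℚ.< ε → ∃ λ N → ∀ n → N ℕ.≤ n → (+ 1) ℚ./ suc n ℚ.≤ ε
1/suc-small ε@(mkℚ (+ suc a) b _) _ = b , λ n b≤n → ℚP.toℚᵘ-cancel-≤
  (ℚᵘP.≤-respˡ-≃ (ℚᵘP.≃-sym (ℚP.toℚᵘ-fromℚᵘ (mkℚᵘ (+ 1) n)))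
  (*≤* (ℤ.+≤+ (ℕP.*-mono-≤ {1} {suc a} (ℕ.s≤s ℕ.z≤n) (ℕ.s≤s b≤n)))))
1/suc-small (mkℚ (+ zero) _ _)      (ℚ.*<* (ℤ.+<+ ()))
1/suc-small (mkℚ (ℤ.-[1+ _ ]) _ _) (ℚ.*<* ())

√ : ℕ → ℝ
√ n = mkℝ (√-approx n) λ ε 0<ε →
  let N , h = 1/suc-small ε 0<ε
  in N , λ i j N≤i N≤j → ∣x-y∣≤
    (ℚP.≤-trans (√-approx-close n i j) (ℚP.+-monoʳ-≤ (√-approx n j) (h j N≤j)))
    (ℚP.≤-trans (√-approx-close n j i) (ℚP.+-monoʳ-≤ (√-approx n i) (h i N≤i)))

√-pos : ∀ n .{{_ : ℕ.NonZero n}} → 0ʳ <ʳ √ n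
√-pos n@(suc _) = 1ℚ , ℚP.positive⁻¹ 1ℚ , 0 , λ k _ →
  let K = suc k
      s = ⌊√ n ℕ.* (K ℕ.* K) ⌋
  in subst (ℚ._≤ √-approx n k) (sym (ℚP.+-identityˡ 1ℚ))
    (/-mono-≤ 1 0 s k (subst₂ ℕ._≤_ (sym (ℕP.*-identityˡ K)) (sym (ℕP.*-identityʳ s))
      (ℕ.s≤s⁻¹ (ℕP.≰⇒> λ s<K → ℕP.<-irrefl refl (ℕP.<-≤-trans
        (proj₂ (⌊√⌋-spec (n ℕ.* (K ℕ.* K))))
        (ℕP.≤-trans (ℕP.*-mono-≤ s<K s<K) (ℕP.m≤n*m (K ℕ.* K) n)))))))

_√÷√_ : (m n : ℕ) .{{_ : ℕ.NonZero n}} → ℝ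
m √÷√ n = √ m *ʳ inv (√ n) (√-pos n)

I₁ : (m κ t : ℕ) .{{_ : ℕ.NonZero t}} → ℝ → Set
I₁ m κ 1 x = (ℕ→ℝ (m ℕ.* κ) /ʳ 2) +ʳ √ m ≤ʳ x
I₁ m κ t@(suc t-1@(suc _)) x =
    (ℕ→ℝ (m ℕ.* κ) /ʳ (2 ℕ.* t)) +ʳ (m √÷√ t) ≤ʳ x
  × x ≤ʳ (ℕ→ℝ (m ℕ.* κ) /ʳ (2 ℕ.* t-1)) -ʳ (m √÷√ t-1)

SquareFree : ℕ → Set
SquareFree n = ∀ d → d ℕ.* d ∣ n → d ≡ 1

-- ⟨ a , b , c , d ⟩ stands for a + b√p + c√q + d√p√q.  This is the field
-- ℚ(√p, √q) provided that p, q and pq are not squares.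
record K (p q : ℕ) : Set where
  constructor ⟨_,_,_,_⟩
  field
    c₁ c√p c√q c√p√q : ℚ
open K public

module _ {p q : ℕ} where

  infixl 6 _+ᴷ_
  infixl 7 _*ᴷ_

  ℚ→K : ℚ → K p q
  ℚ→K a = ⟨ a , 0ℚ , 0ℚ , 0ℚ ⟩

  0ᴷ 1ᴷ : K p q
  0ᴷ = ℚ→K 0ℚ
  1ᴷ = ℚ→K 1ℚ

  _+ᴷ_ : K p q → K p q → K p q
  ⟨ a , b , c , d ⟩ +ᴷ ⟨ a′ , b′ , c′ , d′ ⟩ =
    ⟨ a ℚ.+ a′ , b ℚ.+ b′ , c ℚ.+ c′ , d ℚ.+ d′ ⟩

  _*ᴷ_ : K p q → K p q → K p q
  ⟨ a , b , c , d ⟩ *ᴷ ⟨ a′ , b′ , c′ , d′ ⟩ =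
    ⟨ a ℚ.* a′ ℚ.+ P ℚ.* (b ℚ.* b′) ℚ.+ Q ℚ.* (c ℚ.* c′) ℚ.+ P ℚ.* Q ℚ.* (d ℚ.* d′)
    , a ℚ.* b′ ℚ.+ b ℚ.* a′ ℚ.+ Q ℚ.* (c ℚ.* d′ ℚ.+ d ℚ.* c′)
    , a ℚ.* c′ ℚ.+ c ℚ.* a′ ℚ.+ P ℚ.* (b ℚ.* d′ ℚ.+ d ℚ.* b′)
    , a ℚ.* d′ ℚ.+ d ℚ.* a′ ℚ.+ b ℚ.* c′ ℚ.+ c ℚ.* b′
    ⟩
    where
    P = ℕ→ℚ p
    Q = ℕ→ℚ q

  -- evalMonic (a₀ ∷ … ∷ aₙ₋₁ ∷ []) α = a₀ + a₁α + … + aₙ₋₁αⁿ⁻¹ + αⁿ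
  evalMonic : List ℤ → K p q → K p q
  evalMonic []       α = 1ᴷ
  evalMonic (a ∷ as) α = ℚ→K (ℤ→ℚ a) +ᴷ α *ᴷ evalMonic as α

  -- Membership in 𝒪_K: root of a monic polynomial over ℤ.
  Integral : K p q → Set
  Integral α = ∃ λ as → evalMonic as α ≡ 0ᴷ

  signed : Sign → ℝ → ℝ
  signed Sign.+ x = x
  signed Sign.- x = -ʳ x

  -- The real embedding with √p ↦ s√p and √q ↦ s′√q.
  embed : Sign → Sign → K p q → ℝ
  embed s s′ ⟨ a , b , c , d ⟩ =
    ℚ→ℝ a +ʳ ℚ→ℝ b *ʳ u +ʳ ℚ→ℝ c *ʳ v +ʳ ℚ→ℝ d *ʳ (u *ʳ v)
    where
    u = signed s (√ p)
    v = signed s′ (√ q)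

  TotallyPositive : K p q → Set
  TotallyPositive α = ∀ s s′ → 0ʳ <ʳ embed s s′ α

  _·𝒪⁺∋_ : ℕ → K p q → Set
  m ·𝒪⁺∋ β = ∃ λ α → Integral α × TotallyPositive α × β ≡ ℚ→K (ℕ→ℚ m) *ᴷ α

  SumOfSquares : K p q → Set
  SumOfSquares β = ∃ λ αs → All Integral αs × β ≡ foldr _+ᴷ_ 0ᴷ (map (λ α → α *ᴷ α) αs)

{-# OPTIONS --safe #-}
module Submission where

-- Write c = ⌈κ √p⌉ and consider m (c + κ √p) = ∑ αᵢ².  The trace of the right hand side
-- is too small for any αᵢ to involve √r, so αᵢ = aᵢ + bᵢ √p + cᵢ √q with bᵢ ∈ ℤ.  Put
-- S = ∑ bᵢ².  Comparing coefficients, Cauchy–Schwarz gives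
--   4 p S² + (m κ)² ≤ 4 m c S,   and c < κ √p + 1 turns this into   |2 S √p - m κ| < 2 √(m S).
-- But 2 S √p - m κ ≥ 2 √(m S) holds for S = t, hence for all S ≥ t, and
-- m κ - 2 S √p ≥ 2 √(m S) holds for S = t - 1, hence for all 1 ≤ S ≤ t - 1, because √p ∈ I₁.
-- The interval is nonempty once (√m/√t + √m/√(t-1))² ≤ (m κ / (2 t (t-1)))².

open import Defs
open import Data.Nat as ℕ using (ℕ; zero; suc; NonZero)
import Data.Nat.Properties as ℕP
import Data.Nat.DivMod as ℕD
open import Data.Nat.Divisibility as ℕ∣ using (_∣_; divides)
open import Data.Nat.Coprimality as Cop using (Coprime)
import Data.Nat.GCD as GCD
import Data.Nat.Tactic.RingSolver as ℕSolver
open import Data.Integer as ℤ using (ℤ; +_; ∣_∣)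
import Data.Integer.Properties as ℤP
import Data.Integer.DivMod as ℤD
import Data.Integer.Tactic.RingSolver as ℤSolver
open import Data.Rational as ℚ using (ℚ; 0ℚ; 1ℚ; mkℚ)
import Data.Rational.Properties as ℚP
open import Data.Rational.Unnormalised.Base as ℚᵘ using (mkℚᵘ; *≡*; *≤*)
import Data.Rational.Unnormalised.Properties as ℚᵘP
open import Data.List using (List; []; _∷_; map; foldr; length)
open import Data.List.Relation.Unary.All as All using (All; []; _∷_)
open import Algebra using (CommutativeRing)
open import Algebra.Structures using (IsCommutativeRing)
open import Data.Product using (∃; _×_; _,_; proj₁; proj₂)
open import Data.Sum using (_⊎_; inj₁; inj₂; [_,_]′)
open import Data.Sign using (Sign)
open import Data.Empty using (⊥; ⊥-elim)
open import Level using (0ℓ)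
open import Relation.Binary.Definitions using (tri<; tri≈; tri>)
open import Relation.Nullary using (¬_; contradiction)
open import Relation.Nullary.Decidable using (dec⇒maybe; decidable-stable; True; toWitness)
open import Relation.Binary.PropositionalEquality
open import Tactic.RingSolver using (solve-∀)
open import Tactic.RingSolver.Core.AlmostCommutativeRing using (AlmostCommutativeRing; fromCommutativeRing)

ℚ-ring : AlmostCommutativeRing 0ℓ 0ℓ
ℚ-ring = fromCommutativeRing ℚP.+-*-commutativeRing (λ x → dec⇒maybe (0ℚ ℚP.≟ x))

-- Squarefree numbers and integrality of rational numbers

module _ where
  open import Data.Nat using (_+_; _*_; _^_; _≤_; _<_)

  coprime-* : ∀ {m n o} → Coprime m n → Coprime m o → Coprime m (n * o)
  coprime-* c d (i∣m , i∣no) = d (i∣m , Cop.coprime-divisor (λ { (j∣i , j∣n) → c (ℕ∣.∣-trans j∣i i∣m , j∣n) }) i∣no)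

  coprime-^ : ∀ {m n} k → Coprime m n → Coprime (m ^ k) n
  coprime-^ zero    c = Cop.1-coprimeTo _
  coprime-^ (suc k) c = Cop.sym (coprime-* (Cop.sym c) (Cop.sym (coprime-^ k c)))

  n<2^n : ∀ n → n < 2 ^ n
  n<2^n zero    = ℕ.s≤s ℕ.z≤n
  n<2^n (suc n) = ℕP.≤-trans (ℕP.+-mono-≤ (ℕP.≤-trans (ℕ.s≤s ℕ.z≤n) (n<2^n n)) (n<2^n n))
    (ℕP.≤-reflexive (cong (λ k → 2 ^ n + k) (sym (ℕP.+-identityʳ (2 ^ n)))))

  ∣-all-powers⇒≡1 : ∀ d n .{{_ : NonZero d}} .{{_ : NonZero n}} → (∀ k → d ^ k ∣ n) → d ≡ 1
  ∣-all-powers⇒≡1 1 n h = refl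
  ∣-all-powers⇒≡1 d@(suc (suc _)) n h = contradiction
    (ℕP.≤-trans (ℕP.^-monoˡ-≤ n (ℕ.s≤s (ℕ.s≤s ℕ.z≤n))) (ℕ∣.∣⇒≤ (h n))) (ℕP.<⇒≱ (n<2^n n))

  coprime-² : ∀ {i j} → Coprime i j → Coprime (i * i) j
  coprime-² c = Cop.sym (coprime-* (Cop.sym c) (Cop.sym c))

  squareFree-* : ∀ {m n} → SquareFree m → SquareFree n → Coprime m n → SquareFree (m * n)
  squareFree-* {m} {n} sm sn m⊥n d d²∣mn =
    sn d (Cop.coprime-divisor (coprime-² d⊥m) d²∣mn)
    where
    d⊥m : Coprime d m
    d⊥m {i} (i∣d , i∣m) = sm i (Cop.coprime-divisor
      (coprime-² λ { (j∣i , j∣n) → m⊥n (ℕ∣.∣-trans j∣i i∣m , j∣n) })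
      (ℕ∣.∣-trans (ℕ∣.*-pres-∣ i∣d i∣d) (subst (d * d ∣_) (ℕP.*-comm m n) d²∣mn)))

module _ where
  open import Data.Rational using (_+_; _*_; -_; _-_; _≤_; _<_)

  toℚᵘ-ℤ→ℚ : ∀ z → ℚ.toℚᵘ (ℤ→ℚ z) ℚᵘ.≃ mkℚᵘ z 0
  toℚᵘ-ℤ→ℚ z = ℚP.toℚᵘ-fromℚᵘ (mkℚᵘ z 0)

  ℤ→ℚ-+ : ∀ a b → ℤ→ℚ (a ℤ.+ b) ≡ ℤ→ℚ a + ℤ→ℚ b
  ℤ→ℚ-+ a b = ℚP.toℚᵘ-injective (ℚᵘP.≃-trans (toℚᵘ-ℤ→ℚ (a ℤ.+ b)) (ℚᵘP.≃-trans
    (*≡* (cong (ℤ._* ℤ.1ℤ) (sym (cong₂ ℤ._+_ (ℤP.*-identityʳ a) (ℤP.*-identityʳ b)))))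
    (ℚᵘP.≃-sym (ℚᵘP.≃-trans (ℚP.toℚᵘ-homo-+ (ℤ→ℚ a) (ℤ→ℚ b)) (ℚᵘP.+-cong (toℚᵘ-ℤ→ℚ a) (toℚᵘ-ℤ→ℚ b))))))

  ℤ→ℚ-* : ∀ a b → ℤ→ℚ (a ℤ.* b) ≡ ℤ→ℚ a * ℤ→ℚ b
  ℤ→ℚ-* a b = ℚP.toℚᵘ-injective (ℚᵘP.≃-trans (toℚᵘ-ℤ→ℚ _)
    (ℚᵘP.≃-sym (ℚᵘP.≃-trans (ℚP.toℚᵘ-homo-* (ℤ→ℚ a) (ℤ→ℚ b)) (ℚᵘP.*-cong (toℚᵘ-ℤ→ℚ a) (toℚᵘ-ℤ→ℚ b)))))

  ℕ→ℚ-+ : ∀ a b → ℕ→ℚ (a ℕ.+ b) ≡ ℕ→ℚ a + ℕ→ℚ b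
  ℕ→ℚ-+ a b = trans (cong ℤ→ℚ (ℤP.pos-+ a b)) (ℤ→ℚ-+ (+ a) (+ b))

  ℕ→ℚ-* : ∀ a b → ℕ→ℚ (a ℕ.* b) ≡ ℕ→ℚ a * ℕ→ℚ b
  ℕ→ℚ-* a b = trans (cong ℤ→ℚ (ℤP.pos-* a b)) (ℤ→ℚ-* (+ a) (+ b))

  ℤ→ℚ-neg : ∀ a → ℤ→ℚ (ℤ.- a) ≡ - ℤ→ℚ a
  ℤ→ℚ-neg a = ℚP.toℚᵘ-injective (ℚᵘP.≃-trans (toℚᵘ-ℤ→ℚ _)
    (ℚᵘP.≃-sym (ℚᵘP.≃-trans (ℚP.toℚᵘ-homo‿- (ℤ→ℚ a)) (ℚᵘP.-‿cong (toℚᵘ-ℤ→ℚ a)))))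

  ℤ→ℚ-injective : ∀ a b → ℤ→ℚ a ≡ ℤ→ℚ b → a ≡ b
  ℤ→ℚ-injective a b e with ℚP./-injective-≃ (mkℚᵘ a 0) (mkℚᵘ b 0) e
  ... | *≡* e′ = trans (sym (ℤP.*-identityʳ a)) (trans e′ (ℤP.*-identityʳ b))

  ℤ→ℚ-mono-≤ : ∀ {a b} → a ℤ.≤ b → ℤ→ℚ a ≤ ℤ→ℚ b
  ℤ→ℚ-mono-≤ {a} {b} h = ℚP.toℚᵘ-cancel-≤ (ℚᵘP.≤-respˡ-≃ (ℚᵘP.≃-sym (toℚᵘ-ℤ→ℚ a))
    (ℚᵘP.≤-respʳ-≃ (ℚᵘP.≃-sym (toℚᵘ-ℤ→ℚ b)) (*≤* (ℤP.*-monoʳ-≤-nonNeg ℤ.1ℤ h))))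

  ℤ→ℚ-cancel-≤ : ∀ {a b} → ℤ→ℚ a ≤ ℤ→ℚ b → a ℤ.≤ b
  ℤ→ℚ-cancel-≤ {a} {b} h with ℚᵘP.≤-respˡ-≃ (toℚᵘ-ℤ→ℚ a) (ℚᵘP.≤-respʳ-≃ (toℚᵘ-ℤ→ℚ b) (ℚP.toℚᵘ-mono-≤ h))
  ... | *≤* h′ = subst₂ ℤ._≤_ (ℤP.*-identityʳ a) (ℤP.*-identityʳ b) h′

  IsInt : ℚ → Set
  IsInt x = ∃ λ z → x ≡ ℤ→ℚ z

  isInt-+ : ∀ {x y} → IsInt x → IsInt y → IsInt (x + y)
  isInt-+ (a , refl) (b , refl) = a ℤ.+ b , sym (ℤ→ℚ-+ a b)

  isInt-* : ∀ {x y} → IsInt x → IsInt y → IsInt (x * y)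
  isInt-* (a , refl) (b , refl) = a ℤ.* b , sym (ℤ→ℚ-* a b)

  isInt-neg : ∀ {x} → IsInt x → IsInt (- x)
  isInt-neg (a , refl) = ℤ.- a , sym (ℤ→ℚ-neg a)

  isInt-- : ∀ {x y} → IsInt x → IsInt y → IsInt (x - y)
  isInt-- a b = isInt-+ a (isInt-neg b)

  isInt-ℕ : ∀ n → IsInt (ℕ→ℚ n)
  isInt-ℕ n = + n , refl

  clearDenominator : ∀ x → ∃ λ N → ∃ λ d → NonZero d × Coprime ∣ N ∣ d × x * ℕ→ℚ d ≡ ℤ→ℚ N
  clearDenominator x@(mkℚ N d-1 N⊥d) = N , d , _ , Cop.recompute N⊥d , ℚP.toℚᵘ-injective
    (ℚᵘP.≃-trans (ℚP.toℚᵘ-homo-* x (ℕ→ℚ d)) (ℚᵘP.≃-trans (ℚᵘP.*-cong ℚᵘP.≃-refl (toℚᵘ-ℤ→ℚ (+ d)))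
    (ℚᵘP.≃-trans (*≡* eq) (ℚᵘP.≃-sym (toℚᵘ-ℤ→ℚ N)))))
    where
    d = suc d-1
    eq : N ℤ.* + d ℤ.* ℤ.1ℤ ≡ N ℤ.* + (d ℕ.* 1)
    eq = trans (ℤP.*-identityʳ _) (cong (λ e → N ℤ.* + e) (sym (ℕP.*-identityʳ d)))

  isInt-of-denominator-1 : ∀ {x} N {d} → x * ℕ→ℚ d ≡ ℤ→ℚ N → d ≡ 1 → IsInt x
  isInt-of-denominator-1 {x} N e refl = N , trans (sym (ℚP.*-identityʳ x)) e

  -- If f k = z k ∈ ℤ with f (k + 1) = x f k and x = N / d in lowest terms, then
  -- z (k + 1) d = z k N shows inductively that every power of d divides every z k.
  isInt-of-geometric : ∀ x (f : ℕ → ℚ) → (∀ k → IsInt (f k)) → (∀ k → f (suc k) ≡ x * f k) →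
                       f 0 ≢ 0ℚ → IsInt x
  isInt-of-geometric x f int step f0≢0 with clearDenominator x
  ... | N , d , d≢0 , N⊥d , xd≡N = isInt-of-denominator-1 N xd≡N
      (∣-all-powers⇒≡1 d ∣ z 0 ∣ {{d≢0}} {{ℕ.≢-nonZero λ e → f0≢0 (trans (proj₂ (int 0)) (cong ℤ→ℚ (ℤP.∣i∣≡0⇒i≡0 {z 0} e)))}}
        (λ j → divisible j 0))
    where
    z : ℕ → ℤ
    z k = proj₁ (int k)
    swap : ∀ x f d → (x * f) * d ≡ f * (x * d)
    swap = solve-∀ ℚ-ring
    rec : ∀ k → ∣ z (suc k) ∣ ℕ.* d ≡ ∣ z k ∣ ℕ.* ∣ N ∣
    rec k = trans (sym (ℤP.abs-* (z (suc k)) (+ d))) (trans (cong ∣_∣ (ℤ→ℚ-injective (z (suc k) ℤ.* + d) (z k ℤ.* N)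
      (trans (ℤ→ℚ-* (z (suc k)) (+ d)) (trans (trans (cong (_* ℕ→ℚ d) (trans (sym (proj₂ (int (suc k)))) (step k)))
      (trans (swap x (f k) (ℕ→ℚ d)) (cong₂ _*_ (proj₂ (int k)) xd≡N))) (sym (ℤ→ℚ-* (z k) N)))))) (ℤP.abs-* (z k) N))
    divisible : ∀ j k → d ℕ.^ j ∣ ∣ z k ∣
    divisible zero    k = ℕ∣.1∣ _
    divisible (suc j) k = Cop.coprime-divisor {n = ∣ N ∣} (coprime-^ (suc j) (Cop.sym N⊥d))
      (subst₂ _∣_ (ℕP.*-comm (d ℕ.^ j) d) (trans (rec k) (ℕP.*-comm ∣ z k ∣ ∣ N ∣))
        (ℕ∣.*-pres-∣ (divisible j (suc k)) ℕ∣.∣-refl))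

  isInt-of-squareFree : ∀ n x → SquareFree n → IsInt (ℕ→ℚ n * (x * x)) → IsInt x
  isInt-of-squareFree n x sf (z , nx²≡z) with clearDenominator x
  ... | N , d , d≢0 , N⊥d , xd≡N = isInt-of-denominator-1 N xd≡N (sf d
      (Cop.coprime-divisor {n = ∣ N ∣ ℕ.* ∣ N ∣}
        (coprime-* (coprime-² (Cop.sym N⊥d)) (coprime-² (Cop.sym N⊥d)))
        (divides ∣ z ∣ (trans (ℕP.*-comm (∣ N ∣ ℕ.* ∣ N ∣) n) eq))))
    where
    regroup : ∀ n x d → n * ((x * d) * (x * d)) ≡ (n * (x * x)) * (d * d)
    regroup = solve-∀ ℚ-ring
    eqℤ : + n ℤ.* (N ℤ.* N) ≡ z ℤ.* (+ d ℤ.* + d)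
    eqℤ = ℤ→ℚ-injective (+ n ℤ.* (N ℤ.* N)) (z ℤ.* (+ d ℤ.* + d)) (begin
      ℤ→ℚ (+ n ℤ.* (N ℤ.* N))               ≡⟨ trans (ℤ→ℚ-* (+ n) _) (cong (ℕ→ℚ n *_) (ℤ→ℚ-* N N)) ⟩
      ℕ→ℚ n * (ℤ→ℚ N * ℤ→ℚ N)               ≡⟨ cong (λ y → ℕ→ℚ n * (y * y)) (sym xd≡N) ⟩
      ℕ→ℚ n * ((x * ℕ→ℚ d) * (x * ℕ→ℚ d))   ≡⟨ regroup (ℕ→ℚ n) x (ℕ→ℚ d) ⟩
      (ℕ→ℚ n * (x * x)) * (ℕ→ℚ d * ℕ→ℚ d)   ≡⟨ cong₂ _*_ nx²≡z (sym (ℤ→ℚ-* (+ d) (+ d))) ⟩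
      ℤ→ℚ z * ℤ→ℚ (+ d ℤ.* + d)             ≡⟨ sym (ℤ→ℚ-* z _) ⟩
      ℤ→ℚ (z ℤ.* (+ d ℤ.* + d))             ∎)
      where open ≡-Reasoning
    eq : n ℕ.* (∣ N ∣ ℕ.* ∣ N ∣) ≡ ∣ z ∣ ℕ.* (d ℕ.* d)
    eq = trans (trans (cong (n ℕ.*_) (sym (ℤP.abs-* N N))) (sym (ℤP.abs-* (+ n) _)))
      (trans (cong ∣_∣ eqℤ) (trans (ℤP.abs-* z _) (cong (∣ z ∣ ℕ.*_) (ℤP.abs-* (+ d) (+ d)))))

module _ where
  open import Data.Integer using (_+_; _*_; _-_)

  parity : ∀ z → (∃ λ k → z ≡ + 2 * k) ⊎ (∃ λ k → z ≡ + 2 * k + + 1)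
  parity z with z ℤD.%ℕ 2 | ℤD.n%ℕd<d z 2 | ℤD.a≡a%ℕn+[a/ℕn]*n z 2
  ... | 0 | _ | e = inj₁ (z ℤD./ℕ 2 , trans e (trans (ℤP.+-identityˡ _) (ℤP.*-comm _ (+ 2))))
  ... | 1 | _ | e = inj₂ (z ℤD./ℕ 2 , trans e (trans (ℤP.+-comm (+ 1) (z ℤD./ℕ 2 * + 2)) (cong (_+ + 1) (ℤP.*-comm (z ℤD./ℕ 2) (+ 2)))))
  ... | suc (suc _) | ℕ.s≤s (ℕ.s≤s ()) | _

  residue : ∀ n i → n ℕ.% 4 ≡ i → ∃ λ l → + n ≡ + i + + 4 * l
  residue n i e = + (n ℕ./ 4) , (begin
    + n                              ≡⟨ cong +_ (ℕD.m≡m%n+[m/n]*n n 4) ⟩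
    + (n ℕ.% 4 ℕ.+ n ℕ./ 4 ℕ.* 4)    ≡⟨ cong₂ (λ a b → + (a ℕ.+ b)) e (ℕP.*-comm (n ℕ./ 4) 4) ⟩
    + (i ℕ.+ 4 ℕ.* (n ℕ./ 4))        ≡⟨ ℤP.pos-+ i _ ⟩
    + i + + (4 ℕ.* (n ℕ./ 4))        ≡⟨ cong (λ z → + i + z) (ℤP.pos-* 4 (n ℕ./ 4)) ⟩
    + i + + 4 * + (n ℕ./ 4)          ∎)
    where open ≡-Reasoning

  -- Supplying n k ≡ x - y + (i + 1) as a ring identity refutes x ≡ y modulo n.
  absurd-mod : ∀ n i k {x y} {i<n : True (suc i ℕ.<? n)} → x ≡ y → + n * k ≡ x - y + + suc i → ⊥
  absurd-mod n i k {x} {y} {i<n} x≡y e = contradiction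
    (ℕ∣.∣⇒≤ (divides ∣ k ∣ (trans (cong ∣_∣ (sym nk≡i)) (trans (ℤP.abs-* (+ n) k) (ℕP.*-comm n ∣ k ∣)))))
    (ℕP.<⇒≱ (toWitness i<n))
    where
    nk≡i : + n * k ≡ + suc i
    nk≡i = trans e (cong (_+ + suc i) (trans (cong (_- y) x≡y) (ℤP.+-inverseʳ y)))

  even-pair-2 : ∀ l A B z → A * A - (+ 2 + + 4 * l) * (B * B) ≡ + 4 * z →
                (∃ λ k → A ≡ + 2 * k) × (∃ λ k → B ≡ + 2 * k)
  even-pair-2 l A B z e with parity A | parity B
  ... | inj₁ a          | inj₁ b          = a , b
  ... | inj₁ (a , refl) | inj₂ (b , refl) = ⊥-elim (absurd-mod 4 1 _ e (id a b l z))
    where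
    id : ∀ a b l z → + 4 * (a * a - (+ 1 + + 2 * l) * (+ 2 * (b * b) + + 2 * b) - l - z) ≡
         (+ 2 * a) * (+ 2 * a) - (+ 2 + + 4 * l) * ((+ 2 * b + + 1) * (+ 2 * b + + 1)) - + 4 * z + + 2
    id = ℤSolver.solve-∀
  ... | inj₂ (a , refl) | _               = ⊥-elim (absurd-mod 2 0 _ e (id a B l z))
    where
    id : ∀ a B l z → + 2 * (+ 2 * (a * a) + + 2 * a - (+ 1 + + 2 * l) * (B * B) - + 2 * z + + 1) ≡
         (+ 2 * a + + 1) * (+ 2 * a + + 1) - (+ 2 + + 4 * l) * (B * B) - + 4 * z + + 1
    id = ℤSolver.solve-∀

  even-middle : ∀ l l′ A B C X Y → A * A + (+ 2 + + 4 * l) * (B * B) - (+ 3 + + 4 * l′) * (C * C) ≡ + 4 * X →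
                A * B ≡ + 2 * Y → ∃ λ k → B ≡ + 2 * k
  even-middle l l′ A B C X Y e AB with parity B
  ... | inj₁ b = b
  ... | inj₂ (b , refl) with parity A | parity C
  ...   | inj₂ (a , refl) | _ = ⊥-elim (absurd-mod 2 0 _ AB (id a b Y))
    where
    id : ∀ a b Y → + 2 * (+ 2 * (a * b) + a + b - Y + + 1) ≡ (+ 2 * a + + 1) * (+ 2 * b + + 1) - + 2 * Y + + 1
    id = ℤSolver.solve-∀
  ...   | inj₁ (a , refl) | inj₁ (c , refl) = ⊥-elim (absurd-mod 4 1 _ e (id a b c l l′ X))
    where
    id : ∀ a b c l l′ X → + 4 * (a * a + (+ 1 + + 2 * l) * (+ 2 * (b * b) + + 2 * b) + l - (+ 3 + + 4 * l′) * (c * c) - X + + 1) ≡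
         (+ 2 * a) * (+ 2 * a) + (+ 2 + + 4 * l) * ((+ 2 * b + + 1) * (+ 2 * b + + 1)) - (+ 3 + + 4 * l′) * ((+ 2 * c) * (+ 2 * c)) - + 4 * X + + 2
    id = ℤSolver.solve-∀
  ...   | inj₁ (a , refl) | inj₂ (c , refl) = ⊥-elim (absurd-mod 2 0 _ e (id a b c l l′ X))
    where
    id : ∀ a b c l l′ X → + 2 * (+ 2 * (a * a) + (+ 1 + + 2 * l) * ((+ 2 * b + + 1) * (+ 2 * b + + 1)) - (+ 3 + + 4 * l′) * (+ 2 * (c * c) + + 2 * c) - + 2 * l′ - + 2 * X - + 1) ≡
         (+ 2 * a) * (+ 2 * a) + (+ 2 + + 4 * l) * ((+ 2 * b + + 1) * (+ 2 * b + + 1)) - (+ 3 + + 4 * l′) * ((+ 2 * c + + 1) * (+ 2 * c + + 1)) - + 4 * X + + 1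
    id = ℤSolver.solve-∀

module _ where
  open import Data.Rational using (_+_; _*_; -_; _-_)

  2ℚ 4ℚ : ℚ
  2ℚ = ℕ→ℚ 2
  4ℚ = ℕ→ℚ 4

  x+x≡2x : ∀ x → x + x ≡ 2ℚ * x
  x+x≡2x = solve-∀ ℚ-ring

  *-distribˡ-- : ∀ x y z → x * (y - z) ≡ x * y - x * z
  *-distribˡ-- = solve-∀ ℚ-ring

  ²-distrib-* : ∀ x y → x * y * (x * y) ≡ x * x * (y * y)
  ²-distrib-* = solve-∀ ℚ-ring

  isInt-of-2*even : ∀ {x} A → 2ℚ * x ≡ ℤ→ℚ A → (∃ λ k → A ≡ + 2 ℤ.* k) → IsInt x
  isInt-of-2*even {x} A e (k , refl) = k , trans (halve x) (trans (cong (ℚ.½ *_) (trans e (ℤ→ℚ-* (+ 2) k))) (sym (halve (ℤ→ℚ k))))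
    where
    halve : ∀ x → x ≡ ℚ.½ * (2ℚ * x)
    halve = solve-∀ ℚ-ring

  isInt-quadratic : ∀ n X Y → SquareFree n → n ℕ.% 4 ≡ 2 →
                    IsInt (2ℚ * X) → IsInt (X * X - ℕ→ℚ n * (Y * Y)) → IsInt X × IsInt Y
  isInt-quadratic n X Y sf n%4≡2 2X∈ℤ norm∈ℤ =
    let A , 2X≡A = 2X∈ℤ
        Z , norm≡Z = norm∈ℤ
        B , 2Y≡B = isInt-of-squareFree n (2ℚ * Y) sf (subst IsInt (solveY (ℕ→ℚ n) X Y)
                     (isInt-- (isInt-* 2X∈ℤ 2X∈ℤ) (isInt-* (isInt-ℕ 4) norm∈ℤ)))
        l , n≡2+4l = residue n 2 n%4≡2
        eq = ℤ→ℚ-injective (A ℤ.* A ℤ.- (+ 2 ℤ.+ + 4 ℤ.* l) ℤ.* (B ℤ.* B)) (+ 4 ℤ.* Z) (begin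
          ℤ→ℚ (A ℤ.* A ℤ.- (+ 2 ℤ.+ + 4 ℤ.* l) ℤ.* (B ℤ.* B))
            ≡⟨ cong (λ N → ℤ→ℚ (A ℤ.* A ℤ.- N ℤ.* (B ℤ.* B))) (sym n≡2+4l) ⟩
          ℤ→ℚ (A ℤ.* A ℤ.- + n ℤ.* (B ℤ.* B))
            ≡⟨ hom A B ⟩
          ℤ→ℚ A * ℤ→ℚ A - ℕ→ℚ n * (ℤ→ℚ B * ℤ→ℚ B)
            ≡⟨ cong₂ (λ a b → a * a - ℕ→ℚ n * (b * b)) (sym 2X≡A) (sym 2Y≡B) ⟩
          2ℚ * X * (2ℚ * X) - ℕ→ℚ n * (2ℚ * Y * (2ℚ * Y))
            ≡⟨ collect (ℕ→ℚ n) X Y ⟩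
          4ℚ * (X * X - ℕ→ℚ n * (Y * Y))
            ≡⟨ trans (cong (4ℚ *_) norm≡Z) (sym (ℤ→ℚ-* (+ 4) Z)) ⟩
          ℤ→ℚ (+ 4 ℤ.* Z) ∎)
        A-even , B-even = even-pair-2 l A B Z eq
    in isInt-of-2*even A 2X≡A A-even , isInt-of-2*even B 2Y≡B B-even
    where
    open ≡-Reasoning
    hom : ∀ A B → ℤ→ℚ (A ℤ.* A ℤ.- + n ℤ.* (B ℤ.* B)) ≡ ℤ→ℚ A * ℤ→ℚ A - ℕ→ℚ n * (ℤ→ℚ B * ℤ→ℚ B)
    hom A B = trans (ℤ→ℚ-+ (A ℤ.* A) _) (cong₂ _+_ (ℤ→ℚ-* A A)
      (trans (ℤ→ℚ-neg (+ n ℤ.* (B ℤ.* B))) (cong -_ (trans (ℤ→ℚ-* (+ n) _) (cong (ℕ→ℚ n *_) (ℤ→ℚ-* B B))))))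
    solveY : ∀ n X Y → 2ℚ * X * (2ℚ * X) - 4ℚ * (X * X - n * (Y * Y)) ≡ n * (2ℚ * Y * (2ℚ * Y))
    solveY = solve-∀ ℚ-ring
    collect : ∀ n X Y → 2ℚ * X * (2ℚ * X) - n * (2ℚ * Y * (2ℚ * Y)) ≡ 4ℚ * (X * X - n * (Y * Y))
    collect = solve-∀ ℚ-ring

  isInt-middle : ∀ p q a b c → SquareFree q → p ℕ.% 4 ≡ 2 → q ℕ.% 4 ≡ 3 →
                 IsInt (2ℚ * a) → IsInt (2ℚ * b) → IsInt (2ℚ * (a * b)) →
                 IsInt (a * a + ℕ→ℚ p * (b * b) - ℕ→ℚ q * (c * c)) → IsInt b
  isInt-middle p q a b c sf p%4≡2 q%4≡3 2a∈ℤ 2b∈ℤ 2ab∈ℤ X∈ℤ =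
    let A , 2a≡A = 2a∈ℤ
        B , 2b≡B = 2b∈ℤ
        Y , 2ab≡Y = 2ab∈ℤ
        X , X≡ = X∈ℤ
        C , 2c≡C = isInt-of-squareFree q (2ℚ * c) sf (subst IsInt (solveC (ℕ→ℚ p) (ℕ→ℚ q) a b c)
                     (isInt-- (isInt-+ (isInt-* 2a∈ℤ 2a∈ℤ) (isInt-* (isInt-ℕ p) (isInt-* 2b∈ℤ 2b∈ℤ)))
                              (isInt-* (isInt-ℕ 4) X∈ℤ)))
        l , p≡2+4l = residue p 2 p%4≡2
        l′ , q≡3+4l′ = residue q 3 q%4≡3
        eq = ℤ→ℚ-injective (A ℤ.* A ℤ.+ (+ 2 ℤ.+ + 4 ℤ.* l) ℤ.* (B ℤ.* B) ℤ.- (+ 3 ℤ.+ + 4 ℤ.* l′) ℤ.* (C ℤ.* C)) (+ 4 ℤ.* X) (begin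
          ℤ→ℚ (A ℤ.* A ℤ.+ (+ 2 ℤ.+ + 4 ℤ.* l) ℤ.* (B ℤ.* B) ℤ.- (+ 3 ℤ.+ + 4 ℤ.* l′) ℤ.* (C ℤ.* C))
            ≡⟨ cong₂ (λ P Q → ℤ→ℚ (A ℤ.* A ℤ.+ P ℤ.* (B ℤ.* B) ℤ.- Q ℤ.* (C ℤ.* C))) (sym p≡2+4l) (sym q≡3+4l′) ⟩
          ℤ→ℚ (A ℤ.* A ℤ.+ + p ℤ.* (B ℤ.* B) ℤ.- + q ℤ.* (C ℤ.* C))
            ≡⟨ hom A B C ⟩
          ℤ→ℚ A * ℤ→ℚ A + ℕ→ℚ p * (ℤ→ℚ B * ℤ→ℚ B) - ℕ→ℚ q * (ℤ→ℚ C * ℤ→ℚ C)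
            ≡⟨ cong₂ (λ a b → a * a + ℕ→ℚ p * (b * b) - ℕ→ℚ q * (ℤ→ℚ C * ℤ→ℚ C)) (sym 2a≡A) (sym 2b≡B) ⟩
          2ℚ * a * (2ℚ * a) + ℕ→ℚ p * (2ℚ * b * (2ℚ * b)) - ℕ→ℚ q * (ℤ→ℚ C * ℤ→ℚ C)
            ≡⟨ cong (λ c → 2ℚ * a * (2ℚ * a) + ℕ→ℚ p * (2ℚ * b * (2ℚ * b)) - ℕ→ℚ q * (c * c)) (sym 2c≡C) ⟩
          2ℚ * a * (2ℚ * a) + ℕ→ℚ p * (2ℚ * b * (2ℚ * b)) - ℕ→ℚ q * (2ℚ * c * (2ℚ * c))
            ≡⟨ collect (ℕ→ℚ p) (ℕ→ℚ q) a b c ⟩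
          4ℚ * (a * a + ℕ→ℚ p * (b * b) - ℕ→ℚ q * (c * c))
            ≡⟨ trans (cong (4ℚ *_) X≡) (sym (ℤ→ℚ-* (+ 4) X)) ⟩
          ℤ→ℚ (+ 4 ℤ.* X) ∎)
        eq′ = ℤ→ℚ-injective (A ℤ.* B) (+ 2 ℤ.* Y) (begin
          ℤ→ℚ (A ℤ.* B)                ≡⟨ ℤ→ℚ-* A B ⟩
          ℤ→ℚ A * ℤ→ℚ B                ≡⟨ cong₂ _*_ (sym 2a≡A) (sym 2b≡B) ⟩
          2ℚ * a * (2ℚ * b)            ≡⟨ regroup a b ⟩
          2ℚ * (2ℚ * (a * b))          ≡⟨ trans (cong (2ℚ *_) 2ab≡Y) (sym (ℤ→ℚ-* (+ 2) Y)) ⟩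
          ℤ→ℚ (+ 2 ℤ.* Y)              ∎)
    in isInt-of-2*even B 2b≡B (even-middle l l′ A B C X Y eq eq′)
    where
    open ≡-Reasoning
    hom : ∀ A B C → ℤ→ℚ (A ℤ.* A ℤ.+ + p ℤ.* (B ℤ.* B) ℤ.- + q ℤ.* (C ℤ.* C)) ≡
                    ℤ→ℚ A * ℤ→ℚ A + ℕ→ℚ p * (ℤ→ℚ B * ℤ→ℚ B) - ℕ→ℚ q * (ℤ→ℚ C * ℤ→ℚ C)
    hom A B C = trans (ℤ→ℚ-+ (A ℤ.* A ℤ.+ + p ℤ.* (B ℤ.* B)) _) (cong₂ _+_
      (trans (ℤ→ℚ-+ (A ℤ.* A) _) (cong₂ _+_ (ℤ→ℚ-* A A) (trans (ℤ→ℚ-* (+ p) _) (cong (ℕ→ℚ p *_) (ℤ→ℚ-* B B)))))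
      (trans (ℤ→ℚ-neg (+ q ℤ.* (C ℤ.* C))) (cong -_ (trans (ℤ→ℚ-* (+ q) _) (cong (ℕ→ℚ q *_) (ℤ→ℚ-* C C))))))
    solveC : ∀ p q a b c → 2ℚ * a * (2ℚ * a) + p * (2ℚ * b * (2ℚ * b)) - 4ℚ * (a * a + p * (b * b) - q * (c * c)) ≡
                           q * (2ℚ * c * (2ℚ * c))
    solveC = solve-∀ ℚ-ring
    collect : ∀ p q a b c → 2ℚ * a * (2ℚ * a) + p * (2ℚ * b * (2ℚ * b)) - q * (2ℚ * c * (2ℚ * c)) ≡
                            4ℚ * (a * a + p * (b * b) - q * (c * c))
    collect = solve-∀ ℚ-ring
    regroup : ∀ a b → 2ℚ * a * (2ℚ * b) ≡ 2ℚ * (2ℚ * (a * b))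
    regroup = solve-∀ ℚ-ring

  *-≢0 : ∀ {x y} → x ≢ 0ℚ → y ≢ 0ℚ → x * y ≢ 0ℚ
  *-≢0 {x} {y} x≢0 y≢0 xy≡0 = y≢0 (begin
    y                   ≡⟨ sym (ℚP.*-identityˡ y) ⟩
    1ℚ * y              ≡⟨ cong (_* y) (sym (ℚP.*-inverseˡ x)) ⟩
    (ℚ.1/ x) * x * y    ≡⟨ ℚP.*-assoc (ℚ.1/ x) x y ⟩
    (ℚ.1/ x) * (x * y)  ≡⟨ cong ((ℚ.1/ x) *_) xy≡0 ⟩
    (ℚ.1/ x) * 0ℚ       ≡⟨ ℚP.*-zeroʳ (ℚ.1/ x) ⟩
    0ℚ                  ∎)
    where
    open ≡-Reasoning
    instance _ = ℚ.≢-nonZero x≢0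

  ℕ→ℚ-≢0 : ∀ n .{{_ : NonZero n}} → ℕ→ℚ n ≢ 0ℚ
  ℕ→ℚ-≢0 n e = ℕ.≢-nonZero⁻¹ n (ℤP.+-injective (ℤ→ℚ-injective (+ n) (+ 0) e))

  denominator : ∀ x → ∃ λ D → D ≢ 0ℚ × IsInt D × IsInt (D * x)
  denominator x =
    let N , d , d≢0 , _ , xd≡N = clearDenominator x
    in ℕ→ℚ d , ℕ→ℚ-≢0 d {{d≢0}} , isInt-ℕ d , N , trans (ℚP.*-comm (ℕ→ℚ d) x) xd≡N

-- Integral elements of the biquadratic field

module RingIdentities (R : CommutativeRing 0ℓ 0ℓ) where
  open CommutativeRing R using (_≈_; _+_; _*_; commutativeSemiring) renaming (refl to ≈-refl)
  open import Algebra.Solver.Ring.NaturalCoefficients.Default commutativeSemiring using (solve; _:=_; _:+_; _:*_)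

  expand-power-of-sum : ∀ D E x y a b g → ((D * x) * (E * y)) * ((a + b) * g) ≈
    ((D * (a * x)) * (E * y)) * g + ((D * x) * (E * (b * y))) * g
  expand-power-of-sum = solve 7 (λ D E x y a b g → ((D :* x) :* (E :* y)) :* ((a :+ b) :* g) :=
    (((D :* (a :* x)) :* (E :* y)) :* g :+ ((D :* x) :* (E :* (b :* y))) :* g)) ≈-refl

  expand-power-of-product : ∀ D E x y a b g → ((D * x) * (E * y)) * ((a * b) * g) ≈
    ((D * (a * x)) * (E * (b * y))) * g
  expand-power-of-product = solve 7 (λ D E x y a b g → ((D :* x) :* (E :* y)) :* ((a :* b) :* g) :=
    ((D :* (a :* x)) :* (E :* (b :* y))) :* g) ≈-refl

  swap : ∀ x y z → x * (y * z) ≈ y * (x * z)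
  swap = solve 3 (λ x y z → x :* (y :* z) := y :* (x :* z)) ≈-refl

  horner-step : ∀ x y a α e → x * (y * (a + α * e)) ≈ a * (x * y) + x * ((α * y) * e)
  horner-step = solve 5 (λ x y a α e → x :* (y :* (a :+ α :* e)) := (a :* (x :* y) :+ x :* ((α :* y) :* e))) ≈-refl

module Biquadratic (p q : ℕ) where
  open import Data.Rational using (_+_; _*_; -_; _-_)

  P Q : ℚ
  P = ℕ→ℚ p
  Q = ℕ→ℚ q

  ⟨⟩-cong : ∀ {a b c d a′ b′ c′ d′} → a ≡ a′ → b ≡ b′ → c ≡ c′ → d ≡ d′ →
            _≡_ {A = K p q} ⟨ a , b , c , d ⟩ ⟨ a′ , b′ , c′ , d′ ⟩
  ⟨⟩-cong refl refl refl refl = refl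

  -ᴷ_ : K p q → K p q
  -ᴷ ⟨ a , b , c , d ⟩ = ⟨ - a , - b , - c , - d ⟩

  *ᴷ-comm : ∀ (x y : K p q) → x *ᴷ y ≡ y *ᴷ x
  *ᴷ-comm ⟨ a , b , c , d ⟩ ⟨ a′ , b′ , c′ , d′ ⟩ = ⟨⟩-cong
    (e₁ P Q a b c d a′ b′ c′ d′) (e₂ Q a b c d a′ b′ c′ d′) (e₂ P a c b d a′ c′ b′ d′) (e₄ a b c d a′ b′ c′ d′)
    where
    e₁ : ∀ P Q a b c d a′ b′ c′ d′ →
         a * a′ + P * (b * b′) + Q * (c * c′) + P * Q * (d * d′) ≡
         a′ * a + P * (b′ * b) + Q * (c′ * c) + P * Q * (d′ * d)
    e₁ = solve-∀ ℚ-ring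
    e₂ : ∀ Q a b c d a′ b′ c′ d′ →
         a * b′ + b * a′ + Q * (c * d′ + d * c′) ≡ a′ * b + b′ * a + Q * (c′ * d + d′ * c)
    e₂ = solve-∀ ℚ-ring
    e₄ : ∀ a b c d a′ b′ c′ d′ → a * d′ + d * a′ + b * c′ + c * b′ ≡ a′ * d + d′ * a + b′ * c + c′ * b
    e₄ = solve-∀ ℚ-ring

  *ᴷ-assoc : ∀ (x y z : K p q) → (x *ᴷ y) *ᴷ z ≡ x *ᴷ (y *ᴷ z)
  *ᴷ-assoc ⟨ a , b , c , d ⟩ ⟨ a′ , b′ , c′ , d′ ⟩ ⟨ e , f , g , h ⟩ = ⟨⟩-cong
    (e₁ P Q a b c d a′ b′ c′ d′ e f g h) (e₂ P Q a b c d a′ b′ c′ d′ e f g h)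
    (e₃ P Q a b c d a′ b′ c′ d′ e f g h) (e₄ P Q a b c d a′ b′ c′ d′ e f g h)
    where
    e₁ : ∀ P Q a b c d a′ b′ c′ d′ e f g h →
      (a * a′ + P * (b * b′) + Q * (c * c′) + P * Q * (d * d′)) * e
      + P * ((a * b′ + b * a′ + Q * (c * d′ + d * c′)) * f)
      + Q * ((a * c′ + c * a′ + P * (b * d′ + d * b′)) * g)
      + P * Q * ((a * d′ + d * a′ + b * c′ + c * b′) * h) ≡
      a * (a′ * e + P * (b′ * f) + Q * (c′ * g) + P * Q * (d′ * h))
      + P * (b * (a′ * f + b′ * e + Q * (c′ * h + d′ * g)))
      + Q * (c * (a′ * g + c′ * e + P * (b′ * h + d′ * f)))
      + P * Q * (d * (a′ * h + d′ * e + b′ * g + c′ * f))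
    e₁ = solve-∀ ℚ-ring
    e₂ : ∀ P Q a b c d a′ b′ c′ d′ e f g h →
      (a * a′ + P * (b * b′) + Q * (c * c′) + P * Q * (d * d′)) * f
      + (a * b′ + b * a′ + Q * (c * d′ + d * c′)) * e
      + Q * ((a * c′ + c * a′ + P * (b * d′ + d * b′)) * h
             + (a * d′ + d * a′ + b * c′ + c * b′) * g) ≡
      a * (a′ * f + b′ * e + Q * (c′ * h + d′ * g))
      + b * (a′ * e + P * (b′ * f) + Q * (c′ * g) + P * Q * (d′ * h))
      + Q * (c * (a′ * h + d′ * e + b′ * g + c′ * f)
             + d * (a′ * g + c′ * e + P * (b′ * h + d′ * f)))
    e₂ = solve-∀ ℚ-ring
    e₃ : ∀ P Q a b c d a′ b′ c′ d′ e f g h →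
      (a * a′ + P * (b * b′) + Q * (c * c′) + P * Q * (d * d′)) * g
      + (a * c′ + c * a′ + P * (b * d′ + d * b′)) * e
      + P * ((a * b′ + b * a′ + Q * (c * d′ + d * c′)) * h
             + (a * d′ + d * a′ + b * c′ + c * b′) * f) ≡
      a * (a′ * g + c′ * e + P * (b′ * h + d′ * f))
      + c * (a′ * e + P * (b′ * f) + Q * (c′ * g) + P * Q * (d′ * h))
      + P * (b * (a′ * h + d′ * e + b′ * g + c′ * f)
             + d * (a′ * f + b′ * e + Q * (c′ * h + d′ * g)))
    e₃ = solve-∀ ℚ-ring
    e₄ : ∀ P Q a b c d a′ b′ c′ d′ e f g h →
      (a * a′ + P * (b * b′) + Q * (c * c′) + P * Q * (d * d′)) * h
      + (a * d′ + d * a′ + b * c′ + c * b′) * e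
      + (a * b′ + b * a′ + Q * (c * d′ + d * c′)) * g
      + (a * c′ + c * a′ + P * (b * d′ + d * b′)) * f ≡
      a * (a′ * h + d′ * e + b′ * g + c′ * f)
      + d * (a′ * e + P * (b′ * f) + Q * (c′ * g) + P * Q * (d′ * h))
      + b * (a′ * g + c′ * e + P * (b′ * h + d′ * f))
      + c * (a′ * f + b′ * e + Q * (c′ * h + d′ * g))
    e₄ = solve-∀ ℚ-ring

  *ᴷ-distribʳ : ∀ (z x y : K p q) → (x +ᴷ y) *ᴷ z ≡ (x *ᴷ z) +ᴷ (y *ᴷ z)
  *ᴷ-distribʳ ⟨ a , b , c , d ⟩ ⟨ a′ , b′ , c′ , d′ ⟩ ⟨ e , f , g , h ⟩ = ⟨⟩-cong
    (e₁ P Q a b c d a′ b′ c′ d′ e f g h) (e₂ Q a b c d a′ b′ c′ d′ e f g h)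
    (e₂ P a c b d a′ c′ b′ d′ e g f h) (e₄ a b c d a′ b′ c′ d′ e f g h)
    where
    e₁ : ∀ P Q a b c d a′ b′ c′ d′ e f g h →
      (a′ + e) * a + P * ((b′ + f) * b) + Q * ((c′ + g) * c) + P * Q * ((d′ + h) * d) ≡
      (a′ * a + P * (b′ * b) + Q * (c′ * c) + P * Q * (d′ * d)) +
      (e * a + P * (f * b) + Q * (g * c) + P * Q * (h * d))
    e₁ = solve-∀ ℚ-ring
    e₂ : ∀ Q a b c d a′ b′ c′ d′ e f g h →
      (a′ + e) * b + (b′ + f) * a + Q * ((c′ + g) * d + (d′ + h) * c) ≡
      (a′ * b + b′ * a + Q * (c′ * d + d′ * c)) + (e * b + f * a + Q * (g * d + h * c))
    e₂ = solve-∀ ℚ-ring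
    e₄ : ∀ a b c d a′ b′ c′ d′ e f g h →
      (a′ + e) * d + (d′ + h) * a + (b′ + f) * c + (c′ + g) * b ≡
      (a′ * d + d′ * a + b′ * c + c′ * b) + (e * d + h * a + f * c + g * b)
    e₄ = solve-∀ ℚ-ring

  *ᴷ-identityˡ : ∀ (x : K p q) → 1ᴷ *ᴷ x ≡ x
  *ᴷ-identityˡ ⟨ a , b , c , d ⟩ = ⟨⟩-cong (e₁ P Q a b c d) (e₂ Q a b c d) (e₂ P a c b d) (e₄ a b c d)
    where
    e₁ : ∀ P Q a b c d → 1ℚ * a + P * (0ℚ * b) + Q * (0ℚ * c) + P * Q * (0ℚ * d) ≡ a
    e₁ = solve-∀ ℚ-ring
    e₂ : ∀ Q a b c d → 1ℚ * b + 0ℚ * a + Q * (0ℚ * d + 0ℚ * c) ≡ b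
    e₂ = solve-∀ ℚ-ring
    e₄ : ∀ a b c d → 1ℚ * d + 0ℚ * a + 0ℚ * c + 0ℚ * b ≡ d
    e₄ = solve-∀ ℚ-ring

  K-isCommutativeRing : IsCommutativeRing {A = K p q} _≡_ _+ᴷ_ _*ᴷ_ -ᴷ_ 0ᴷ 1ᴷ
  K-isCommutativeRing = record
    { isRing = record
      { +-isAbelianGroup = record
        { isGroup = record
          { isMonoid = record
            { isSemigroup = record
              { isMagma = record { isEquivalence = isEquivalence ; ∙-cong = cong₂ _+ᴷ_ }
              ; assoc = λ x y z → ⟨⟩-cong (ℚP.+-assoc (c₁ x) (c₁ y) (c₁ z)) (ℚP.+-assoc (c√p x) (c√p y) (c√p z))
                                         (ℚP.+-assoc (c√q x) (c√q y) (c√q z)) (ℚP.+-assoc (c√p√q x) (c√p√q y) (c√p√q z))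
              }
            ; identity = (λ x → ⟨⟩-cong (ℚP.+-identityˡ (c₁ x)) (ℚP.+-identityˡ (c√p x)) (ℚP.+-identityˡ (c√q x)) (ℚP.+-identityˡ (c√p√q x)))
                       , (λ x → ⟨⟩-cong (ℚP.+-identityʳ (c₁ x)) (ℚP.+-identityʳ (c√p x)) (ℚP.+-identityʳ (c√q x)) (ℚP.+-identityʳ (c√p√q x)))
            }
          ; inverse = (λ x → ⟨⟩-cong (ℚP.+-inverseˡ (c₁ x)) (ℚP.+-inverseˡ (c√p x)) (ℚP.+-inverseˡ (c√q x)) (ℚP.+-inverseˡ (c√p√q x)))
                    , (λ x → ⟨⟩-cong (ℚP.+-inverseʳ (c₁ x)) (ℚP.+-inverseʳ (c√p x)) (ℚP.+-inverseʳ (c√q x)) (ℚP.+-inverseʳ (c√p√q x)))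
          ; ⁻¹-cong = cong -ᴷ_
          }
        ; comm = λ x y → ⟨⟩-cong (ℚP.+-comm (c₁ x) (c₁ y)) (ℚP.+-comm (c√p x) (c√p y)) (ℚP.+-comm (c√q x) (c√q y)) (ℚP.+-comm (c√p√q x) (c√p√q y))
        }
      ; *-cong = cong₂ _*ᴷ_
      ; *-assoc = *ᴷ-assoc
      ; *-identity = *ᴷ-identityˡ , λ x → trans (*ᴷ-comm x 1ᴷ) (*ᴷ-identityˡ x)
      ; distrib = (λ x y z → trans (*ᴷ-comm x (y +ᴷ z)) (trans (*ᴷ-distribʳ x y z) (cong₂ _+ᴷ_ (*ᴷ-comm y x) (*ᴷ-comm z x))))
                , *ᴷ-distribʳ
      }
    ; *-comm = *ᴷ-comm
    }

  K-commutativeRing : CommutativeRing 0ℓ 0ℓ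
  K-commutativeRing = record { isCommutativeRing = K-isCommutativeRing }

  open RingIdentities K-commutativeRing

  *ᴷ-identityʳ : ∀ (x : K p q) → x *ᴷ 1ᴷ ≡ x
  *ᴷ-identityʳ = CommutativeRing.*-identityʳ K-commutativeRing

  *ᴷ-zeroʳ : ∀ (x : K p q) → x *ᴷ 0ᴷ ≡ 0ᴷ
  *ᴷ-zeroʳ = CommutativeRing.zeroʳ K-commutativeRing

  infixr 8 _^ᴷ_
  _^ᴷ_ : K p q → ℕ → K p q
  α ^ᴷ zero  = 1ᴷ
  α ^ᴷ suc k = α *ᴷ α ^ᴷ k

  ℚ→K-* : ∀ x y → ℚ→K {p} {q} x *ᴷ ℚ→K y ≡ ℚ→K (x * y)
  ℚ→K-* x y = ⟨⟩-cong (e₁ P Q x y) (e₂ Q x y) (e₂ P x y) (e₄ x y)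
    where
    e₁ : ∀ P Q x y → x * y + P * (0ℚ * 0ℚ) + Q * (0ℚ * 0ℚ) + P * Q * (0ℚ * 0ℚ) ≡ x * y
    e₁ = solve-∀ ℚ-ring
    e₂ : ∀ Q x y → x * 0ℚ + 0ℚ * y + Q * (0ℚ * 0ℚ + 0ℚ * 0ℚ) ≡ 0ℚ
    e₂ = solve-∀ ℚ-ring
    e₄ : ∀ x y → x * 0ℚ + 0ℚ * y + 0ℚ * 0ℚ + 0ℚ * 0ℚ ≡ 0ℚ
    e₄ = solve-∀ ℚ-ring

  IsIntᴷ : K p q → Set
  IsIntᴷ ⟨ a , b , c , d ⟩ = IsInt a × IsInt b × IsInt c × IsInt d

  isIntᴷ-+ : ∀ {x y} → IsIntᴷ x → IsIntᴷ y → IsIntᴷ (x +ᴷ y)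
  isIntᴷ-+ (a , b , c , d) (a′ , b′ , c′ , d′) = isInt-+ a a′ , isInt-+ b b′ , isInt-+ c c′ , isInt-+ d d′

  isIntᴷ-* : ∀ {x y} → IsIntᴷ x → IsIntᴷ y → IsIntᴷ (x *ᴷ y)
  isIntᴷ-* (a , b , c , d) (a′ , b′ , c′ , d′) =
      isInt-+ (isInt-+ (isInt-+ (isInt-* a a′) (isInt-* P∈ℤ (isInt-* b b′))) (isInt-* Q∈ℤ (isInt-* c c′)))
        (isInt-* (isInt-* P∈ℤ Q∈ℤ) (isInt-* d d′))
    , isInt-+ (isInt-+ (isInt-* a b′) (isInt-* b a′)) (isInt-* Q∈ℤ (isInt-+ (isInt-* c d′) (isInt-* d c′)))
    , isInt-+ (isInt-+ (isInt-* a c′) (isInt-* c a′)) (isInt-* P∈ℤ (isInt-+ (isInt-* b d′) (isInt-* d b′)))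
    , isInt-+ (isInt-+ (isInt-+ (isInt-* a d′) (isInt-* d a′)) (isInt-* b c′)) (isInt-* c b′)
    where
    P∈ℤ = isInt-ℕ p
    Q∈ℤ = isInt-ℕ q

  isIntᴷ-ℤ : ∀ z → IsIntᴷ (ℚ→K (ℤ→ℚ z))
  isIntᴷ-ℤ z = (z , refl) , (+ 0 , refl) , (+ 0 , refl) , (+ 0 , refl)

  -- Unlike Integral, this is visibly preserved by sums, products and conjugation.
  AlmostIntegral : K p q → Set
  AlmostIntegral α = ∃ λ D → D ≢ 0ℚ × ∀ k → IsIntᴷ (ℚ→K D *ᴷ α ^ᴷ k)

  almostIntegral-+ : ∀ {α β} → AlmostIntegral α → AlmostIntegral β → AlmostIntegral (α +ᴷ β)
  almostIntegral-+ {α} {β} (D , D≢0 , int-α) (E , E≢0 , int-β) = D * E , *-≢0 D≢0 E≢0 , λ k →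
    subst IsIntᴷ (cong (_*ᴷ (α +ᴷ β) ^ᴷ k) (trans (cong₂ _*ᴷ_ (*ᴷ-identityʳ (ℚ→K D)) (*ᴷ-identityʳ (ℚ→K E))) (ℚ→K-* D E)))
      (go k 0 0)
    where
    go : ∀ k i j → IsIntᴷ (((ℚ→K D *ᴷ α ^ᴷ i) *ᴷ (ℚ→K E *ᴷ β ^ᴷ j)) *ᴷ (α +ᴷ β) ^ᴷ k)
    go zero    i j = subst IsIntᴷ (sym (*ᴷ-identityʳ _)) (isIntᴷ-* (int-α i) (int-β j))
    go (suc k) i j = subst IsIntᴷ
      (sym (expand-power-of-sum (ℚ→K D) (ℚ→K E) (α ^ᴷ i) (β ^ᴷ j) α β ((α +ᴷ β) ^ᴷ k)))
      (isIntᴷ-+ (go k (suc i) j) (go k i (suc j)))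

  almostIntegral-* : ∀ {α β} → AlmostIntegral α → AlmostIntegral β → AlmostIntegral (α *ᴷ β)
  almostIntegral-* {α} {β} (D , D≢0 , int-α) (E , E≢0 , int-β) = D * E , *-≢0 D≢0 E≢0 , λ k →
    subst IsIntᴷ (cong (_*ᴷ (α *ᴷ β) ^ᴷ k) (trans (cong₂ _*ᴷ_ (*ᴷ-identityʳ (ℚ→K D)) (*ᴷ-identityʳ (ℚ→K E))) (ℚ→K-* D E)))
      (go k 0 0)
    where
    go : ∀ k i j → IsIntᴷ (((ℚ→K D *ᴷ α ^ᴷ i) *ᴷ (ℚ→K E *ᴷ β ^ᴷ j)) *ᴷ (α *ᴷ β) ^ᴷ k)
    go zero    i j = subst IsIntᴷ (sym (*ᴷ-identityʳ _)) (isIntᴷ-* (int-α i) (int-β j))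
    go (suc k) i j = subst IsIntᴷ
      (sym (expand-power-of-product (ℚ→K D) (ℚ→K E) (α ^ᴷ i) (β ^ᴷ j) α β ((α *ᴷ β) ^ᴷ k)))
      (go k (suc i) (suc j))

  σ-√p σ-√q : K p q → K p q
  σ-√p ⟨ a , b , c , d ⟩ = ⟨ a , - b , c , - d ⟩
  σ-√q ⟨ a , b , c , d ⟩ = ⟨ a , b , - c , - d ⟩

  σ-√p-* : ∀ x y → σ-√p (x *ᴷ y) ≡ σ-√p x *ᴷ σ-√p y
  σ-√p-* ⟨ a , b , c , d ⟩ ⟨ a′ , b′ , c′ , d′ ⟩ = ⟨⟩-cong
    (e₁ P Q a b c d a′ b′ c′ d′) (e₂ Q a b c d a′ b′ c′ d′) (e₃ P a b c d a′ b′ c′ d′) (e₄ a b c d a′ b′ c′ d′)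
    where
    e₁ : ∀ P Q a b c d a′ b′ c′ d′ → a * a′ + P * (b * b′) + Q * (c * c′) + P * Q * (d * d′) ≡
         a * a′ + P * (- b * - b′) + Q * (c * c′) + P * Q * (- d * - d′)
    e₁ = solve-∀ ℚ-ring
    e₂ : ∀ Q a b c d a′ b′ c′ d′ → - (a * b′ + b * a′ + Q * (c * d′ + d * c′)) ≡
         a * - b′ + - b * a′ + Q * (c * - d′ + - d * c′)
    e₂ = solve-∀ ℚ-ring
    e₃ : ∀ P a b c d a′ b′ c′ d′ → a * c′ + c * a′ + P * (b * d′ + d * b′) ≡
         a * c′ + c * a′ + P * (- b * - d′ + - d * - b′)
    e₃ = solve-∀ ℚ-ring
    e₄ : ∀ a b c d a′ b′ c′ d′ → - (a * d′ + d * a′ + b * c′ + c * b′) ≡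
         a * - d′ + - d * a′ + - b * c′ + c * - b′
    e₄ = solve-∀ ℚ-ring

  σ-√q-* : ∀ x y → σ-√q (x *ᴷ y) ≡ σ-√q x *ᴷ σ-√q y
  σ-√q-* ⟨ a , b , c , d ⟩ ⟨ a′ , b′ , c′ , d′ ⟩ = ⟨⟩-cong
    (e₁ P Q a b c d a′ b′ c′ d′) (e₂ Q a b c d a′ b′ c′ d′) (e₃ P a b c d a′ b′ c′ d′) (e₄ a b c d a′ b′ c′ d′)
    where
    e₁ : ∀ P Q a b c d a′ b′ c′ d′ → a * a′ + P * (b * b′) + Q * (c * c′) + P * Q * (d * d′) ≡
         a * a′ + P * (b * b′) + Q * (- c * - c′) + P * Q * (- d * - d′)
    e₁ = solve-∀ ℚ-ring
    e₂ : ∀ Q a b c d a′ b′ c′ d′ → a * b′ + b * a′ + Q * (c * d′ + d * c′) ≡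
         a * b′ + b * a′ + Q * (- c * - d′ + - d * - c′)
    e₂ = solve-∀ ℚ-ring
    e₃ : ∀ P a b c d a′ b′ c′ d′ → - (a * c′ + c * a′ + P * (b * d′ + d * b′)) ≡
         a * - c′ + - c * a′ + P * (b * - d′ + - d * b′)
    e₃ = solve-∀ ℚ-ring
    e₄ : ∀ a b c d a′ b′ c′ d′ → - (a * d′ + d * a′ + b * c′ + c * b′) ≡
         a * - d′ + - d * a′ + b * - c′ + - c * b′
    e₄ = solve-∀ ℚ-ring

  almostIntegral-σ : (σ : K p q → K p q) → (∀ x → σ (ℚ→K x) ≡ ℚ→K x) → (∀ x y → σ (x *ᴷ y) ≡ σ x *ᴷ σ y) →
                     (∀ {x} → IsIntᴷ x → IsIntᴷ (σ x)) → ∀ {α} → AlmostIntegral α → AlmostIntegral (σ α)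
  almostIntegral-σ σ fixed σ-* σ-int {α} (D , D≢0 , int) = D , D≢0 , λ k → subst IsIntᴷ
    (trans (σ-* (ℚ→K D) (α ^ᴷ k)) (cong₂ _*ᴷ_ (fixed D) (σ-^ k))) (σ-int (int k))
    where
    σ-^ : ∀ k → σ (α ^ᴷ k) ≡ σ α ^ᴷ k
    σ-^ zero    = fixed 1ℚ
    σ-^ (suc k) = trans (σ-* α (α ^ᴷ k)) (cong (σ α *ᴷ_) (σ-^ k))

  almostIntegral-σ-√p : ∀ {α} → AlmostIntegral α → AlmostIntegral (σ-√p α)
  almostIntegral-σ-√p = almostIntegral-σ σ-√p (λ _ → refl) σ-√p-*
    (λ (a , b , c , d) → a , isInt-neg b , c , isInt-neg d)

  almostIntegral-σ-√q : ∀ {α} → AlmostIntegral α → AlmostIntegral (σ-√q α)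
  almostIntegral-σ-√q = almostIntegral-σ σ-√q (λ _ → refl) σ-√q-*
    (λ (a , b , c , d) → a , b , isInt-neg c , isInt-neg d)

  isInt-of-almostIntegral : ∀ {x} → AlmostIntegral (ℚ→K x) → IsInt x
  isInt-of-almostIntegral {x} (D , D≢0 , int) = isInt-of-geometric x f
    (λ k → proj₁ (subst IsIntᴷ (power k) (int k))) (λ _ → refl) D≢0
    where
    f : ℕ → ℚ
    f zero    = D
    f (suc k) = x * f k
    power : ∀ k → ℚ→K D *ᴷ ℚ→K x ^ᴷ k ≡ ℚ→K (f k)
    power zero    = *ᴷ-identityʳ (ℚ→K D)
    power (suc k) = trans (swap (ℚ→K D) (ℚ→K x) (ℚ→K x ^ᴷ k)) (trans (cong (ℚ→K x *ᴷ_) (power k)) (ℚ→K-* x (f k)))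

  isIntᴷ-cancelˡ : ∀ {u v : K p q} → IsIntᴷ (u +ᴷ v) → IsIntᴷ u → IsIntᴷ v
  isIntᴷ-cancelˡ {⟨ a , b , c , d ⟩} {⟨ a′ , b′ , c′ , d′ ⟩} (e , f , g , h) (e′ , f′ , g′ , h′) =
    go a a′ e e′ , go b b′ f f′ , go c c′ g g′ , go d d′ h h′
    where
    id : ∀ x y → x + y - x ≡ y
    id = solve-∀ ℚ-ring
    go : ∀ x y → IsInt (x + y) → IsInt x → IsInt y
    go x y i j = subst IsInt (id x y) (isInt-- i j)

  horner : ∀ D as α k → (∀ i → i ℕ.< length as → IsIntᴷ (D *ᴷ α ^ᴷ (i ℕ.+ k))) →
           IsIntᴷ (D *ᴷ (α ^ᴷ k *ᴷ evalMonic as α)) → IsIntᴷ (D *ᴷ α ^ᴷ (length as ℕ.+ k))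
  horner D []       α k below total = subst (λ x → IsIntᴷ (D *ᴷ x)) (*ᴷ-identityʳ (α ^ᴷ k)) total
  horner D (a ∷ as) α k below total = subst (λ j → IsIntᴷ (D *ᴷ α ^ᴷ j)) (ℕP.+-suc (length as) k)
    (horner D as α (suc k)
      (λ i i<n → subst (λ j → IsIntᴷ (D *ᴷ α ^ᴷ j)) (sym (ℕP.+-suc i k)) (below (suc i) (ℕ.s≤s i<n)))
      (isIntᴷ-cancelˡ (subst IsIntᴷ (horner-step D (α ^ᴷ k) (ℚ→K (ℤ→ℚ a)) α (evalMonic as α)) total)
        (isIntᴷ-* (isIntᴷ-ℤ a) (below 0 (ℕ.s≤s ℕ.z≤n)))))

  ℚ→K-scale : ∀ x (y : K p q) → ℚ→K x *ᴷ y ≡ ⟨ x * c₁ y , x * c√p y , x * c√q y , x * c√p√q y ⟩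
  ℚ→K-scale x ⟨ a , b , c , d ⟩ = ⟨⟩-cong (e₁ P Q x a b c d) (e₂ Q x a b c d) (e₂ P x a c b d) (e₄ x a b c d)
    where
    e₁ : ∀ P Q x a b c d → x * a + P * (0ℚ * b) + Q * (0ℚ * c) + P * Q * (0ℚ * d) ≡ x * a
    e₁ = solve-∀ ℚ-ring
    e₂ : ∀ Q x a b c d → x * b + 0ℚ * a + Q * (0ℚ * d + 0ℚ * c) ≡ x * b
    e₂ = solve-∀ ℚ-ring
    e₄ : ∀ x a b c d → x * d + 0ℚ * a + 0ℚ * c + 0ℚ * b ≡ x * d
    e₄ = solve-∀ ℚ-ring

  denominatorᴷ : ∀ (x : K p q) → ∃ λ D → D ≢ 0ℚ × IsInt D × IsIntᴷ (ℚ→K D *ᴷ x)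
  denominatorᴷ x@(⟨ a , b , c , d ⟩) =
    let A , A≢0 , A∈ℤ , Aa∈ℤ = denominator a
        B , B≢0 , B∈ℤ , Bb∈ℤ = denominator b
        C , C≢0 , C∈ℤ , Cc∈ℤ = denominator c
        D , D≢0 , D∈ℤ , Dd∈ℤ = denominator d
        AB∈ℤ = isInt-* A∈ℤ B∈ℤ
        CD∈ℤ = isInt-* C∈ℤ D∈ℤ
    in A * B * (C * D) , *-≢0 (*-≢0 A≢0 B≢0) (*-≢0 C≢0 D≢0) , isInt-* AB∈ℤ CD∈ℤ ,
       subst IsIntᴷ (sym (ℚ→K-scale (A * B * (C * D)) x))
         ( subst IsInt (e₁ A B C D a) (isInt-* (isInt-* B∈ℤ CD∈ℤ) Aa∈ℤ)
         , subst IsInt (e₂ A B C D b) (isInt-* (isInt-* A∈ℤ CD∈ℤ) Bb∈ℤ)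
         , subst IsInt (e₃ A B C D c) (isInt-* (isInt-* AB∈ℤ D∈ℤ) Cc∈ℤ)
         , subst IsInt (e₄ A B C D d) (isInt-* (isInt-* AB∈ℤ C∈ℤ) Dd∈ℤ) )
    where
    e₁ : ∀ A B C D x → B * (C * D) * (A * x) ≡ A * B * (C * D) * x
    e₁ = solve-∀ ℚ-ring
    e₂ : ∀ A B C D x → A * (C * D) * (B * x) ≡ A * B * (C * D) * x
    e₂ = solve-∀ ℚ-ring
    e₃ : ∀ A B C D x → A * B * D * (C * x) ≡ A * B * (C * D) * x
    e₃ = solve-∀ ℚ-ring
    e₄ : ∀ A B C D x → A * B * C * (D * x) ≡ A * B * (C * D) * x
    e₄ = solve-∀ ℚ-ring

  denominator-powers : ∀ α n → ∃ λ D → D ≢ 0ℚ × IsInt D × (∀ i → i ℕ.< n → IsIntᴷ (ℚ→K D *ᴷ α ^ᴷ i))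
  denominator-powers α zero    = 1ℚ , ℚP.1≢0 , isInt-ℕ 1 , λ _ ()
  denominator-powers α (suc n) =
    let D , D≢0 , D∈ℤ , below = denominator-powers α n
        E , E≢0 , (e , E≡e) , at-n = denominatorᴷ (α ^ᴷ n)
    in D * E , *-≢0 D≢0 E≢0 , isInt-* D∈ℤ (e , E≡e) , λ i i<1+n → subst IsIntᴷ
      (trans (sym (*ᴷ-assoc (ℚ→K D) (ℚ→K E) (α ^ᴷ i))) (cong (_*ᴷ α ^ᴷ i) (ℚ→K-* D E)))
      (case i D E D∈ℤ (e , E≡e) i<1+n below at-n)
    where
    case : ∀ i D E → IsInt D → IsInt E → i ℕ.< suc n → (∀ i → i ℕ.< n → IsIntᴷ (ℚ→K D *ᴷ α ^ᴷ i)) →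
           IsIntᴷ (ℚ→K E *ᴷ α ^ᴷ n) → IsIntᴷ (ℚ→K D *ᴷ (ℚ→K E *ᴷ α ^ᴷ i))
    case i D E (D′ , refl) (E′ , refl) i<1+n below at-n with ℕP.m≤n⇒m<n∨m≡n (ℕ.s≤s⁻¹ i<1+n)
    ... | inj₁ i<n  = subst IsIntᴷ (swap (ℚ→K E) (ℚ→K D) (α ^ᴷ i)) (isIntᴷ-* (isIntᴷ-ℤ E′) (below i i<n))
    ... | inj₂ refl = isIntᴷ-* (isIntᴷ-ℤ D′) at-n

  almostIntegral : ∀ {α} → Integral α → AlmostIntegral α
  almostIntegral {α} (as , root) =
    let D , D≢0 , _ , below = denominator-powers α (length as)
    in D , D≢0 , λ k → go D below (suc k) k (ℕP.m≤n+m (suc k) (length as))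
    where
    go : ∀ D → (∀ i → i ℕ.< length as → IsIntᴷ (ℚ→K D *ᴷ α ^ᴷ i)) →
         ∀ k i → i ℕ.< length as ℕ.+ k → IsIntᴷ (ℚ→K D *ᴷ α ^ᴷ i)
    go D below zero    i i< = below i (subst (i ℕ.<_) (ℕP.+-identityʳ (length as)) i<)
    go D below (suc k) i i< with ℕP.m≤n⇒m<n∨m≡n (ℕ.s≤s⁻¹ (subst (i ℕ.<_) (ℕP.+-suc (length as) k) i<))
    ... | inj₁ i<n+k = go D below k i i<n+k
    ... | inj₂ refl  = horner (ℚ→K D) as α k (λ j j<n → go D below k (j ℕ.+ k) (ℕP.+-monoˡ-< k j<n))
      (subst IsIntᴷ (sym (trans (cong (λ x → ℚ→K D *ᴷ (α ^ᴷ k *ᴷ x)) root)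
        (trans (cong (ℚ→K D *ᴷ_) (*ᴷ-zeroʳ (α ^ᴷ k))) (*ᴷ-zeroʳ (ℚ→K D))))) (isIntᴷ-ℤ (+ 0)))

  isInt-trace-norm-√p : ∀ x y → AlmostIntegral ⟨ x , y , 0ℚ , 0ℚ ⟩ → IsInt (2ℚ * x) × IsInt (x * x - P * (y * y))
  isInt-trace-norm-√p x y ai =
      isInt-of-almostIntegral (subst AlmostIntegral (⟨⟩-cong (x+x≡2x x) (ℚP.+-inverseʳ y) refl refl) (almostIntegral-+ ai ai′))
    , isInt-of-almostIntegral (subst AlmostIntegral (⟨⟩-cong (e₁ P Q x y) (e₂ Q x y) (e₃ P x y) (e₄ x y)) (almostIntegral-* ai ai′))
    where
    ai′ = almostIntegral-σ-√p ai
    e₁ : ∀ P Q x y → x * x + P * (y * - y) + Q * (0ℚ * 0ℚ) + P * Q * (0ℚ * 0ℚ) ≡ x * x - P * (y * y)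
    e₁ = solve-∀ ℚ-ring
    e₂ : ∀ Q x y → x * - y + y * x + Q * (0ℚ * 0ℚ + 0ℚ * 0ℚ) ≡ 0ℚ
    e₂ = solve-∀ ℚ-ring
    e₃ : ∀ P x y → x * 0ℚ + 0ℚ * x + P * (y * 0ℚ + 0ℚ * - y) ≡ 0ℚ
    e₃ = solve-∀ ℚ-ring
    e₄ : ∀ x y → x * 0ℚ + 0ℚ * x + y * 0ℚ + 0ℚ * - y ≡ 0ℚ
    e₄ = solve-∀ ℚ-ring

  isInt-trace-norm-√p√q : ∀ x w → AlmostIntegral ⟨ x , 0ℚ , 0ℚ , w ⟩ → IsInt (2ℚ * x) × IsInt (x * x - P * Q * (w * w))
  isInt-trace-norm-√p√q x w ai =
      isInt-of-almostIntegral (subst AlmostIntegral (⟨⟩-cong (x+x≡2x x) refl refl (ℚP.+-inverseʳ w)) (almostIntegral-+ ai ai′))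
    , isInt-of-almostIntegral (subst AlmostIntegral (⟨⟩-cong (e₁ P Q x w) (e₂ Q x w) (e₂ P x w) (e₄ x w)) (almostIntegral-* ai ai′))
    where
    ai′ = almostIntegral-σ-√p ai
    e₁ : ∀ P Q x w → x * x + P * (0ℚ * 0ℚ) + Q * (0ℚ * 0ℚ) + P * Q * (w * - w) ≡ x * x - P * Q * (w * w)
    e₁ = solve-∀ ℚ-ring
    e₂ : ∀ Q x w → x * 0ℚ + 0ℚ * x + Q * (0ℚ * - w + w * 0ℚ) ≡ 0ℚ
    e₂ = solve-∀ ℚ-ring
    e₄ : ∀ x w → x * - w + w * x + 0ℚ * 0ℚ + 0ℚ * 0ℚ ≡ 0ℚ
    e₄ = solve-∀ ℚ-ring

  integral-√p√q-coordinate : ∀ {g r} → SquareFree r → r ℕ.% 4 ≡ 2 → r ℕ.* (g ℕ.* g) ≡ p ℕ.* q →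
                             ∀ {α : K p q} → Integral α → IsInt (ℕ→ℚ g * (2ℚ * c√p√q α))
  integral-√p√q-coordinate {g} {r} r-sf r%4≡2 rg²≡pq {α@(⟨ a , b , c , d ⟩)} int =
    let ai = almostIntegral int
        tr , nm = isInt-trace-norm-√p√q (2ℚ * a) (2ℚ * d) (subst AlmostIntegral
                    (⟨⟩-cong (x+x≡2x a) (ℚP.+-inverseʳ b) (ℚP.+-inverseʳ c) (t d))
                    (almostIntegral-+ ai (almostIntegral-σ-√p (almostIntegral-σ-√q ai))))
    in proj₂ (isInt-quadratic r (2ℚ * a) (ℕ→ℚ g * (2ℚ * d)) r-sf r%4≡2 tr
         (subst IsInt (cong (λ z → 2ℚ * a * (2ℚ * a) - z) (trans (cong (_* (2ℚ * d * (2ℚ * d))) (sym PQ)) (regroup (ℕ→ℚ r) (ℕ→ℚ g) (2ℚ * d)))) nm))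
    where
    t : ∀ y → y + - - y ≡ 2ℚ * y
    t = solve-∀ ℚ-ring
    regroup : ∀ r g w → r * (g * g) * (w * w) ≡ r * ((g * w) * (g * w))
    regroup = solve-∀ ℚ-ring
    PQ : ℕ→ℚ r * (ℕ→ℚ g * ℕ→ℚ g) ≡ P * Q
    PQ = trans (cong (ℕ→ℚ r *_) (sym (ℕ→ℚ-* g g))) (trans (sym (ℕ→ℚ-* r (g ℕ.* g))) (trans (cong ℕ→ℚ rg²≡pq) (ℕ→ℚ-* p q)))

  integral-√p-coordinate : SquareFree p → SquareFree q → p ℕ.% 4 ≡ 2 → q ℕ.% 4 ≡ 3 →
                           ∀ {α : K p q} → Integral α → c√p√q α ≡ 0ℚ → IsInt (c√p α)
  integral-√p-coordinate p-sf q-sf p%4≡2 q%4≡3 {⟨ a , b , c , d ⟩} int refl =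
    let ai = almostIntegral int
        ai′ = almostIntegral-σ-√q ai
        2a∈ℤ , 2b∈ℤ = sum-coordinates (subst AlmostIntegral (⟨⟩-cong (x+x≡2x a) (x+x≡2x b) (ℚP.+-inverseʳ c) refl) (almostIntegral-+ ai ai′))
        nm∈ℤ , 2ab∈ℤ = sum-coordinates (subst AlmostIntegral
          (⟨⟩-cong (e₁ P Q a b c) (e₂ Q a b c) (e₃ P a b c) (e₄ a b c)) (almostIntegral-* ai ai′))
    in isInt-middle p q a b c q-sf p%4≡2 q%4≡3 2a∈ℤ 2b∈ℤ 2ab∈ℤ nm∈ℤ
    where
    sum-coordinates : ∀ {x y} → AlmostIntegral ⟨ x , y , 0ℚ , 0ℚ ⟩ → IsInt x × IsInt y
    sum-coordinates {x} {y} ai = let tr , nm = isInt-trace-norm-√p x y ai in isInt-quadratic p x y p-sf p%4≡2 tr nm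
    e₁ : ∀ P Q a b c → a * a + P * (b * b) + Q * (c * - c) + P * Q * (0ℚ * - 0ℚ) ≡ a * a + P * (b * b) - Q * (c * c)
    e₁ = solve-∀ ℚ-ring
    e₂ : ∀ Q a b c → a * b + b * a + Q * (c * - 0ℚ + 0ℚ * - c) ≡ 2ℚ * (a * b)
    e₂ = solve-∀ ℚ-ring
    e₃ : ∀ P a b c → a * - c + c * a + P * (b * - 0ℚ + 0ℚ * b) ≡ 0ℚ
    e₃ = solve-∀ ℚ-ring
    e₄ : ∀ a b c → a * - 0ℚ + 0ℚ * a + b * - c + c * b ≡ 0ℚ
    e₄ = solve-∀ ℚ-ring

-- Limits of rational sequences

module _ where
  open import Data.Rational using (_+_; _*_; -_; _-_; _≤_; _<_)

  x≤y⇒0≤y-x : ∀ {x y} → x ≤ y → 0ℚ ≤ y - x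
  x≤y⇒0≤y-x {x} {y} x≤y = subst (_≤ y - x) (ℚP.+-inverseʳ x) (ℚP.+-monoˡ-≤ (- x) x≤y)

  0≤y-x⇒x≤y : ∀ {x y} → 0ℚ ≤ y - x → x ≤ y
  0≤y-x⇒x≤y {x} {y} 0≤ = subst₂ _≤_ (ℚP.+-identityʳ x) (id x y) (ℚP.+-monoʳ-≤ x 0≤)
    where
    id : ∀ x y → x + (y - x) ≡ y
    id = solve-∀ ℚ-ring

  0≤+ : ∀ {x y} → 0ℚ ≤ x → 0ℚ ≤ y → 0ℚ ≤ x + y
  0≤+ = ℚP.+-mono-≤

  0≤* : ∀ {x y} → 0ℚ ≤ x → 0ℚ ≤ y → 0ℚ ≤ x * y
  0≤* {x} {y} 0≤x 0≤y = subst (_≤ x * y) (ℚP.*-zeroʳ x) (ℚP.*-monoˡ-≤-nonNeg x {{ℚ.nonNegative 0≤x}} 0≤y)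

  0≤² : ∀ x → 0ℚ ≤ x * x
  0≤² x with ℚP.≤-total 0ℚ x
  ... | inj₁ 0≤x = 0≤* 0≤x 0≤x
  ... | inj₂ x≤0 = subst (0ℚ ≤_) (neg² x) (0≤* (ℚP.neg-antimono-≤ x≤0) (ℚP.neg-antimono-≤ x≤0))
    where
    neg² : ∀ x → - x * - x ≡ x * x
    neg² = solve-∀ ℚ-ring

  ²-mono-≤ : ∀ {x y} → 0ℚ ≤ x → x ≤ y → x * x ≤ y * y
  ²-mono-≤ 0≤x x≤y = *-mono-≤₀ 0≤x (ℚP.≤-trans 0≤x x≤y) x≤y x≤y

  ²-mono-< : ∀ {x y} → 0ℚ ≤ x → x < y → x * x < y * y
  ²-mono-< {x} {y} 0≤x x<y = ℚP.≤-<-trans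
    (ℚP.*-monoˡ-≤-nonNeg x {{ℚ.nonNegative 0≤x}} (ℚP.<⇒≤ x<y))
    (ℚP.*-monoˡ-<-pos y {{ℚ.positive (ℚP.≤-<-trans 0≤x x<y)}} x<y)

  ²-cancel-≤ : ∀ {x y} → 0ℚ ≤ y → x * x ≤ y * y → x ≤ y
  ²-cancel-≤ {x} {y} 0≤y x²≤y² with ℚP.<-cmp y x
  ... | tri< y<x _ _ = contradiction (ℚP.<-≤-trans (²-mono-< 0≤y y<x) x²≤y²) (ℚP.<-irrefl refl)
  ... | tri≈ _ y≡x _ = ℚP.≤-reflexive (sym y≡x)
  ... | tri> _ _ x<y = ℚP.<⇒≤ x<y

  0≤ℕ→ℚ : ∀ n → 0ℚ ≤ ℕ→ℚ n
  0≤ℕ→ℚ n = ℤ→ℚ-mono-≤ {+ 0} {+ n} (ℤ.+≤+ ℕ.z≤n)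

  ℕ→ℚ-mono-≤ : ∀ {m n} → m ℕ.≤ n → ℕ→ℚ m ≤ ℕ→ℚ n
  ℕ→ℚ-mono-≤ {m} {n} m≤n = ℤ→ℚ-mono-≤ {+ m} {+ n} (ℤ.+≤+ m≤n)

  ℕ→ℚ-cancel-≤ : ∀ m n → ℕ→ℚ m ≤ ℕ→ℚ n → m ℕ.≤ n
  ℕ→ℚ-cancel-≤ m n m≤n = ℤP.drop‿+≤+ (ℤ→ℚ-cancel-≤ {+ m} {+ n} m≤n)

  ℕ→ℚ-mono-< : ∀ {m n} → m ℕ.< n → ℕ→ℚ m < ℕ→ℚ n
  ℕ→ℚ-mono-< {m} {n} m<n = ℚP.≰⇒> λ n≤m → ℕP.<⇒≱ m<n (ℕ→ℚ-cancel-≤ n m n≤m)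

  0<ℕ→ℚ : ∀ n .{{_ : NonZero n}} → 0ℚ < ℕ→ℚ n
  0<ℕ→ℚ (suc n) = ℕ→ℚ-mono-< {0} {suc n} (ℕ.s≤s ℕ.z≤n)

  /-*-cancel : ∀ a b → (+ a) ℚ./ suc b * ℕ→ℚ (suc b) ≡ ℕ→ℚ a
  /-*-cancel a b = ℚP.toℚᵘ-injective
    (ℚᵘP.≃-trans (ℚP.toℚᵘ-homo-* ((+ a) ℚ./ suc b) (ℕ→ℚ (suc b)))
    (ℚᵘP.≃-trans (ℚᵘP.*-cong (ℚP.toℚᵘ-fromℚᵘ (mkℚᵘ (+ a) b)) (toℚᵘ-ℤ→ℚ (+ suc b)))
    (ℚᵘP.≃-trans (*≡* eq) (ℚᵘP.≃-sym (toℚᵘ-ℤ→ℚ (+ a))))))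
    where
    eq : + a ℤ.* + suc b ℤ.* ℤ.1ℤ ≡ + a ℤ.* + (suc b ℕ.* 1)
    eq = trans (ℤP.*-identityʳ _) (cong (λ e → + a ℤ.* + e) (sym (ℕP.*-identityʳ (suc b))))

  infix 4 _≲_
  record _≲_ (f g : ℕ → ℚ) : Set where
    constructor mk≲
    field
      eventually : ∀ ε → 0ℚ < ε → ∃ λ N → ∀ n → N ℕ.≤ n → f n ≤ g n + ε
  open _≲_ public

  ≤-+ε : ∀ {x y ε} → 0ℚ < ε → x ≤ y → x ≤ y + ε
  ≤-+ε {x} {y} {ε} 0<ε x≤y = subst (_≤ y + ε) (ℚP.+-identityʳ x) (ℚP.+-mono-≤ x≤y (ℚP.<⇒≤ 0<ε))

  pointwise⇒≲ : ∀ {f g} → (∀ n → f n ≤ g n) → f ≲ g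
  pointwise⇒≲ f≤g = mk≲ λ ε 0<ε → 0 , λ n _ → ≤-+ε 0<ε (f≤g n)

  ≲-trans : ∀ {f g h} → f ≲ g → g ≲ h → f ≲ h
  ≲-trans {f} {g} {h} f≲g g≲h = mk≲ λ ε 0<ε →
    let M , p = eventually f≲g (ε * ℚ.½) (½-pos 0<ε)
        N , q = eventually g≲h (ε * ℚ.½) (½-pos 0<ε)
    in M ℕ.⊔ N , λ n ≤n → begin
      f n                          ≤⟨ p n (ℕP.m⊔n≤o⇒m≤o M N ≤n) ⟩
      g n + ε * ℚ.½                ≤⟨ ℚP.+-monoˡ-≤ (ε * ℚ.½) (q n (ℕP.m⊔n≤o⇒n≤o M N ≤n)) ⟩
      h n + ε * ℚ.½ + ε * ℚ.½      ≡⟨ trans (ℚP.+-assoc (h n) _ _) (cong (λ z → h n + z) (½+½ ε)) ⟩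
      h n + ε                      ∎
    where open ℚP.≤-Reasoning

  ≲-≤-trans : ∀ {f g h} → f ≲ g → (∀ n → g n ≤ h n) → f ≲ h
  ≲-≤-trans f≲g g≤h = ≲-trans f≲g (pointwise⇒≲ g≤h)

  ≤-≲-trans : ∀ {f g h} → (∀ n → f n ≤ g n) → g ≲ h → f ≲ h
  ≤-≲-trans f≤g g≲h = ≲-trans (pointwise⇒≲ f≤g) g≲h

  recip-cancel : ∀ {c} ε → 0ℚ < c → c * (ε * recip c) ≡ ε
  recip-cancel {c} ε 0<c = trans (regroup c ε (recip c)) (trans (cong (ε *_) (recip-inverseʳ 0<c)) (ℚP.*-identityʳ ε))
    where
    regroup : ∀ c e r → c * (e * r) ≡ e * (c * r)
    regroup = solve-∀ ℚ-ring

  ≲-rearrange : ∀ {f g f′ g′} c → 0ℚ < c → (∀ n → c * (g n - f n) ≤ g′ n - f′ n) → f ≲ g → f′ ≲ g′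
  ≲-rearrange {f} {g} {f′} {g′} c 0<c h f≲g = mk≲ λ ε 0<ε →
    let N , p = eventually f≲g (ε * recip c) (*-pos 0<ε (recip-pos 0<c))
    in N , λ n N≤n → 0≤y-x⇒x≤y (begin
      0ℚ                                     ≤⟨ 0≤* (ℚP.<⇒≤ 0<c) (x≤y⇒0≤y-x (p n N≤n)) ⟩
      c * (g n + ε * recip c - f n)          ≡⟨ expand c (g n) (ε * recip c) (f n) ⟩
      c * (g n - f n) + c * (ε * recip c)    ≡⟨ cong (λ z → c * (g n - f n) + z) (recip-cancel ε 0<c) ⟩
      c * (g n - f n) + ε                    ≤⟨ ℚP.+-monoˡ-≤ ε (h n) ⟩
      g′ n - f′ n + ε                        ≡⟨ swap′ (g′ n) (f′ n) ε ⟩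
      g′ n + ε - f′ n                        ∎)
    where
    open ℚP.≤-Reasoning
    expand : ∀ c g e f → c * (g + e - f) ≡ c * (g - f) + c * e
    expand = solve-∀ ℚ-ring
    swap′ : ∀ g f e → g - f + e ≡ g + e - f
    swap′ = solve-∀ ℚ-ring

  ≲-const : ∀ {a b} → (λ _ → a) ≲ (λ _ → b) → a ≤ b
  ≲-const {a} {b} a≲b = ℚP.≮⇒≥ λ b<a →
    let 0<d = subst (_< a - b) (ℚP.+-inverseʳ b) (ℚP.+-monoˡ-< (- b) b<a)
        N , p = eventually a≲b ((a - b) * ℚ.½) (½-pos 0<d)
    in ℚP.<-irrefl refl (begin-strict
      a                                              ≤⟨ p N ℕP.≤-refl ⟩
      b + (a - b) * ℚ.½                              ≡⟨ sym (ℚP.+-identityʳ _) ⟩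
      b + (a - b) * ℚ.½ + 0ℚ                         <⟨ ℚP.+-monoʳ-< (b + (a - b) * ℚ.½) (½-pos 0<d) ⟩
      b + (a - b) * ℚ.½ + (a - b) * ℚ.½              ≡⟨ trans (ℚP.+-assoc b _ _) (trans (cong (λ z → b + z) (½+½ (a - b))) (cancel b a)) ⟩
      a                                              ∎)
    where
    open ℚP.≤-Reasoning
    cancel : ∀ b a → b + (a - b) ≡ a
    cancel = solve-∀ ℚ-ring

  ≲-*ˡ : ∀ {f g} (h : ℕ → ℚ) {B} → 0ℚ < B → (∀ n → 0ℚ ≤ h n) → (∀ n → h n ≤ B) → f ≲ g →
         (λ n → h n * f n) ≲ (λ n → h n * g n)
  ≲-*ˡ {f} {g} h {B} 0<B 0≤h h≤B f≲g = mk≲ λ ε 0<ε →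
    let 0<ε/B = *-pos 0<ε (recip-pos 0<B)
        N , p = eventually f≲g (ε * recip B) 0<ε/B
    in N , λ n N≤n → begin
      h n * f n                          ≤⟨ ℚP.*-monoˡ-≤-nonNeg (h n) {{ℚ.nonNegative (0≤h n)}} (p n N≤n) ⟩
      h n * (g n + ε * recip B)          ≡⟨ ℚP.*-distribˡ-+ (h n) (g n) _ ⟩
      h n * g n + h n * (ε * recip B)    ≤⟨ ℚP.+-monoʳ-≤ (h n * g n) (ℚP.*-monoʳ-≤-nonNeg (ε * recip B) {{ℚ.nonNegative (ℚP.<⇒≤ 0<ε/B)}} (h≤B n)) ⟩
      h n * g n + B * (ε * recip B)      ≡⟨ cong (λ z → h n * g n + z) (recip-cancel ε 0<B) ⟩
      h n * g n + ε                      ∎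
    where
    open ℚP.≤-Reasoning

  -- f² ≲ f g ≤ (f² + g²) / 2, so no sign or bound on g is needed.
  ≲-² : ∀ {f g : ℕ → ℚ} {B} → 0ℚ < B → (∀ n → 0ℚ ≤ f n) → (∀ n → f n ≤ B) → f ≲ g →
        (λ n → f n * f n) ≲ (λ n → g n * g n)
  ≲-² {f} {g} 0<B 0≤f f≤B f≲g = ≲-rearrange 2ℚ (0<ℕ→ℚ 2)
    (λ n → 0≤y-x⇒x≤y (subst (0ℚ ≤_) (id (f n) (g n)) (0≤² (g n - f n))))
    (≲-*ˡ f 0<B 0≤f f≤B f≲g)
    where
    id : ∀ f g → (g - f) * (g - f) ≡ g * g - f * f - 2ℚ * (f * g - f * f)
    id = solve-∀ ℚ-ring

  record IsSqrt (u : ℕ → ℚ) (x : ℚ) : Set where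
    field
      bound : ℚ
      0<bound : 0ℚ < bound
      0≤ : ∀ k → 0ℚ ≤ u k
      ≤bound : ∀ k → u k ≤ bound
      ²≤ : ∀ k → u k * u k ≤ x
      ≲² : (λ _ → x) ≲ (λ k → u k * u k)

  √-approx-isSqrt : ∀ n → IsSqrt (√-approx n) (ℕ→ℚ n)
  √-approx-isSqrt n = record
    { bound = 1ℚ + ℕ→ℚ n
    ; 0<bound = ℚP.+-mono-<-≤ (ℚP.positive⁻¹ 1ℚ) (0≤ℕ→ℚ n)
    ; 0≤ = 0≤s
    ; ≤bound = ≤bound
    ; ²≤ = ²≤
    ; ≲² = ≲²
    }
    where
    open ℚP.≤-Reasoning
    N = ℕ→ℚ n
    s = √-approx n
    δ : ℕ → ℚ
    δ k = (+ 1) ℚ./ suc k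
    σ : ℕ → ℕ
    σ k = ⌊√ n ℕ.* (suc k ℕ.* suc k) ⌋
    0≤s : ∀ k → 0ℚ ≤ s k
    0≤s k = /-mono-≤ 0 0 (σ k) k ℕ.z≤n
    0≤δ : ∀ k → 0ℚ ≤ δ k
    0≤δ k = /-mono-≤ 0 0 1 k ℕ.z≤n
    δ≤1 : ∀ k → δ k ≤ 1ℚ
    δ≤1 k = /-mono-≤ 1 k 1 0 (ℕ.s≤s ℕ.z≤n)
    K²-pos : ∀ k → ℚ.Positive (ℕ→ℚ (suc k) * ℕ→ℚ (suc k))
    K²-pos k = ℚ.positive (*-pos (0<ℕ→ℚ (suc k)) (0<ℕ→ℚ (suc k)))
    nK² : ∀ k → ℕ→ℚ (n ℕ.* (suc k ℕ.* suc k)) ≡ N * (ℕ→ℚ (suc k) * ℕ→ℚ (suc k))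
    nK² k = trans (ℕ→ℚ-* n _) (cong (N *_) (ℕ→ℚ-* (suc k) (suc k)))
    ²≤ : ∀ k → s k * s k ≤ N
    ²≤ k = ℚP.*-cancelʳ-≤-pos (ℕ→ℚ (suc k) * ℕ→ℚ (suc k)) {{K²-pos k}} (begin
      s k * s k * (ℕ→ℚ (suc k) * ℕ→ℚ (suc k))        ≡⟨ sym (²-distrib-* (s k) (ℕ→ℚ (suc k))) ⟩
      s k * ℕ→ℚ (suc k) * (s k * ℕ→ℚ (suc k))        ≡⟨ cong (λ x → x * x) (/-*-cancel (σ k) k) ⟩
      ℕ→ℚ (σ k) * ℕ→ℚ (σ k)                          ≡⟨ sym (ℕ→ℚ-* (σ k) (σ k)) ⟩
      ℕ→ℚ (σ k ℕ.* σ k)                              ≤⟨ ℕ→ℚ-mono-≤ (proj₁ (⌊√⌋-spec (n ℕ.* (suc k ℕ.* suc k)))) ⟩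
      ℕ→ℚ (n ℕ.* (suc k ℕ.* suc k))                  ≡⟨ nK² k ⟩
      N * (ℕ→ℚ (suc k) * ℕ→ℚ (suc k))                ∎)
    ≤² : ∀ k → N ≤ (s k + δ k) * (s k + δ k)
    ≤² k = ℚP.*-cancelʳ-≤-pos (ℕ→ℚ (suc k) * ℕ→ℚ (suc k)) {{K²-pos k}} (begin
      N * (ℕ→ℚ (suc k) * ℕ→ℚ (suc k))                ≡⟨ sym (nK² k) ⟩
      ℕ→ℚ (n ℕ.* (suc k ℕ.* suc k))                  ≤⟨ ℕ→ℚ-mono-≤ (ℕP.<⇒≤ (proj₂ (⌊√⌋-spec (n ℕ.* (suc k ℕ.* suc k))))) ⟩
      ℕ→ℚ (suc (σ k) ℕ.* suc (σ k))                  ≡⟨ ℕ→ℚ-* (suc (σ k)) (suc (σ k)) ⟩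
      ℕ→ℚ (suc (σ k)) * ℕ→ℚ (suc (σ k))              ≡⟨ cong (λ x → x * x) (sym (trans (cong (_* ℕ→ℚ (suc k)) (sym (/-suc (σ k) k))) (/-*-cancel (suc (σ k)) k))) ⟩
      (s k + δ k) * ℕ→ℚ (suc k) * ((s k + δ k) * ℕ→ℚ (suc k)) ≡⟨ ²-distrib-* (s k + δ k) (ℕ→ℚ (suc k)) ⟩
      (s k + δ k) * (s k + δ k) * (ℕ→ℚ (suc k) * ℕ→ℚ (suc k)) ∎)
    ≤bound : ∀ k → s k ≤ 1ℚ + N
    ≤bound k = ²-cancel-≤ (0≤+ (ℚP.<⇒≤ (ℚP.positive⁻¹ 1ℚ)) (0≤ℕ→ℚ n)) (ℚP.≤-trans (²≤ k) (0≤y-x⇒x≤y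
      (subst (0ℚ ≤_) (id N) (0≤+ (0≤+ (ℚP.<⇒≤ (ℚP.positive⁻¹ 1ℚ)) (0≤ℕ→ℚ n)) (0≤² N)))))
      where
      id : ∀ N → 1ℚ + N + N * N ≡ (1ℚ + N) * (1ℚ + N) - N
      id = solve-∀ ℚ-ring
    C = 2ℚ * (1ℚ + N) + 1ℚ
    0<C : 0ℚ < C
    0<C = ℚP.+-mono-≤-< (0≤* (0≤ℕ→ℚ 2) (0≤+ (ℚP.<⇒≤ (ℚP.positive⁻¹ 1ℚ)) (0≤ℕ→ℚ n))) (ℚP.positive⁻¹ 1ℚ)
    ≲² : (λ _ → N) ≲ (λ k → s k * s k)
    ≲² = mk≲ λ ε 0<ε →
      let M , small = 1/suc-small (ε * recip C) (*-pos 0<ε (recip-pos 0<C))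
      in M , λ k M≤k → begin
        N                                             ≤⟨ ≤² k ⟩
        (s k + δ k) * (s k + δ k)                     ≡⟨ expand (s k) (δ k) ⟩
        s k * s k + (2ℚ * s k + δ k) * δ k            ≤⟨ ℚP.+-monoʳ-≤ (s k * s k) (*-mono-≤₀ (0≤δ k) (ℚP.<⇒≤ 0<C)
                                                           (ℚP.+-mono-≤ (ℚP.*-monoˡ-≤-nonNeg 2ℚ (≤bound k)) (δ≤1 k)) (small k M≤k)) ⟩
        s k * s k + C * (ε * recip C)                 ≡⟨ cong (λ z → s k * s k + z) (recip-cancel ε 0<C) ⟩
        s k * s k + ε                                 ∎
      where
      expand : ∀ s d → (s + d) * (s + d) ≡ s * s + (2ℚ * s + d) * d
      expand = solve-∀ ℚ-ring

module _ where
  open import Data.Rational using (_+_; _*_; -_; _-_; _≤_; _<_)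
  open IsSqrt

  record IsSqrtQuotient (w : ℕ → ℚ) (m t : ℚ) : Set where
    field
      bound : ℚ
      0<bound : 0ℚ < bound
      0≤ : ∀ k → 0ℚ ≤ w k
      ≤bound : ∀ k → w k ≤ bound
      m≲ : (λ _ → m) ≲ (λ k → t * (w k * w k))
      ≲m : (λ k → t * (w k * w k)) ≲ (λ _ → m)

  isSqrt⇒isSqrtQuotient : ∀ {u m} → IsSqrt u m → IsSqrtQuotient u m 1ℚ
  isSqrt⇒isSqrtQuotient u√m = record
    { bound = bound u√m
    ; 0<bound = 0<bound u√m
    ; 0≤ = 0≤ u√m
    ; ≤bound = ≤bound u√m
    ; m≲ = ≲-≤-trans (≲² u√m) λ k → ℚP.≤-reflexive (sym (ℚP.*-identityˡ _))
    ; ≲m = pointwise⇒≲ λ k → ℚP.≤-trans (ℚP.≤-reflexive (ℚP.*-identityˡ _)) (²≤ u√m k)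
    }

  √÷√-isSqrtQuotient : ∀ m t .{{_ : NonZero t}} → IsSqrtQuotient (seq (m √÷√ t)) (ℕ→ℚ m) (ℕ→ℚ t)
  √÷√-isSqrtQuotient m t@(suc _) = record
    { bound = bound √m
    ; 0<bound = 0<bound √m
    ; 0≤ = 0≤w
    ; ≤bound = λ k → ℚP.≤-trans (w≤a k) (≤bound √m k)
    ; m≲ = ≲-≤-trans (≲² √m) λ k → ℚP.≤-trans (ℚP.≤-reflexive (sym (w²b²≡a² k)))
        (ℚP.≤-trans (ℚP.*-monoˡ-≤-nonNeg (w k * w k) {{ℚ.nonNegative (0≤² (w k))}} (²≤ √t k))
          (ℚP.≤-reflexive (ℚP.*-comm _ (ℕ→ℚ t))))
    ; ≲m = ≲-trans (≤-≲-trans (λ k → ℚP.≤-reflexive (ℚP.*-comm (ℕ→ℚ t) _))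
        (≲-*ˡ (λ k → w k * w k) (*-pos (0<bound √m) (0<bound √m)) (λ k → 0≤² (w k))
          (λ k → ²-mono-≤ (0≤w k) (ℚP.≤-trans (w≤a k) (≤bound √m k))) (≲² √t)))
        (pointwise⇒≲ λ k → ℚP.≤-trans (ℚP.≤-reflexive (w²b²≡a² k)) (²≤ √m k))
    }
    where
    √m = √-approx-isSqrt m
    √t = √-approx-isSqrt t
    a = √-approx m
    b = √-approx t
    w : ℕ → ℚ
    w k = a k * recip (b k)
    1≤b : ∀ k → 1ℚ ≤ b k
    1≤b k = proj₂ (proj₂ (proj₂ (√-pos t))) k ℕ.z≤n
    0<b : ∀ k → 0ℚ < b k
    0<b k = ℚP.<-≤-trans (ℚP.positive⁻¹ 1ℚ) (1≤b k)
    0≤w : ∀ k → 0ℚ ≤ w k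
    0≤w k = 0≤* (0≤ √m k) (ℚP.<⇒≤ (recip-pos (0<b k)))
    wb≡a : ∀ k → w k * b k ≡ a k
    wb≡a k = trans (regroup (a k) (recip (b k)) (b k)) (trans (cong (a k *_) (recip-inverseʳ (0<b k))) (ℚP.*-identityʳ (a k)))
      where
      regroup : ∀ a r b → a * r * b ≡ a * (b * r)
      regroup = solve-∀ ℚ-ring
    w≤a : ∀ k → w k ≤ a k
    w≤a k = subst₂ _≤_ (ℚP.*-identityʳ (w k)) (wb≡a k) (ℚP.*-monoˡ-≤-nonNeg (w k) {{ℚ.nonNegative (0≤w k)}} (1≤b k))
    w²b²≡a² : ∀ k → w k * w k * (b k * b k) ≡ a k * a k
    w²b²≡a² k = trans (sym (²-distrib-* (w k) (b k))) (cong (λ x → x * x) (wb≡a k))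

  discriminant : (p m M T : ℚ) → ℚ
  discriminant p m M T = 4ℚ * (T * T) * p + M * M - 4ℚ * T * m

  -- The inequality 4 T M √p ≤ discriminant p m M T, which expresses (2 T √p - M)² ≥ 4 T m.
  √-Bounded : (p m M T : ℚ) → Set
  √-Bounded p m M T = 0ℚ ≤ discriminant p m M T ×
    4ℚ * T * M * (4ℚ * T * M) * p ≤ discriminant p m M T * discriminant p m M T

  module _ {u w : ℕ → ℚ} {p m M T : ℚ} (√p : IsSqrt u p) (0<T : 0ℚ < T) (0<M : 0ℚ < M)
           (√m/t : IsSqrtQuotient w m T) where
    private
      module W = IsSqrtQuotient √m/t
      0≤T = ℚP.<⇒≤ 0<T
      0≤M = ℚP.<⇒≤ 0<M
      0<2T : 0ℚ < 2ℚ * T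
      0<2T = *-pos (0<ℕ→ℚ 2) 0<T
      0<4T : 0ℚ < 4ℚ * T
      0<4T = *-pos (0<ℕ→ℚ 4) 0<T
      0<4TM : 0ℚ < 4ℚ * T * M
      0<4TM = *-pos 0<4T 0<M
      0≤2Tu : ∀ k → 0ℚ ≤ 2ℚ * T * u k
      0≤2Tu k = 0≤* (ℚP.<⇒≤ 0<2T) (0≤ √p k)
      scaled-bound : ∀ {c x y} → 0ℚ < c → x ≤ y → c * x ≤ c * y
      scaled-bound {c} 0<c = ℚP.*-monoˡ-≤-nonNeg c {{ℚ.nonNegative (ℚP.<⇒≤ 0<c)}}
      x≤y-from : ∀ {x y d} → 0ℚ ≤ d → d ≡ y - x → x ≤ y
      x≤y-from 0≤d e = 0≤y-x⇒x≤y (subst (0ℚ ≤_) e 0≤d)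

    √-bounded : (s : ℕ → ℚ) → (λ k → 2ℚ * T * w k) ≲ s →
                (∀ k → s k * s k ≡ 4ℚ * (T * T) * (u k * u k) + M * M - 4ℚ * T * M * u k) →
                √-Bounded p m M T
    √-bounded s 2Tw≲s s²≡ =
        ≲-const (≤-≲-trans (λ k → 0≤4TMu k) 4TMu≲D)
      , ≲-const (≲-trans
          (≲-rearrange (4ℚ * T * M * (4ℚ * T * M)) (*-pos 0<4TM 0<4TM)
            (λ k → ℚP.≤-reflexive (id₃ (4ℚ * T * M) (u k) p)) (≲² √p))
          (≲-² (*-pos 0<4TM (0<bound √p)) 0≤4TMu (λ k → scaled-bound 0<4TM (≤bound √p k)) 4TMu≲D))
      where
      D = discriminant p m M T
      0≤4TMu : ∀ k → 0ℚ ≤ 4ℚ * T * M * u k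
      0≤4TMu k = 0≤* (ℚP.<⇒≤ 0<4TM) (0≤ √p k)
      id₁ : ∀ T m w → 4ℚ * T * (T * (w * w) - m) ≡ 2ℚ * T * w * (2ℚ * T * w) - 4ℚ * T * m
      id₁ = solve-∀ ℚ-ring
      4Tm≲s² : (λ _ → 4ℚ * T * m) ≲ (λ k → s k * s k)
      4Tm≲s² = ≲-trans
        (≲-rearrange (4ℚ * T) 0<4T (λ k → ℚP.≤-reflexive (id₁ T m (w k))) W.m≲)
        (≲-² (*-pos 0<2T W.0<bound) (λ k → 0≤* (ℚP.<⇒≤ 0<2T) (W.0≤ k)) (λ k → scaled-bound 0<2T (W.≤bound k)) 2Tw≲s)
      id₂ : ∀ u p m M T → 4ℚ * (T * T) * (p - u * u) ≡ 4ℚ * (T * T) * p + M * M - 4ℚ * T * m - 4ℚ * T * M * u -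
            1ℚ * (4ℚ * (T * T) * (u * u) + M * M - 4ℚ * T * M * u - 4ℚ * T * m)
      id₂ = solve-∀ ℚ-ring
      id₃ : ∀ c u p → c * c * (u * u - p) ≡ c * u * (c * u) - c * c * p
      id₃ = solve-∀ ℚ-ring
      4TMu≲D : (λ k → 4ℚ * T * M * u k) ≲ (λ _ → D)
      4TMu≲D = ≲-rearrange 1ℚ (ℚP.positive⁻¹ 1ℚ)
        (λ k → x≤y-from (0≤* (0≤* (0≤ℕ→ℚ 4) (0≤² T)) (x≤y⇒0≤y-x (²≤ √p k)))
          (trans (id₂ (u k) p m M T) (cong (λ z → D - 4ℚ * T * M * u k - 1ℚ * (z - 4ℚ * T * m)) (sym (s²≡ k)))))
        4Tm≲s²

    module _ (h : ℚ) (h2T≡1 : h * (2ℚ * T) ≡ 1ℚ) where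
      private
        Mh2T : M ≡ M * (h * (2ℚ * T))
        Mh2T = trans (sym (ℚP.*-identityʳ M)) (cong (M *_) (sym h2T≡1))

      lower-bound : (λ k → M * h + w k) ≲ u → M * M ≤ 4ℚ * (T * T) * p × √-Bounded p m M T
      lower-bound hyp =
          ≲-const (≲-≤-trans
            (≲-² {g = λ k → 2ℚ * T * u k} 0<M (λ _ → 0≤M) (λ _ → ℚP.≤-refl)
              (≲-rearrange (2ℚ * T) 0<2T
                (λ k → x≤y-from (0≤* (ℚP.<⇒≤ 0<2T) (W.0≤ k))
                  (trans (id₂ T M (u k) h (w k)) (cong (λ z → 2ℚ * T * u k - z - 2ℚ * T * (u k - (M * h + w k))) (sym Mh2T)))) hyp))
            (λ k → x≤y-from (0≤* (0≤* (0≤ℕ→ℚ 4) (0≤² T)) (x≤y⇒0≤y-x (²≤ √p k))) (id₃ (u k) p T)))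
        , √-bounded (λ k → 2ℚ * T * u k - M)
            (≲-rearrange (2ℚ * T) 0<2T
              (λ k → ℚP.≤-reflexive (trans (id₁ T M (u k) h (w k)) (cong (λ z → 2ℚ * T * u k - z - 2ℚ * T * w k) (sym Mh2T)))) hyp)
            (λ k → sq T M (u k))
        where
        id₁ : ∀ T M u h w → 2ℚ * T * (u - (M * h + w)) ≡ 2ℚ * T * u - M * (h * (2ℚ * T)) - 2ℚ * T * w
        id₁ = solve-∀ ℚ-ring
        id₂ : ∀ T M u h w → 2ℚ * T * w ≡ 2ℚ * T * u - M * (h * (2ℚ * T)) - 2ℚ * T * (u - (M * h + w))
        id₂ = solve-∀ ℚ-ring
        id₃ : ∀ u p T → 4ℚ * (T * T) * (p - u * u) ≡ 4ℚ * (T * T) * p - 2ℚ * T * u * (2ℚ * T * u)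
        id₃ = solve-∀ ℚ-ring
        sq : ∀ T M u → (2ℚ * T * u - M) * (2ℚ * T * u - M) ≡ 4ℚ * (T * T) * (u * u) + M * M - 4ℚ * T * M * u
        sq = solve-∀ ℚ-ring

      upper-bound : u ≲ (λ k → M * h + - w k) → 4ℚ * (T * T) * p ≤ M * M × √-Bounded p m M T
      upper-bound hyp =
          ≲-const (≲-trans
            (≲-rearrange (4ℚ * (T * T)) (*-pos (0<ℕ→ℚ 4) (*-pos 0<T 0<T)) (λ k → ℚP.≤-reflexive (id₃ (u k) p T)) (≲² √p))
            (≲-² {g = λ _ → M} (*-pos 0<2T (0<bound √p)) 0≤2Tu (λ k → scaled-bound 0<2T (≤bound √p k))
              (≲-rearrange (2ℚ * T) 0<2T
                (λ k → x≤y-from (0≤* (ℚP.<⇒≤ 0<2T) (W.0≤ k))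
                  (trans (id₂ T M (u k) h (w k)) (cong (λ z → z - 2ℚ * T * u k - 2ℚ * T * (M * h + - w k - u k)) (sym Mh2T)))) hyp)))
        , √-bounded (λ k → M - 2ℚ * T * u k)
            (≲-rearrange (2ℚ * T) 0<2T
              (λ k → ℚP.≤-reflexive (trans (id₁ T M (u k) h (w k)) (cong (λ z → z - 2ℚ * T * u k - 2ℚ * T * w k) (sym Mh2T)))) hyp)
            (λ k → sq T M (u k))
        where
        id₁ : ∀ T M u h w → 2ℚ * T * (M * h + - w - u) ≡ M * (h * (2ℚ * T)) - 2ℚ * T * u - 2ℚ * T * w
        id₁ = solve-∀ ℚ-ring
        id₂ : ∀ T M u h w → 2ℚ * T * w ≡ M * (h * (2ℚ * T)) - 2ℚ * T * u - 2ℚ * T * (M * h + - w - u)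
        id₂ = solve-∀ ℚ-ring
        id₃ : ∀ u p T → 4ℚ * (T * T) * (u * u - p) ≡ 2ℚ * T * u * (2ℚ * T * u) - 4ℚ * (T * T) * p
        id₃ = solve-∀ ℚ-ring
        sq : ∀ T M u → (M - 2ℚ * T * u) * (M - 2ℚ * T * u) ≡ 4ℚ * (T * T) * (u * u) + M * M - 4ℚ * T * M * u
        sq = solve-∀ ℚ-ring

  1/2t : ∀ t .{{_ : NonZero t}} → _*_ (ℚ._/_ (+ 1) (2 ℕ.* t) {{ℕP.m*n≢0 2 t}}) (2ℚ * ℕ→ℚ t) ≡ 1ℚ
  1/2t t@(suc t-1) = trans (cong ((ℚ._/_ (+ 1) (2 ℕ.* t)) *_) (sym (ℕ→ℚ-* 2 t))) (/-*-cancel 1 (t-1 ℕ.+ (t ℕ.+ 0)))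

  I₁⇒lower : ∀ m κ t p .{{_ : NonZero m}} .{{_ : NonZero κ}} .{{_ : NonZero t}} → I₁ m κ t (√ p) →
    ℕ→ℚ (m ℕ.* κ) * ℕ→ℚ (m ℕ.* κ) ≤ 4ℚ * (ℕ→ℚ t * ℕ→ℚ t) * ℕ→ℚ p ×
    √-Bounded (ℕ→ℚ p) (ℕ→ℚ m) (ℕ→ℚ (m ℕ.* κ)) (ℕ→ℚ t)
  I₁⇒lower m κ 1 p x∈I₁ = lower-bound (√-approx-isSqrt p) (0<ℕ→ℚ 1) (0<ℕ→ℚ (m ℕ.* κ) {{ℕP.m*n≢0 m κ}})
    (isSqrt⇒isSqrtQuotient (√-approx-isSqrt m)) _ (1/2t 1) (mk≲ x∈I₁)
  I₁⇒lower m κ t@(suc (suc _)) p (lower , _) =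
    lower-bound (√-approx-isSqrt p) (0<ℕ→ℚ t) (0<ℕ→ℚ (m ℕ.* κ) {{ℕP.m*n≢0 m κ}})
    (√÷√-isSqrtQuotient m t) _ (1/2t t) (mk≲ lower)

  I₁⇒upper : ∀ m κ t p .{{_ : NonZero m}} .{{_ : NonZero κ}} .{{_ : NonZero t}} → I₁ m κ (suc t) (√ p) →
    4ℚ * (ℕ→ℚ t * ℕ→ℚ t) * ℕ→ℚ p ≤ ℕ→ℚ (m ℕ.* κ) * ℕ→ℚ (m ℕ.* κ) ×
    √-Bounded (ℕ→ℚ p) (ℕ→ℚ m) (ℕ→ℚ (m ℕ.* κ)) (ℕ→ℚ t)
  I₁⇒upper m κ t@(suc _) p (_ , upper) =
    upper-bound (√-approx-isSqrt p) (0<ℕ→ℚ t) (0<ℕ→ℚ (m ℕ.* κ) {{ℕP.m*n≢0 m κ}})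
    (√÷√-isSqrtQuotient m t) _ (1/2t t) (mk≲ upper)

-- Sums of squares

module _ where
  open import Data.Rational using (_+_; _*_; -_; _-_; _≤_; _<_)

  √-bounded⇒< : ∀ {p m M T κ c} → 0ℚ < T → 0ℚ < M → 0ℚ ≤ κ → 0ℚ ≤ c → √-Bounded p m M T → c * c < κ * κ * p →
                4ℚ * T * M * c < κ * discriminant p m M T
  √-bounded⇒< {p} {m} {M} {T} {κ} {c} 0<T 0<M 0≤κ 0≤c (0≤D , D²) c²<κ²p = ℚP.≰⇒> λ κD≤ →
    ℚP.<-irrefl refl (begin-strict
      κ * D * (κ * D)                          ≤⟨ ²-mono-≤ (0≤* 0≤κ 0≤D) κD≤ ⟩
      A * c * (A * c)                          ≡⟨ ²-distrib-* A c ⟩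
      A * A * (c * c)                          <⟨ ℚP.*-monoʳ-<-pos (A * A) {{ℚ.positive (*-pos 0<A 0<A)}} c²<κ²p ⟩
      A * A * (κ * κ * p)                      ≡⟨ id A κ p ⟩
      κ * κ * (A * A * p)                      ≤⟨ ℚP.*-monoˡ-≤-nonNeg (κ * κ) {{ℚ.nonNegative (0≤² κ)}} D² ⟩
      κ * κ * (D * D)                          ≡⟨ sym (²-distrib-* κ D) ⟩
      κ * D * (κ * D)                          ∎)
    where
    open ℚP.≤-Reasoning
    D = discriminant p m M T
    A = 4ℚ * T * M
    0<A : 0ℚ < A
    0<A = *-pos (*-pos (0<ℕ→ℚ 4) 0<T) 0<M
    id : ∀ a k p → a * a * (k * k * p) ≡ k * k * (a * a * p)
    id = solve-∀ ℚ-ring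

  -- The hypotheses bound (4 p S² + M²) / S strictly below its value at T, while
  -- the last one says that this function of S is at least its value at T.
  no-solution : ∀ {p m κ T S c} → 0ℚ < T → 0ℚ < S → 0ℚ < m → 0ℚ < κ → 0ℚ ≤ c →
                √-Bounded p m (m * κ) T → c * c < κ * κ * p →
                4ℚ * p * (S * S) + m * κ * (m * κ) ≤ 4ℚ * m * (c + 1ℚ) * S →
                ¬ (0ℚ ≤ (S - T) * (4ℚ * p * (S * T) - m * κ * (m * κ)))
  no-solution {p} {m} {κ} {T} {S} {c} 0<T 0<S 0<m 0<κ 0≤c bounded c²<κ²p E sign = ℚP.<-irrefl refl (begin-strict
      T * κ * (4ℚ * p * (S * S) + M * M)
        ≤⟨ ℚP.*-monoˡ-≤-nonNeg (T * κ) {{ℚ.nonNegative (ℚP.<⇒≤ (*-pos 0<T 0<κ))}} E ⟩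
      T * κ * (4ℚ * m * (c + 1ℚ) * S)
        ≡⟨ id₁ T κ m c S ⟩
      S * (4ℚ * T * M * c) + 4ℚ * T * M * S
        <⟨ ℚP.+-monoˡ-< (4ℚ * T * M * S) (ℚP.*-monoʳ-<-pos S {{ℚ.positive 0<S}}
             (√-bounded⇒< {p} {m} {M} {T} {κ} {c} 0<T (*-pos 0<m 0<κ) (ℚP.<⇒≤ 0<κ) 0≤c bounded c²<κ²p)) ⟩
      S * (κ * discriminant p m M T) + 4ℚ * T * M * S
        ≡⟨ id₂ p m κ T S ⟩
      T * κ * (4ℚ * p * (S * S) + M * M) - κ * ((S - T) * (4ℚ * p * (S * T) - M * M))
        ≤⟨ 0≤y-x⇒x≤y (subst (0ℚ ≤_) (id₃ (T * κ * (4ℚ * p * (S * S) + M * M)) _) (0≤* (ℚP.<⇒≤ 0<κ) sign)) ⟩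
      T * κ * (4ℚ * p * (S * S) + M * M) ∎)
    where
    open ℚP.≤-Reasoning
    M = m * κ
    id₁ : ∀ T κ m c S → T * κ * (4ℚ * m * (c + 1ℚ) * S) ≡ S * (4ℚ * T * (m * κ) * c) + 4ℚ * T * (m * κ) * S
    id₁ = solve-∀ ℚ-ring
    id₂ : ∀ p m κ T S → S * (κ * (4ℚ * (T * T) * p + m * κ * (m * κ) - 4ℚ * T * m)) + 4ℚ * T * (m * κ) * S ≡
          T * κ * (4ℚ * p * (S * S) + m * κ * (m * κ)) - κ * ((S - T) * (4ℚ * p * (S * T) - m * κ * (m * κ)))
    id₂ = solve-∀ ℚ-ring
    id₃ : ∀ x y → y ≡ x - (x - y)
    id₃ = solve-∀ ℚ-ring

  sign-above : ∀ {p T S N} → 0ℚ ≤ p → 0ℚ ≤ T → T ≤ S → N ≤ 4ℚ * (T * T) * p → 0ℚ ≤ (S - T) * (4ℚ * p * (S * T) - N)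
  sign-above {p} {T} {S} {N} 0≤p 0≤T T≤S N≤ = 0≤* (x≤y⇒0≤y-x T≤S) (subst (0ℚ ≤_) (id p T S N)
    (0≤+ (x≤y⇒0≤y-x N≤) (0≤* (0≤* (0≤* (0≤ℕ→ℚ 4) 0≤p) 0≤T) (x≤y⇒0≤y-x T≤S))))
    where
    id : ∀ p T S N → 4ℚ * (T * T) * p - N + 4ℚ * p * T * (S - T) ≡ 4ℚ * p * (S * T) - N
    id = solve-∀ ℚ-ring

  sign-below : ∀ {p T S N} → 0ℚ ≤ p → 0ℚ ≤ T → S ≤ T → 4ℚ * (T * T) * p ≤ N → 0ℚ ≤ (S - T) * (4ℚ * p * (S * T) - N)
  sign-below {p} {T} {S} {N} 0≤p 0≤T S≤T ≤N = subst (0ℚ ≤_) (id p T S N) (0≤* (x≤y⇒0≤y-x S≤T)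
    (0≤+ (x≤y⇒0≤y-x ≤N) (0≤* (0≤* (0≤* (0≤ℕ→ℚ 4) 0≤p) 0≤T) (x≤y⇒0≤y-x S≤T))))
    where
    id : ∀ p T S N → (T - S) * (N - 4ℚ * (T * T) * p + 4ℚ * p * T * (T - S)) ≡ (S - T) * (4ℚ * p * (S * T) - N)
    id = solve-∀ ℚ-ring

  ∣z∣² : ∀ z → z ℤ.* z ≡ + (∣ z ∣ ℕ.* ∣ z ∣)
  ∣z∣² (+ n)        = sym (ℤP.pos-* n n)
  ∣z∣² ℤ.-[1+ n ] = refl

  isInt-² : ∀ {x} → IsInt x → ∃ λ n → x * x ≡ ℕ→ℚ n
  isInt-² (z , refl) = ∣ z ∣ ℕ.* ∣ z ∣ , trans (sym (ℤ→ℚ-* z z)) (cong ℤ→ℚ (∣z∣² z))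

  isInt-≢0⇒1≤² : ∀ {x} → IsInt x → x ≢ 0ℚ → 1ℚ ≤ x * x
  isInt-≢0⇒1≤² {x} x∈ℤ x≢0 with isInt-² x∈ℤ
  ... | zero  , x²≡0 = contradiction x²≡0 (*-≢0 x≢0 x≢0)
  ... | suc n , x²≡n = subst (1ℚ ≤_) (sym x²≡n) (ℕ→ℚ-mono-≤ {1} {suc n} (ℕ.s≤s ℕ.z≤n))

module SumsOfSquares (p q : ℕ) where
  open import Data.Rational using (_+_; _*_; -_; _-_; _≤_; _<_)
  open Biquadratic p q

  ∑² : List (K p q) → K p q
  ∑² αs = foldr _+ᴷ_ 0ᴷ (map (λ α → α *ᴷ α) αs)

  0≤c₁² : ∀ (α : K p q) → 0ℚ ≤ c₁ (α *ᴷ α)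
  0≤c₁² α = 0≤+ (0≤+ (0≤+ (0≤² (c₁ α)) (0≤* (0≤ℕ→ℚ p) (0≤² (c√p α)))) (0≤* (0≤ℕ→ℚ q) (0≤² (c√q α))))
    (0≤* (0≤* (0≤ℕ→ℚ p) (0≤ℕ→ℚ q)) (0≤² (c√p√q α)))

  0≤c₁∑² : ∀ αs → 0ℚ ≤ c₁ (∑² αs)
  0≤c₁∑² []       = ℚP.≤-refl
  0≤c₁∑² (α ∷ αs) = 0≤+ (0≤c₁² α) (0≤c₁∑² αs)

  term≤sum : ∀ αs → All (λ α → c₁ (α *ᴷ α) ≤ c₁ (∑² αs)) αs
  term≤sum []       = []
  term≤sum (α ∷ αs) =
      subst (_≤ c₁ (∑² (α ∷ αs))) (ℚP.+-identityʳ _) (ℚP.+-monoʳ-≤ (c₁ (α *ᴷ α)) (0≤c₁∑² αs))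
    ∷ All.map (λ {β} β≤ → ℚP.≤-trans β≤ (subst (_≤ c₁ (∑² (α ∷ αs))) (ℚP.+-identityˡ _)
        (ℚP.+-monoˡ-≤ (c₁ (∑² αs)) (0≤c₁² α)))) (term≤sum αs)

  4pqd²≤4c₁² : ∀ (α : K p q) → P * Q * (2ℚ * c√p√q α * (2ℚ * c√p√q α)) ≤ 4ℚ * c₁ (α *ᴷ α)
  4pqd²≤4c₁² ⟨ a , b , c , d ⟩ = 0≤y-x⇒x≤y (subst (0ℚ ≤_) (id P Q a b c d)
    (0≤* (0≤ℕ→ℚ 4) (0≤+ (0≤+ (0≤² a) (0≤* (0≤ℕ→ℚ p) (0≤² b))) (0≤* (0≤ℕ→ℚ q) (0≤² c)))))
    where
    id : ∀ P Q a b c d → 4ℚ * (a * a + P * (b * b) + Q * (c * c)) ≡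
      4ℚ * (a * a + P * (b * b) + Q * (c * c) + P * Q * (d * d)) - P * Q * (2ℚ * d * (2ℚ * d))
    id = solve-∀ ℚ-ring

  -- X = ∑ a², S = ∑ b² and Z = ∑ a b; the form is ∑ (ν a - μ b)².
  record Sums (αs : List (K p q)) : Set where
    field
      X Z : ℚ
      S : ℕ
      X+pS≤ : X + P * ℕ→ℚ S ≤ c₁ (∑² αs)
      2Z≡ : 2ℚ * Z ≡ c√p (∑² αs)
      0≤form : ∀ μ ν → 0ℚ ≤ ν * ν * X - 2ℚ * ν * μ * Z + μ * μ * ℕ→ℚ S

  sums : ∀ αs → All (λ α → c√p√q α ≡ 0ℚ × IsInt (c√p α)) αs → Sums αs
  sums [] [] = record
    { X = 0ℚ ; Z = 0ℚ ; S = 0 ; X+pS≤ = ℚP.≤-reflexive (id₁ P) ; 2Z≡ = refl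
    ; 0≤form = λ μ ν → ℚP.≤-reflexive (id₂ μ ν) }
    where
    id₁ : ∀ P → 0ℚ + P * 0ℚ ≡ 0ℚ
    id₁ = solve-∀ ℚ-ring
    id₂ : ∀ μ ν → 0ℚ ≡ ν * ν * 0ℚ - 2ℚ * ν * μ * 0ℚ + μ * μ * 0ℚ
    id₂ = solve-∀ ℚ-ring
  sums (α@(⟨ a , b , c , d ⟩) ∷ αs) ((refl , b∈ℤ) ∷ rest) = record
    { X = a * a + T.X
    ; Z = a * b + T.Z
    ; S = n ℕ.+ T.S
    ; X+pS≤ = begin
        a * a + T.X + P * ℕ→ℚ (n ℕ.+ T.S)           ≡⟨ cong (λ s → a * a + T.X + P * s) S≡ ⟩
        a * a + T.X + P * (b * b + ℕ→ℚ T.S)         ≡⟨ id₁ a T.X P b (ℕ→ℚ T.S) ⟩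
        a * a + P * (b * b) + (T.X + P * ℕ→ℚ T.S)   ≤⟨ ℚP.+-monoˡ-≤ (T.X + P * ℕ→ℚ T.S) (0≤y-x⇒x≤y {a * a + P * (b * b)} {c₁ (α *ᴷ α)} (subst (0ℚ ≤_) (id₂ P Q a b c)
                                                          (0≤* (0≤ℕ→ℚ q) (0≤² c)))) ⟩
        c₁ (α *ᴷ α) + (T.X + P * ℕ→ℚ T.S)           ≤⟨ ℚP.+-monoʳ-≤ (c₁ (α *ᴷ α)) T.X+pS≤ ⟩
        c₁ (α *ᴷ α) + c₁ (∑² αs)                    ∎
    ; 2Z≡ = trans (id₃ Q a b c T.Z) (cong (λ z → c√p (α *ᴷ α) + z) T.2Z≡)
    ; 0≤form = λ μ ν → subst (0ℚ ≤_)
        (trans (id₄ a b μ ν T.X T.Z (ℕ→ℚ T.S)) (cong (λ s → ν * ν * (a * a + T.X) - 2ℚ * ν * μ * (a * b + T.Z) + μ * μ * s) (sym S≡)))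
        (0≤+ (0≤² (ν * a - μ * b)) (T.0≤form μ ν))
    }
    where
    open ℚP.≤-Reasoning
    module T = Sums (sums αs rest)
    n = proj₁ (isInt-² b∈ℤ)
    S≡ : ℕ→ℚ (n ℕ.+ T.S) ≡ b * b + ℕ→ℚ T.S
    S≡ = trans (ℕ→ℚ-+ n T.S) (cong (λ z → z + ℕ→ℚ T.S) (sym (proj₂ (isInt-² b∈ℤ))))
    id₁ : ∀ a X P b S → a * a + X + P * (b * b + S) ≡ a * a + P * (b * b) + (X + P * S)
    id₁ = solve-∀ ℚ-ring
    id₂ : ∀ P Q a b c → Q * (c * c) ≡
      a * a + P * (b * b) + Q * (c * c) + P * Q * (0ℚ * 0ℚ) - (a * a + P * (b * b))
    id₂ = solve-∀ ℚ-ring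
    id₃ : ∀ Q a b c Z → 2ℚ * (a * b + Z) ≡ a * b + b * a + Q * (c * 0ℚ + 0ℚ * c) + 2ℚ * Z
    id₃ = solve-∀ ℚ-ring
    id₄ : ∀ a b μ ν X Z S → (ν * a - μ * b) * (ν * a - μ * b) + (ν * ν * X - 2ℚ * ν * μ * Z + μ * μ * S) ≡
      ν * ν * (a * a + X) - 2ℚ * ν * μ * (a * b + Z) + μ * μ * (b * b + S)
    id₄ = solve-∀ ℚ-ring

  cauchy-schwarz : ∀ {αs} (s : Sums αs) → let open Sums s in
                   1ℚ ≤ c√p (∑² αs) → 0ℚ < ℕ→ℚ S × c√p (∑² αs) * c√p (∑² αs) ≤ 4ℚ * ℕ→ℚ S * X
  cauchy-schwarz {αs} s 1≤M = 0<S , 0≤y-x⇒x≤y (ℚP.*-cancelˡ-≤-pos (ℕ→ℚ S) {{ℚ.positive 0<S}}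
      (subst₂ _≤_ (sym (ℚP.*-zeroʳ (ℕ→ℚ S)))
        (trans (id₁ (ℕ→ℚ S) X Z M) (trans (cong (λ y → ℕ→ℚ S * (4ℚ * ℕ→ℚ S * X - (y + y - M) * M)) 2Z≡) (id₂ (ℕ→ℚ S) X M)))
        (0≤form M (2ℚ * ℕ→ℚ S))))
    where
    open Sums s
    M = c√p (∑² αs)
    id₁ : ∀ S X Z M → 2ℚ * S * (2ℚ * S) * X - 2ℚ * (2ℚ * S) * M * Z + M * M * S ≡ S * (4ℚ * S * X - (2ℚ * Z + 2ℚ * Z - M) * M)
    id₁ = solve-∀ ℚ-ring
    id₂ : ∀ S X M → S * (4ℚ * S * X - (M + M - M) * M) ≡ S * (4ℚ * S * X - M * M)
    id₂ = solve-∀ ℚ-ring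
    0≤X : 0ℚ ≤ X
    0≤X = subst (0ℚ ≤_) (id X Z (ℕ→ℚ S)) (0≤form 0ℚ 1ℚ)
      where
      id : ∀ X Z S → 1ℚ * 1ℚ * X - 2ℚ * 1ℚ * 0ℚ * Z + 0ℚ * 0ℚ * S ≡ X
      id = solve-∀ ℚ-ring
    0<S : 0ℚ < ℕ→ℚ S
    0<S with S in S≡
    ... | suc n = 0<ℕ→ℚ (suc n)
    ... | zero  = contradiction (begin-strict
        0ℚ          ≤⟨ 0≤form (X + 1ℚ) 1ℚ ⟩
        1ℚ * 1ℚ * X - 2ℚ * 1ℚ * (X + 1ℚ) * Z + (X + 1ℚ) * (X + 1ℚ) * ℕ→ℚ S
                    ≡⟨ trans (cong (λ n → 1ℚ * 1ℚ * X - 2ℚ * 1ℚ * (X + 1ℚ) * Z + (X + 1ℚ) * (X + 1ℚ) * ℕ→ℚ n) S≡)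
                         (trans (id X Z) (cong (λ M → X - (X + 1ℚ) * M) 2Z≡)) ⟩
        X - (X + 1ℚ) * M
                    ≤⟨ ℚP.+-monoʳ-≤ X (ℚP.neg-antimono-≤ (ℚP.*-monoˡ-≤-nonNeg (X + 1ℚ)
                         {{ℚ.nonNegative (0≤+ 0≤X (0≤ℕ→ℚ 1))}} 1≤M)) ⟩
        X - (X + 1ℚ) * 1ℚ
                    ≡⟨ id′ X ⟩
        - 1ℚ        <⟨ ℚP.negative⁻¹ (- 1ℚ) ⟩
        0ℚ          ∎) (ℚP.<-irrefl refl)
      where
      open ℚP.≤-Reasoning
      id : ∀ X Z → 1ℚ * 1ℚ * X - 2ℚ * 1ℚ * (X + 1ℚ) * Z + (X + 1ℚ) * (X + 1ℚ) * 0ℚ ≡ X - (X + 1ℚ) * (2ℚ * Z)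
      id = solve-∀ ℚ-ring
      id′ : ∀ X → X - (X + 1ℚ) * 1ℚ ≡ - 1ℚ
      id′ = solve-∀ ℚ-ring

-- The interval I₁ is nonempty

module _ where
  open import Data.Rational using (_+_; _*_; -_; _-_; _≤_; _<_)

  ≲-+ : ∀ {f g f′ g′ : ℕ → ℚ} → f ≲ g → f′ ≲ g′ → (λ n → f n + f′ n) ≲ (λ n → g n + g′ n)
  ≲-+ {f} {g} {f′} {g′} f≲g f′≲g′ = ≲-trans {g = λ n → g n + f′ n}
    (≲-rearrange 1ℚ (ℚP.positive⁻¹ 1ℚ) (λ n → ℚP.≤-reflexive (id₁ (f n) (g n) (f′ n))) f≲g)
    (≲-rearrange 1ℚ (ℚP.positive⁻¹ 1ℚ) (λ n → ℚP.≤-reflexive (id₂ (g n) (f′ n) (g′ n))) f′≲g′)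
    where
    id₁ : ∀ f g h → 1ℚ * (g - f) ≡ g + h - (f + h)
    id₁ = solve-∀ ℚ-ring
    id₂ : ∀ h f g → 1ℚ * (g - f) ≡ h + g - (h + f)
    id₂ = solve-∀ ℚ-ring

  ≲-²-cancel : ∀ {f g : ℕ → ℚ} → (∀ n → 0ℚ ≤ g n) → (λ n → f n * f n) ≲ (λ n → g n * g n) → f ≲ g
  ≲-²-cancel {f} {g} 0≤g f²≲g² = mk≲ λ ε 0<ε →
    let N , h = eventually f²≲g² (ε * ε) (*-pos 0<ε 0<ε)
    in N , λ n N≤n → ²-cancel-≤ (0≤+ (0≤g n) (ℚP.<⇒≤ 0<ε)) (ℚP.≤-trans (h n N≤n) (0≤y-x⇒x≤y
      (subst (0ℚ ≤_) (id (g n) ε) (0≤* (0≤* (0≤ℕ→ℚ 2) (0≤g n)) (ℚP.<⇒≤ 0<ε)))))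
    where
    id : ∀ g e → 2ℚ * g * e ≡ (g + e) * (g + e) - (g * g + e * e)
    id = solve-∀ ℚ-ring

  quotient-sum-² : ∀ {w w′ y m t t′} → IsSqrtQuotient w m t → IsSqrtQuotient w′ m t′ → IsSqrt y (t * t′) →
                   0ℚ < m → 0ℚ < t → 0ℚ < t′ →
                   (λ k → t * t′ * ((w k + w′ k) * (w k + w′ k))) ≲ (λ k → m * (t + t′ + 2ℚ * y k))
  quotient-sum-² {w} {w′} {y} {m} {t} {t′} √m/t √m/t′ √tt′ 0<m 0<t 0<t′ =
    ≤-≲-trans (λ k → ℚP.≤-reflexive (id₁ t t′ (w k) (w′ k)))
      (≲-≤-trans (≲-+ (≲-+ (scale 0<t′ W.≲m) (scale 0<t W′.≲m)) (scale (0<ℕ→ℚ 2) cross))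
        (λ k → ℚP.≤-reflexive (id₂ t t′ m (y k))))
    where
    module W = IsSqrtQuotient √m/t
    module W′ = IsSqrtQuotient √m/t′
    module Y = IsSqrt √tt′
    scale : ∀ {c} {f g : ℕ → ℚ} → 0ℚ < c → f ≲ g → (λ n → c * f n) ≲ (λ n → c * g n)
    scale {c} {f} {g} 0<c = ≲-rearrange c 0<c (λ n → ℚP.≤-reflexive (*-distribˡ-- c (g n) (f n)))
    id₁ : ∀ t t′ w w′ → t * t′ * ((w + w′) * (w + w′)) ≡ t′ * (t * (w * w)) + t * (t′ * (w′ * w′)) + 2ℚ * (t * t′ * (w * w′))
    id₁ = solve-∀ ℚ-ring
    id₂ : ∀ t t′ m y → t′ * m + t * m + 2ℚ * (m * y) ≡ m * (t + t′ + 2ℚ * y)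
    id₂ = solve-∀ ℚ-ring
    id₃ : ∀ t t′ w w′ → t * t′ * (w * w′) * (t * t′ * (w * w′)) ≡ t * t′ * (t′ * (w′ * w′) * (t * (w * w)))
    id₃ = solve-∀ ℚ-ring
    id₄ : ∀ x m → x * m ≡ m * x
    id₄ = solve-∀ ℚ-ring
    id₅ : ∀ m s y → m * m * (y * y - s) ≡ m * y * (m * y) - s * (m * m)
    id₅ = solve-∀ ℚ-ring
    0≤t′w′² : ∀ k → 0ℚ ≤ t′ * (w′ k * w′ k)
    0≤t′w′² k = 0≤* (ℚP.<⇒≤ 0<t′) (0≤² (w′ k))
    product : (λ k → t′ * (w′ k * w′ k) * (t * (w k * w k))) ≲ (λ _ → m * m)
    product = ≲-trans
      (≲-*ˡ (λ k → t′ * (w′ k * w′ k)) (*-pos 0<t′ (*-pos W′.0<bound W′.0<bound)) 0≤t′w′²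
        (λ k → ℚP.*-monoˡ-≤-nonNeg t′ {{ℚ.nonNegative (ℚP.<⇒≤ 0<t′)}} (²-mono-≤ (W′.0≤ k) (W′.≤bound k))) W.≲m)
      (≤-≲-trans (λ k → ℚP.≤-reflexive (id₄ (t′ * (w′ k * w′ k)) m)) (scale 0<m W′.≲m))
    cross : (λ k → t * t′ * (w k * w′ k)) ≲ (λ k → m * y k)
    cross = ≲-²-cancel (λ k → 0≤* (ℚP.<⇒≤ 0<m) (Y.0≤ k))
      (≤-≲-trans (λ k → ℚP.≤-reflexive (id₃ t t′ (w k) (w′ k)))
        (≲-trans (scale (*-pos 0<t 0<t′) product)
          (≲-rearrange (m * m) (*-pos 0<m 0<m) (λ k → ℚP.≤-reflexive (id₅ m (t * t′) (y k))) Y.≲²)))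

  I₁-nonEmpty : ∀ m t κ .{{_ : NonZero m}} .{{_ : NonZero t}} .{{_ : NonZero κ}} →
    _/ʳ_ (ℕ→ℝ (4 ℕ.* t ℕ.* (t ℕ.∸ 1)) *ʳ (ℕ→ℝ (2 ℕ.* t ℕ.∸ 1) +ʳ ℕ→ℝ 2 *ʳ √ (t ℕ.* (t ℕ.∸ 1)))) (κ ℕ.^ 2)
         {{ℕP.m^n≢0 κ 2}} ≤ʳ ℕ→ℝ m →
    ∃ λ (x : ℝ) → I₁ m κ t x
  I₁-nonEmpty m 1 κ _ = (ℕ→ℝ (m ℕ.* κ) /ʳ 2) +ʳ √ m , eventually (pointwise⇒≲ {f = seq ((ℕ→ℝ (m ℕ.* κ) /ʳ 2) +ʳ √ m)} λ _ → ℚP.≤-refl)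
  I₁-nonEmpty m t@(suc t′@(suc t″)) κ@(suc κ-1) hyp = x , eventually (pointwise⇒≲ {f = seq x} λ _ → ℚP.≤-refl) ,
      eventually (≲-rearrange {f = λ k → 2ℚ * T * T′ * (w k + w′ k)} {g = λ _ → M} {f′ = seq x} {g′ = λ k → M * h′ + - w′ k}
        (2ℚ * h * h′) (*-pos (*-pos (0<ℕ→ℚ 2) 0<h) 0<h′) (λ k → ℚP.≤-reflexive (id₃ k)) sum≲M)
    where
    x = (ℕ→ℝ (m ℕ.* κ) /ʳ (2 ℕ.* t)) +ʳ (m √÷√ t)
    w = seq (m √÷√ t)
    w′ = seq (m √÷√ t′)
    y = √-approx (t ℕ.* t′)
    T = ℕ→ℚ t
    T′ = ℕ→ℚ t′
    μ = ℕ→ℚ m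
    M = ℕ→ℚ (m ℕ.* κ)
    h = (+ 1) ℚ./ (2 ℕ.* t)
    h′ = (+ 1) ℚ./ (2 ℕ.* t′)
    v = ℚ._/_ (+ 1) (κ ℕ.^ 2) {{ℕP.m^n≢0 κ 2}}
    1/suc-pos : ∀ n → 0ℚ < (+ 1) ℚ./ suc n
    1/suc-pos n = ℚP.positive⁻¹ _ {{ℚP.normalize-pos 1 (suc n)}}
    0<h : 0ℚ < h
    0<h = 1/suc-pos (t′ ℕ.+ (t ℕ.+ 0))
    0<h′ : 0ℚ < h′
    0<h′ = 1/suc-pos (t″ ℕ.+ (t′ ℕ.+ 0))
    0<μ : 0ℚ < μ
    0<μ = 0<ℕ→ℚ m
    vκ² : v * (ℕ→ℚ κ * ℕ→ℚ κ) ≡ 1ℚ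
    vκ² = trans (cong (v *_) (trans (sym (ℕ→ℚ-* κ κ)) (cong (λ n → ℕ→ℚ (κ ℕ.* n)) (sym (ℕP.*-identityʳ κ)))))
      (/-*-cancel 1 (κ-1 ℕ.* 1 ℕ.+ κ-1 ℕ.* (κ ℕ.* 1)))
    M≡ : M ≡ μ * ℕ→ℚ κ
    M≡ = ℕ→ℚ-* m κ
    1≡T-T′ : 1ℚ ≡ T - T′
    1≡T-T′ = trans (id₀ T′) (cong (_- T′) (sym (ℕ→ℚ-+ 1 t′)))
      where
      id₀ : ∀ T′ → 1ℚ ≡ 1ℚ + T′ - T′
      id₀ = solve-∀ ℚ-ring
    4tt′ : ℕ→ℚ (4 ℕ.* t ℕ.* t′) ≡ 4ℚ * T * T′
    4tt′ = trans (ℕ→ℚ-* (4 ℕ.* t) t′) (cong (_* T′) (ℕ→ℚ-* 4 t))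
    2t-1 : ℕ→ℚ (2 ℕ.* t ℕ.∸ 1) ≡ T + T′
    2t-1 = trans (cong ℕ→ℚ (trans (cong (λ n → t′ ℕ.+ n) (ℕP.+-identityʳ t)) (ℕP.+-comm t′ t))) (ℕ→ℚ-+ t t′)
    id₁ : ∀ T T′ z → 2ℚ * T * T′ * z * (2ℚ * T * T′ * z) ≡ 4ℚ * T * T′ * (T * T′ * (z * z))
    id₁ = solve-∀ ℚ-ring
    id₂ : ∀ A B y m κ v → m * (κ * κ) * (m - A * (B + 2ℚ * y) * v) ≡ m * κ * (m * κ) - A * (m * (B + 2ℚ * y)) * (v * (κ * κ))
    id₂ = solve-∀ ℚ-ring
    [2tt′z]²≲M² : (λ k → 2ℚ * T * T′ * (w k + w′ k) * (2ℚ * T * T′ * (w k + w′ k))) ≲ (λ _ → M * M)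
    [2tt′z]²≲M² = ≲-trans {g = λ k → 4ℚ * T * T′ * (μ * (T + T′ + 2ℚ * y k))}
      (≲-rearrange (4ℚ * T * T′) (*-pos (*-pos (0<ℕ→ℚ 4) (0<ℕ→ℚ t)) (0<ℕ→ℚ t′))
        (λ k → ℚP.≤-reflexive (trans (*-distribˡ-- (4ℚ * T * T′) _ _)
          (cong (λ z → 4ℚ * T * T′ * (μ * (T + T′ + 2ℚ * y k)) - z) (sym (id₁ T T′ (w k + w′ k))))))
        (quotient-sum-² (√÷√-isSqrtQuotient m t) (√÷√-isSqrtQuotient m t′)
          (subst (IsSqrt y) (ℕ→ℚ-* t t′) (√-approx-isSqrt (t ℕ.* t′))) 0<μ (0<ℕ→ℚ t) (0<ℕ→ℚ t′)))
      (≲-rearrange {g = λ _ → μ} (μ * (ℕ→ℚ κ * ℕ→ℚ κ)) (*-pos 0<μ (*-pos (0<ℕ→ℚ κ) (0<ℕ→ℚ κ)))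
        (λ k → ℚP.≤-reflexive (trans
          (cong₂ (λ a b → μ * (ℕ→ℚ κ * ℕ→ℚ κ) * (μ - a * (b + 2ℚ * y k) * v)) 4tt′ 2t-1)
          (trans (id₂ (4ℚ * T * T′) (T + T′) (y k) μ (ℕ→ℚ κ) v)
            (cong₂ (λ a b → a * a - b) (sym M≡)
              (trans (cong (4ℚ * T * T′ * (μ * (T + T′ + 2ℚ * y k)) *_) vκ²) (ℚP.*-identityʳ (4ℚ * T * T′ * (μ * (T + T′ + 2ℚ * y k)))))))))
        (mk≲ hyp))
    sum≲M : (λ k → 2ℚ * T * T′ * (w k + w′ k)) ≲ (λ _ → M)
    sum≲M = ≲-²-cancel (λ _ → 0≤ℕ→ℚ (m ℕ.* κ)) [2tt′z]²≲M²
    id₄ : ∀ h h′ T T′ M w w′ → 2ℚ * h * h′ * (M - 2ℚ * T * T′ * (w + w′)) ≡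
          M * (h′ * (h * (2ℚ * 1ℚ))) - (h * (2ℚ * T)) * (h′ * (2ℚ * T′)) * (w + w′)
    id₄ = solve-∀ ℚ-ring
    id₅ : ∀ h h′ T T′ → h′ * (h * (2ℚ * (T - T′))) ≡ h′ * (h * (2ℚ * T)) - h * (h′ * (2ℚ * T′))
    id₅ = solve-∀ ℚ-ring
    id₆ : ∀ h h′ M w w′ → M * (h′ * 1ℚ - h * 1ℚ) - 1ℚ * 1ℚ * (w + w′) ≡ M * h′ + - w′ - (M * h + w)
    id₆ = solve-∀ ℚ-ring
    id₃ : ∀ k → 2ℚ * h * h′ * (M - 2ℚ * T * T′ * (w k + w′ k)) ≡ M * h′ + - w′ k - (M * h + w k)
    id₃ k = trans (id₄ h h′ T T′ M (w k) (w′ k)) (trans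
      (cong₂ (λ a b → M * a - b * (w k + w′ k))
        (trans (cong (λ z → h′ * (h * (2ℚ * z))) 1≡T-T′) (trans (id₅ h h′ T T′) (cong₂ (λ a b → h′ * a - h * b) (1/2t t) (1/2t t′))))
        (cong₂ _*_ (1/2t t) (1/2t t′)))
      (id₆ h h′ M (w k) (w′ k)))

-- The element c + κ √p

module _ where
  open import Data.Nat using (_+_; _*_; _^_; _≤_; _<_; _%_; _/_)

  squareFree-∣ : ∀ {m n} → m ∣ n → SquareFree n → SquareFree m
  squareFree-∣ m∣n sf d d²∣m = sf d (ℕ∣.∣-trans d²∣m m∣n)

  squareFree-1 : SquareFree 1
  squareFree-1 d d²∣1 = ℕP.m*n≡1⇒m≡1 d d (ℕ∣.∣1⇒≡1 d²∣1)

  squareFree-reduced-product : ∀ {p q r} .{{_ : NonZero p}} → SquareFree p → SquareFree q →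
                               r * (GCD.gcd p q * GCD.gcd p q) ≡ p * q → SquareFree r
  squareFree-reduced-product {p} {q} {r} p-sf q-sf rg²≡pq = subst SquareFree (sym r≡p′q′)
    (squareFree-* (squareFree-∣ (ℕ∣.m/n∣m g∣p) p-sf) (squareFree-∣ (ℕ∣.m/n∣m g∣q) q-sf) (Cop.coprime-/gcd p q))
    where
    g = GCD.gcd p q
    instance
      g≢0 : NonZero g
      g≢0 = ℕ.≢-nonZero (GCD.gcd[m,n]≢0 p q (inj₁ (ℕ.≢-nonZero⁻¹ p)))
    g∣p = GCD.gcd[m,n]∣m p q
    g∣q = GCD.gcd[m,n]∣n p q
    regroup : ∀ a b g → (a * g) * (b * g) ≡ (a * b) * (g * g)
    regroup = ℕSolver.solve-∀
    r≡p′q′ : r ≡ (p / g) * (q / g)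
    r≡p′q′ = ℕP.*-cancelʳ-≡ r _ (g * g) {{ℕP.m*n≢0 g g}} (trans rg²≡pq (trans
      (sym (cong₂ _*_ (ℕD.m/n*n≡m g∣p) (ℕD.m/n*n≡m g∣q))) (regroup (p / g) (q / g) g)))

module _ where
  open import Data.Integer using (_+_; _*_; _-_)

  reduced-product-%4 : ∀ p q r g → p ℕ.% 4 ≡ 2 → q ℕ.% 4 ≡ 3 → g ∣ q → r ℕ.* (g ℕ.* g) ≡ p ℕ.* q → r ℕ.% 4 ≡ 2
  reduced-product-%4 p q r g p%4≡2 q%4≡3 (divides e q≡eg) rg²≡pq with
    residue p 2 p%4≡2 | residue q 3 q%4≡3 | residue r (r ℕ.% 4) refl | parity (+ g)
  ... | _ | l′ , q≡ | _ | inj₁ (h , g≡2h) = ⊥-elim (absurd-mod 2 0 _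
          (trans (sym (trans (cong +_ q≡eg) (trans (ℤP.pos-* e g) (cong (λ z → + e * z) g≡2h)))) q≡) (id (+ e) h l′))
    where
    id : ∀ e h l′ → + 2 * (e * h - + 1 - + 2 * l′) ≡ e * (+ 2 * h) - (+ 3 + + 4 * l′) + + 1
    id = ℤSolver.solve-∀
  ... | l , p≡ | l′ , q≡ | l″ , r≡ | inj₂ (h , g≡2h+1) = go (r ℕ.% 4) (ℕD.m%n<n r 4) eq
    where
    eq : (+ (r ℕ.% 4) + + 4 * l″) * ((+ 2 * h + + 1) * (+ 2 * h + + 1)) ≡ (+ 2 + + 4 * l) * (+ 3 + + 4 * l′)
    eq = begin
      (+ (r ℕ.% 4) + + 4 * l″) * ((+ 2 * h + + 1) * (+ 2 * h + + 1))
        ≡⟨ cong₂ _*_ (sym r≡) (cong (λ z → z * z) (sym g≡2h+1)) ⟩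
      + r * (+ g * + g)                  ≡⟨ cong (+ r *_) (sym (ℤP.pos-* g g)) ⟩
      + r * + (g ℕ.* g)                  ≡⟨ sym (ℤP.pos-* r (g ℕ.* g)) ⟩
      + (r ℕ.* (g ℕ.* g))                ≡⟨ trans (cong +_ rg²≡pq) (ℤP.pos-* p q) ⟩
      + p * + q                          ≡⟨ cong₂ _*_ p≡ q≡ ⟩
      (+ 2 + + 4 * l) * (+ 3 + + 4 * l′) ∎
      where open ≡-Reasoning
    id : ∀ i j h l l′ l″ → + 4 * (i * (h * h + h) + l″ * ((+ 2 * h + + 1) * (+ 2 * h + + 1)) - (+ 2 * l′ + + 3 * l + + 4 * l * l′) - + 2 + j) ≡
      (i + + 4 * l″) * ((+ 2 * h + + 1) * (+ 2 * h + + 1)) - (+ 2 + + 4 * l) * (+ 3 + + 4 * l′) + (+ 4 * j - + 2 - i)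
    id = ℤSolver.solve-∀
    go : ∀ i → i ℕ.< 4 → (+ i + + 4 * l″) * ((+ 2 * h + + 1) * (+ 2 * h + + 1)) ≡ (+ 2 + + 4 * l) * (+ 3 + + 4 * l′) → i ≡ 2
    go 0 _ e = ⊥-elim (absurd-mod 4 1 _ e (id (+ 0) (+ 1) h l l′ l″))
    go 1 _ e = ⊥-elim (absurd-mod 4 0 _ e (id (+ 1) (+ 1) h l l′ l″))
    go 2 _ _ = refl
    go 3 _ e = ⊥-elim (absurd-mod 4 2 _ e (id (+ 3) (+ 2) h l l′ l″))
    go (suc (suc (suc (suc _)))) (ℕ.s≤s (ℕ.s≤s (ℕ.s≤s (ℕ.s≤s ())))) _

module _ where
  open import Data.Rational using (_+_; _*_; -_; _-_; _≤_; _<_)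

  squareFree⇒nonSquare : ∀ p κ c .{{_ : NonZero κ}} → 2 ℕ.≤ p → SquareFree p → c ℕ.* c ≢ κ ℕ.* κ ℕ.* p
  squareFree⇒nonSquare p κ c 2≤p p-sf c²≡κ²p = ℕP.<⇒≢ 2≤p (sym p≡1)
    where
    x = ℕ→ℚ c * recip (ℕ→ℚ κ)
    regroup : ∀ c k → 1ℚ * (c * k * (c * k)) ≡ c * c * (k * k)
    regroup = solve-∀ ℚ-ring
    regroup′ : ∀ k p r → k * k * p * (r * r) ≡ k * r * (k * r) * p
    regroup′ = solve-∀ ℚ-ring
    x²≡p : 1ℚ * (x * x) ≡ ℕ→ℚ p
    x²≡p = begin
      1ℚ * (x * x)                                              ≡⟨ regroup (ℕ→ℚ c) _ ⟩
      ℕ→ℚ c * ℕ→ℚ c * (recip (ℕ→ℚ κ) * recip (ℕ→ℚ κ))           ≡⟨ cong (_* (recip (ℕ→ℚ κ) * recip (ℕ→ℚ κ)))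
        (trans (sym (ℕ→ℚ-* c c)) (trans (cong ℕ→ℚ c²≡κ²p) (trans (ℕ→ℚ-* (κ ℕ.* κ) p) (cong (_* ℕ→ℚ p) (ℕ→ℚ-* κ κ))))) ⟩
      ℕ→ℚ κ * ℕ→ℚ κ * ℕ→ℚ p * (recip (ℕ→ℚ κ) * recip (ℕ→ℚ κ))   ≡⟨ regroup′ (ℕ→ℚ κ) (ℕ→ℚ p) _ ⟩
      ℕ→ℚ κ * recip (ℕ→ℚ κ) * (ℕ→ℚ κ * recip (ℕ→ℚ κ)) * ℕ→ℚ p   ≡⟨ cong (λ z → z * z * ℕ→ℚ p) (recip-inverseʳ (0<ℕ→ℚ κ)) ⟩
      1ℚ * 1ℚ * ℕ→ℚ p                                           ≡⟨ ℚP.*-identityˡ (ℕ→ℚ p) ⟩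
      ℕ→ℚ p                                                     ∎
      where open ≡-Reasoning
    x∈ℤ : IsInt x
    x∈ℤ = isInt-of-squareFree 1 x squareFree-1 (+ p , x²≡p)
    z = proj₁ x∈ℤ
    z²≡p : ∣ z ∣ ℕ.* ∣ z ∣ ≡ p
    z²≡p = ℤP.+-injective (ℤ→ℚ-injective (+ (∣ z ∣ ℕ.* ∣ z ∣)) (+ p) (trans (cong ℤ→ℚ (sym (∣z∣² z)))
      (trans (ℤ→ℚ-* z z) (trans (cong (λ y → y * y) (sym (proj₂ x∈ℤ))) (trans (sym (ℚP.*-identityˡ (x * x))) x²≡p)))))
    p≡1 : p ≡ 1
    p≡1 = trans (sym z²≡p) (cong (λ n → n ℕ.* n) (p-sf ∣ z ∣ (ℕ∣.∣-reflexive z²≡p)))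

  ceiling-² : ∀ κ r c → ℕ→ℝ κ *ʳ √ r ≤ʳ ℤ→ℝ (+ c) → κ ℕ.* κ ℕ.* r ℕ.≤ c ℕ.* c
  ceiling-² zero        r c _ = ℕ.z≤n
  ceiling-² κ@(suc _)   r c h = ℕ→ℚ-cancel-≤ (κ ℕ.* κ ℕ.* r) (c ℕ.* c) (subst₂ _≤_
    (sym (trans (ℕ→ℚ-* (κ ℕ.* κ) r) (cong (_* ℕ→ℚ r) (ℕ→ℚ-* κ κ)))) (sym (ℕ→ℚ-* c c))
    (≲-const (≲-trans {g = λ k → k² * (√-approx r k * √-approx r k)}
      (≲-rearrange {g = λ k → √-approx r k * √-approx r k} k² (*-pos (0<ℕ→ℚ κ) (0<ℕ→ℚ κ)) (λ k → ℚP.≤-reflexive (*-distribˡ-- k² _ (ℕ→ℚ r))) ≲²)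
      (≤-≲-trans (λ k → ℚP.≤-reflexive (sym (²-distrib-* (ℕ→ℚ κ) (√-approx r k))))
        (≲-² {f = λ k → ℕ→ℚ κ * √-approx r k} {g = λ _ → ℕ→ℚ c} (*-pos (0<ℕ→ℚ κ) 0<bound) (λ k → 0≤* (0≤ℕ→ℚ κ) (0≤ k))
          (λ k → ℚP.*-monoˡ-≤-nonNeg (ℕ→ℚ κ) {{ℚ.nonNegative (0≤ℕ→ℚ κ)}} (≤bound k)) (mk≲ h))))))
    where
    open IsSqrt (√-approx-isSqrt r)
    k² = ℕ→ℚ κ * ℕ→ℚ κ

  ≤-/⇒*-≤ : ∀ m r n .{{_ : NonZero n}} → ℕ→ℚ m ≤ (+ r) ℚ./ n → m ℕ.* n ℕ.≤ r
  ≤-/⇒*-≤ m r n@(suc n-1) h = ℕ→ℚ-cancel-≤ (m ℕ.* n) r (subst₂ _≤_ (sym (ℕ→ℚ-* m n)) (/-*-cancel r n-1)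
    (ℚP.*-monoʳ-≤-nonNeg (ℕ→ℚ n) {{ℚ.nonNegative (0≤ℕ→ℚ n)}} h))

module Element (p q κ c : ℕ) (κ²p<c² : κ ℕ.* κ ℕ.* p ℕ.< c ℕ.* c) where
  open import Data.Rational using (_+_; _*_; -_; _-_; _≤_; _<_)
  open Biquadratic p q

  private
    C κℚ : ℚ
    C = ℕ→ℚ c
    κℚ = ℕ→ℚ κ
    instance
      c≢0 : NonZero c
      c≢0 = ℕ.≢-nonZero λ { refl → contradiction κ²p<c² λ () }

  element : K p q
  element = ⟨ C , κℚ , 0ℚ , 0ℚ ⟩

  element-integral : Integral element
  element-integral = a₀ ∷ a₁ ∷ [] , trans (cong (λ x → ℚ→K (ℤ→ℚ a₀) +ᴷ element *ᴷ (ℚ→K (ℤ→ℚ a₁) +ᴷ x)) (*ᴷ-identityʳ element))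
    (trans (cong₂ (λ x y → ℚ→K {p} {q} x +ᴷ element *ᴷ (ℚ→K y +ᴷ element)) a₀≡ a₁≡)
      (⟨⟩-cong (e₁ P Q C κℚ) (e₂ Q C κℚ) (e₃ P C κℚ) (e₄ C κℚ)))
    where
    a₀ a₁ : ℤ
    a₀ = + (c ℕ.* c) ℤ.- + (κ ℕ.* κ ℕ.* p)
    a₁ = ℤ.- (+ (2 ℕ.* c))
    a₀≡ : ℤ→ℚ a₀ ≡ C * C - κℚ * κℚ * P
    a₀≡ = trans (ℤ→ℚ-+ (+ (c ℕ.* c)) (ℤ.- (+ (κ ℕ.* κ ℕ.* p)))) (cong₂ _+_ (ℕ→ℚ-* c c) (trans (ℤ→ℚ-neg (+ (κ ℕ.* κ ℕ.* p)))
      (cong -_ (trans (ℕ→ℚ-* (κ ℕ.* κ) p) (cong (_* P) (ℕ→ℚ-* κ κ))))))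
    a₁≡ : ℤ→ℚ a₁ ≡ - (2ℚ * C)
    a₁≡ = trans (ℤ→ℚ-neg (+ (2 ℕ.* c))) (cong -_ (ℕ→ℚ-* 2 c))
    e₁ : ∀ P Q C κ → C * C - κ * κ * P + (C * (- (2ℚ * C) + C) + P * (κ * (0ℚ + κ)) + Q * (0ℚ * (0ℚ + 0ℚ)) + P * Q * (0ℚ * (0ℚ + 0ℚ))) ≡ 0ℚ
    e₁ = solve-∀ ℚ-ring
    e₂ : ∀ Q C κ → 0ℚ + (C * (0ℚ + κ) + κ * (- (2ℚ * C) + C) + Q * (0ℚ * (0ℚ + 0ℚ) + 0ℚ * (0ℚ + 0ℚ))) ≡ 0ℚ
    e₂ = solve-∀ ℚ-ring
    e₃ : ∀ P C κ → 0ℚ + (C * (0ℚ + 0ℚ) + 0ℚ * (- (2ℚ * C) + C) + P * (κ * (0ℚ + 0ℚ) + 0ℚ * (0ℚ + κ))) ≡ 0ℚ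
    e₃ = solve-∀ ℚ-ring
    e₄ : ∀ C κ → 0ℚ + (C * (0ℚ + 0ℚ) + 0ℚ * (- (2ℚ * C) + C) + κ * (0ℚ + 0ℚ) + 0ℚ * (0ℚ + κ)) ≡ 0ℚ
    e₄ = solve-∀ ℚ-ring

  element-totallyPositive : TotallyPositive element
  element-totallyPositive s s′ = ε , 0<ε , 0 , λ k _ → subst (0ℚ + ε ≤_) (sym (coordinates k)) (subst (_≤ C + κℚ * y k) (sym (ℚP.+-identityˡ ε)) (positive s k))
    where
    open ℚP.≤-Reasoning
    open IsSqrt (√-approx-isSqrt p)
    u = √-approx p
    0<2C : 0ℚ < 2ℚ * C
    0<2C = *-pos (0<ℕ→ℚ 2) (0<ℕ→ℚ c)
    ε = recip (2ℚ * C)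
    0<ε = recip-pos 0<2C
    0≤C = 0≤ℕ→ℚ c
    y = seq (signed {p} {q} s (√ p))
    coordinates : ∀ k → seq (embed s s′ element) k ≡ C + κℚ * y k
    coordinates k = id C κℚ (y k) (seq (signed {p} {q} s′ (√ q)) k)
      where
      id : ∀ C κ y v → C + κ * y + 0ℚ * v + 0ℚ * (y * v) ≡ C + κ * y
      id = solve-∀ ℚ-ring
    κ²u²+1≤C² : ∀ k → κℚ * u k * (κℚ * u k) + 1ℚ ≤ C * C
    κ²u²+1≤C² k = begin
      κℚ * u k * (κℚ * u k) + 1ℚ      ≡⟨ cong (_+ 1ℚ) (²-distrib-* κℚ (u k)) ⟩
      κℚ * κℚ * (u k * u k) + 1ℚ      ≤⟨ ℚP.+-monoˡ-≤ 1ℚ (ℚP.*-monoˡ-≤-nonNeg (κℚ * κℚ) {{ℚ.nonNegative (0≤² κℚ)}} (²≤ k)) ⟩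
      κℚ * κℚ * P + 1ℚ                ≡⟨ cong (λ z → z * P + 1ℚ) (sym (ℕ→ℚ-* κ κ)) ⟩
      ℕ→ℚ (κ ℕ.* κ) * P + 1ℚ          ≡⟨ cong (_+ 1ℚ) (sym (ℕ→ℚ-* (κ ℕ.* κ) p)) ⟩
      ℕ→ℚ (κ ℕ.* κ ℕ.* p) + 1ℚ        ≡⟨ trans (sym (ℕ→ℚ-+ (κ ℕ.* κ ℕ.* p) 1)) (cong ℕ→ℚ (ℕP.+-comm (κ ℕ.* κ ℕ.* p) 1)) ⟩
      ℕ→ℚ (suc (κ ℕ.* κ ℕ.* p))       ≤⟨ ℕ→ℚ-mono-≤ κ²p<c² ⟩
      ℕ→ℚ (c ℕ.* c)                   ≡⟨ ℕ→ℚ-* c c ⟩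
      C * C                           ∎
    0≤κu : ∀ k → 0ℚ ≤ κℚ * u k
    0≤κu k = 0≤* (0≤ℕ→ℚ κ) (0≤ k)
    κu≤C : ∀ k → κℚ * u k ≤ C
    κu≤C k = ²-cancel-≤ 0≤C (ℚP.≤-trans (≤-+ε (ℚP.positive⁻¹ 1ℚ) ℚP.≤-refl) (κ²u²+1≤C² k))
    ε≤C-κu : ∀ k → ε ≤ C - κℚ * u k
    ε≤C-κu k = ℚP.*-cancelˡ-≤-pos (2ℚ * C) {{ℚ.positive 0<2C}} (begin
      2ℚ * C * ε                                              ≡⟨ recip-inverseʳ 0<2C ⟩
      1ℚ                                                      ≤⟨ 0≤y-x⇒x≤y (subst (0ℚ ≤_) (id₁ C (κℚ * u k)) (x≤y⇒0≤y-x (κ²u²+1≤C² k))) ⟩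
      (C + κℚ * u k) * (C - κℚ * u k)                         ≤⟨ ℚP.*-monoʳ-≤-nonNeg (C - κℚ * u k) {{ℚ.nonNegative (x≤y⇒0≤y-x (κu≤C k))}}
                                                                   (ℚP.+-monoʳ-≤ C (κu≤C k)) ⟩
      (C + C) * (C - κℚ * u k)                                ≡⟨ id₂ C (C - κℚ * u k) ⟩
      2ℚ * C * (C - κℚ * u k)                                 ∎)
      where
      id₁ : ∀ C y → C * C - (y * y + 1ℚ) ≡ (C + y) * (C - y) - 1ℚ
      id₁ = solve-∀ ℚ-ring
      id₂ : ∀ C y → (C + C) * y ≡ 2ℚ * C * y
      id₂ = solve-∀ ℚ-ring
    positive : ∀ s k → ε ≤ C + κℚ * seq (signed {p} {q} s (√ p)) k
    positive Sign.+ k = ℚP.≤-trans (ε≤C-κu k) (ℚP.+-monoʳ-≤ C (ℚP.≤-trans (ℚP.neg-antimono-≤ (0≤κu k)) (0≤κu k)))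
    positive Sign.- k = subst (ε ≤_) (cong (λ z → C + z) (ℚP.neg-distribʳ-* κℚ (u k))) (ε≤C-κu k)

module _ where
  open import Data.Rational using (_+_; _*_; -_; _-_; _≤_; _<_)

  coordinate-vanishes : ∀ {p q r g n} → SquareFree r → r ℕ.% 4 ≡ 2 → .{{_ : NonZero g}} → r ℕ.* (g ℕ.* g) ≡ p ℕ.* q →
                        ∀ {α : K p q} → Integral α → 4ℚ * c₁ (α *ᴷ α) ≤ ℕ→ℚ n → n ℕ.< r → c√p√q α ≡ 0ℚ
  coordinate-vanishes {p} {q} {r} {g} {n} r-sf r%4≡2 rg²≡pq {α} int 4c₁≤n n<r =
    decidable-stable (c√p√q α ℚP.≟ 0ℚ) λ d≢0 → ℕP.≤⇒≯ (ℕ→ℚ-cancel-≤ r n (begin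
    ℕ→ℚ r                                          ≡⟨ sym (ℚP.*-identityʳ (ℕ→ℚ r)) ⟩
    ℕ→ℚ r * 1ℚ                                     ≤⟨ ℚP.*-monoˡ-≤-nonNeg (ℕ→ℚ r) {{ℚ.nonNegative (0≤ℕ→ℚ r)}}
                                                        (isInt-≢0⇒1≤² (integral-√p√q-coordinate {g} {r} r-sf r%4≡2 rg²≡pq int)
                                                          (*-≢0 (ℕ→ℚ-≢0 g) (*-≢0 (ℕ→ℚ-≢0 2) d≢0))) ⟩
    ℕ→ℚ r * (ℕ→ℚ g * 2d * (ℕ→ℚ g * 2d))            ≡⟨ regroup (ℕ→ℚ r) (ℕ→ℚ g) 2d ⟩
    ℕ→ℚ r * (ℕ→ℚ g * ℕ→ℚ g) * (2d * 2d)            ≡⟨ cong (_* (2d * 2d)) (trans (cong (ℕ→ℚ r *_) (sym (ℕ→ℚ-* g g)))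
                                                        (trans (sym (ℕ→ℚ-* r (g ℕ.* g))) (trans (cong ℕ→ℚ rg²≡pq) (ℕ→ℚ-* p q)))) ⟩
    P * Q * (2d * 2d)                              ≤⟨ 4pqd²≤4c₁² α ⟩
    4ℚ * c₁ (α *ᴷ α)                               ≤⟨ 4c₁≤n ⟩
    ℕ→ℚ n                                          ∎)) n<r
    where
    open ℚP.≤-Reasoning
    open Biquadratic p q
    open SumsOfSquares p q
    2d = 2ℚ * c√p√q α
    regroup : ∀ r g w → r * (g * w * (g * w)) ≡ r * (g * g) * (w * w)
    regroup = solve-∀ ℚ-ring

  ceiling-bounds : ∀ m κ p r R .{{_ : NonZero κ}} .{{_ : NonZero R}} → r ℕ.% 4 ≡ 2 → p ℕ.< r →
                   ℕ→ℝ κ *ʳ √ r ≤ʳ ℤ→ℝ (+ R) → m ℕ.* (4 ℕ.* R) ℕ.≤ r →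
                   ∀ c → c ℕ.* c ℕ.≤ κ ℕ.* κ ℕ.* p → 4 ℕ.* (m ℕ.* suc c) ℕ.< r
  ceiling-bounds m κ p r R r%4≡2 p<r κ√r≤R m4R≤r c c²≤κ²p = ℕP.≤∧≢⇒< 4mc≤r λ 4mc≡r →
      contradiction (trans (sym (trans (cong (ℕ._% 4) (trans (ℕP.*-comm (m ℕ.* suc c) 4) 4mc≡r)) r%4≡2)) (ℕD.m*n%n≡0 (m ℕ.* suc c) 4)) λ ()
    where
    open ℕP.≤-Reasoning
    c<R : c ℕ.< R
    c<R = ℕP.≰⇒> λ R≤c → ℕP.<-irrefl refl (begin-strict
      c ℕ.* c          ≤⟨ c²≤κ²p ⟩
      κ ℕ.* κ ℕ.* p    <⟨ ℕP.*-monoʳ-< (κ ℕ.* κ) {{ℕP.m*n≢0 κ κ}} p<r ⟩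
      κ ℕ.* κ ℕ.* r    ≤⟨ ceiling-² κ r R κ√r≤R ⟩
      R ℕ.* R          ≤⟨ ℕP.*-mono-≤ R≤c R≤c ⟩
      c ℕ.* c          ∎)
    swap : ∀ m c → 4 ℕ.* (m ℕ.* c) ≡ m ℕ.* (4 ℕ.* c)
    swap = ℕSolver.solve-∀
    4mc≤r : 4 ℕ.* (m ℕ.* suc c) ℕ.≤ r
    4mc≤r = begin
      4 ℕ.* (m ℕ.* suc c)    ≡⟨ swap m (suc c) ⟩
      m ℕ.* (4 ℕ.* suc c)    ≤⟨ ℕP.*-monoʳ-≤ m (ℕP.*-monoʳ-≤ 4 c<R) ⟩
      m ℕ.* (4 ℕ.* R)        ≤⟨ m4R≤r ⟩
      r                      ∎

  I₁⇒sign : ∀ m t κ p S .{{_ : NonZero m}} .{{_ : NonZero t}} .{{_ : NonZero κ}} .{{_ : NonZero S}} → I₁ m κ t (√ p) →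
            let M = ℕ→ℚ m * ℕ→ℚ κ in
            ∃ λ T → 0ℚ < T × √-Bounded (ℕ→ℚ p) (ℕ→ℚ m) M T × 0ℚ ≤ (ℕ→ℚ S - T) * (4ℚ * ℕ→ℚ p * (ℕ→ℚ S * T) - M * M)
  I₁⇒sign m t κ p S √p∈I₁ = [ above , below t √p∈I₁ ]′ (ℕP.≤-<-connex t S)
    where
    Result : Set
    Result = let M = ℕ→ℚ m * ℕ→ℚ κ in
      ∃ λ T → 0ℚ < T × √-Bounded (ℕ→ℚ p) (ℕ→ℚ m) M T × 0ℚ ≤ (ℕ→ℚ S - T) * (4ℚ * ℕ→ℚ p * (ℕ→ℚ S * T) - M * M)
    above : t ℕ.≤ S → Result
    above t≤S = let M²≤ , bounded = subst (λ M → M * M ≤ 4ℚ * (ℕ→ℚ t * ℕ→ℚ t) * ℕ→ℚ p × √-Bounded (ℕ→ℚ p) (ℕ→ℚ m) M (ℕ→ℚ t))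
                                      (ℕ→ℚ-* m κ) (I₁⇒lower m κ t p √p∈I₁)
                in ℕ→ℚ t , 0<ℕ→ℚ t , bounded , sign-above (0≤ℕ→ℚ p) (0≤ℕ→ℚ t) (ℕ→ℚ-mono-≤ t≤S) M²≤
    below : ∀ t .{{_ : NonZero t}} → I₁ m κ t (√ p) → S ℕ.< t → Result
    below 1 _ S<1 = contradiction S<1 (ℕP.≤⇒≯ (ℕ.>-nonZero⁻¹ S))
    below (suc t′@(suc _)) √p∈I₁ S<t =
      let ≤M² , bounded = subst (λ M → 4ℚ * (ℕ→ℚ t′ * ℕ→ℚ t′) * ℕ→ℚ p ≤ M * M × √-Bounded (ℕ→ℚ p) (ℕ→ℚ m) M (ℕ→ℚ t′))
                            (ℕ→ℚ-* m κ) (I₁⇒upper m κ t′ p √p∈I₁)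
      in ℕ→ℚ t′ , 0<ℕ→ℚ t′ , bounded , sign-below (0≤ℕ→ℚ p) (0≤ℕ→ℚ t′) (ℕ→ℚ-mono-≤ (ℕ.s≤s⁻¹ S<t)) ≤M²

  not-all-sums : ∀ m t κ .{{_ : NonZero m}} .{{_ : NonZero t}} .{{_ : NonZero κ}} (p q r : ℕ) →
    2 ℕ.≤ p → SquareFree p → SquareFree q → p ℕ.% 4 ≡ 2 → q ℕ.% 4 ≡ 3 →
    r ℕ.* GCD.gcd p q ℕ.^ 2 ≡ p ℕ.* q → p ℕ.< r →
    (R : ℕ) .{{_ : NonZero R}} → ℕ→ℝ κ *ʳ √ r ≤ʳ ℤ→ℝ (+ R) → m ℕ.* (4 ℕ.* R) ℕ.≤ r → I₁ m κ t (√ p) →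
    ¬ (∀ (β : K p q) → m ·𝒪⁺∋ β → SumOfSquares β)
  not-all-sums m t κ p q r 2≤p p-sf q-sf p%4≡2 q%4≡3 rg²≡pq p<r R κ√r≤R m4R≤r √p∈I₁ all-sums =
    no-solution {ℕ→ℚ p} {μ} {ℕ→ℚ κ} {proj₁ sign} {ℕ→ℚ S} {ℕ→ℚ c} (proj₁ (proj₂ sign)) 0<S (0<ℕ→ℚ m) (0<ℕ→ℚ κ) (0≤ℕ→ℚ c)
      (proj₁ (proj₂ (proj₂ sign)))
      (subst₂ _<_ (ℕ→ℚ-* c c) (trans (ℕ→ℚ-* (κ ℕ.* κ) p) (cong (_* ℕ→ℚ p) (ℕ→ℚ-* κ κ))) (ℕ→ℚ-mono-< c²<κ²p))
      energy
      (proj₂ (proj₂ (proj₂ sign)))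
    where
    open Biquadratic p q
    open SumsOfSquares p q
    instance
      p≢0 : NonZero p
      p≢0 = ℕ.>-nonZero (ℕP.<-trans (ℕ.s≤s ℕ.z≤n) 2≤p)
    g = GCD.gcd p q
    instance
      g≢0 : NonZero g
      g≢0 = ℕ.≢-nonZero (GCD.gcd[m,n]≢0 p q (inj₁ (ℕ.≢-nonZero⁻¹ p)))
    μ = ℕ→ℚ m
    M = μ * ℕ→ℚ κ
    rgg≡pq : r ℕ.* (g ℕ.* g) ≡ p ℕ.* q
    rgg≡pq = trans (cong (λ n → r ℕ.* (g ℕ.* n)) (sym (ℕP.*-identityʳ g))) rg²≡pq
    r-sf : SquareFree r
    r-sf = squareFree-reduced-product p-sf q-sf rgg≡pq
    r%4≡2 : r ℕ.% 4 ≡ 2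
    r%4≡2 = reduced-product-%4 p q r g p%4≡2 q%4≡3 (GCD.gcd[m,n]∣n p q) rgg≡pq
    c = ⌊√ κ ℕ.* κ ℕ.* p ⌋
    c²≤κ²p = proj₁ (⌊√⌋-spec (κ ℕ.* κ ℕ.* p))
    c²<κ²p = ℕP.≤∧≢⇒< c²≤κ²p (squareFree⇒nonSquare p κ c 2≤p p-sf)
    4mc<r : 4 ℕ.* (m ℕ.* suc c) ℕ.< r
    4mc<r = ceiling-bounds m κ p r R r%4≡2 p<r κ√r≤R m4R≤r c c²≤κ²p
    open Element p q κ (suc c) (proj₂ (⌊√⌋-spec (κ ℕ.* κ ℕ.* p)))
    representation = all-sums (ℚ→K μ *ᴷ element) (element , element-integral , element-totallyPositive , refl)
    αs = proj₁ representation
    ∑²≡ : ∑² αs ≡ ⟨ μ * ℕ→ℚ (suc c) , M , μ * 0ℚ , μ * 0ℚ ⟩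
    ∑²≡ = trans (sym (proj₂ (proj₂ representation))) (ℚ→K-scale μ element)
    4c₁≡ : 4ℚ * c₁ (∑² αs) ≡ ℕ→ℚ (4 ℕ.* (m ℕ.* suc c))
    4c₁≡ = trans (cong (λ x → 4ℚ * c₁ x) ∑²≡) (sym (trans (ℕ→ℚ-* 4 (m ℕ.* suc c)) (cong (4ℚ *_) (ℕ→ℚ-* m (suc c)))))
    coordinates : ∀ {α : K p q} → Integral α × c₁ (α *ᴷ α) ≤ c₁ (∑² αs) → c√p√q α ≡ 0ℚ × IsInt (c√p α)
    coordinates {α} (int , α²≤) = d≡0 , integral-√p-coordinate p-sf q-sf p%4≡2 q%4≡3 int d≡0
      where
      d≡0 : c√p√q α ≡ 0ℚ
      d≡0 = coordinate-vanishes {g = g} r-sf r%4≡2 rgg≡pq int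
        (subst (4ℚ * c₁ (α *ᴷ α) ≤_) 4c₁≡ (ℚP.*-monoˡ-≤-nonNeg 4ℚ α²≤)) 4mc<r
    s : Sums αs
    s = sums αs (All.map coordinates (All.zip (proj₁ (proj₂ representation) , term≤sum αs)))
    open Sums s
    M≡ : c√p (∑² αs) ≡ M
    M≡ = cong c√p ∑²≡
    1≤M : 1ℚ ≤ c√p (∑² αs)
    1≤M = subst (1ℚ ≤_) (trans (ℕ→ℚ-* m κ) (sym M≡)) (ℕ→ℚ-mono-≤ {1} (ℕ.>-nonZero⁻¹ (m ℕ.* κ) {{ℕP.m*n≢0 m κ}}))
    0<S = proj₁ (cauchy-schwarz s 1≤M)
    instance
      S≢0 : NonZero S
      S≢0 = ℕ.≢-nonZero λ S≡0 → ℚP.<-irrefl (cong ℕ→ℚ (sym S≡0)) 0<S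
    sign = I₁⇒sign m t κ p S √p∈I₁
    energy : 4ℚ * ℕ→ℚ p * (ℕ→ℚ S * ℕ→ℚ S) + M * M ≤ 4ℚ * μ * (ℕ→ℚ c + 1ℚ) * ℕ→ℚ S
    energy = begin
      4ℚ * P * (ℕ→ℚ S * ℕ→ℚ S) + M * M
        ≤⟨ ℚP.+-monoʳ-≤ (4ℚ * P * (ℕ→ℚ S * ℕ→ℚ S)) (subst (λ M → M * M ≤ 4ℚ * ℕ→ℚ S * X) M≡ (proj₂ (cauchy-schwarz s 1≤M))) ⟩
      4ℚ * P * (ℕ→ℚ S * ℕ→ℚ S) + 4ℚ * ℕ→ℚ S * X
        ≡⟨ id₁ P (ℕ→ℚ S) X ⟩
      4ℚ * ℕ→ℚ S * (X + P * ℕ→ℚ S)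
        ≤⟨ ℚP.*-monoˡ-≤-nonNeg (4ℚ * ℕ→ℚ S) {{ℚ.nonNegative (0≤* (0≤ℕ→ℚ 4) (0≤ℕ→ℚ S))}} X+pS≤ ⟩
      4ℚ * ℕ→ℚ S * c₁ (∑² αs)
        ≡⟨ cong (λ x → 4ℚ * ℕ→ℚ S * x) (trans (cong c₁ ∑²≡) (cong (μ *_) (trans (ℕ→ℚ-+ 1 c) (ℚP.+-comm 1ℚ (ℕ→ℚ c))))) ⟩
      4ℚ * ℕ→ℚ S * (μ * (ℕ→ℚ c + 1ℚ))
        ≡⟨ id₂ (ℕ→ℚ S) μ (ℕ→ℚ c + 1ℚ) ⟩
      4ℚ * μ * (ℕ→ℚ c + 1ℚ) * ℕ→ℚ S ∎
      where
      open ℚP.≤-Reasoning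
      id₁ : ∀ P S X → 4ℚ * P * (S * S) + 4ℚ * S * X ≡ 4ℚ * S * (X + P * S)
      id₁ = solve-∀ ℚ-ring
      id₂ : ∀ S m c → 4ℚ * S * (m * c) ≡ 4ℚ * m * c * S
      id₂ = solve-∀ ℚ-ring

open import Data.Nat using (ℕ; NonZero; _+_; _*_; _∸_; _^_; _≤_; _<_; _%_)
open import Data.Nat.Properties using (m*n≢0; m^n≢0)
open import Data.Nat.GCD using (gcd)
open import Data.Integer using (+_)
open import Data.Rational as ℚ using (_/_; _⊓_)
open import Data.Product using (∃; _×_)
open import Relation.Nullary using (¬_)
open import Relation.Binary.PropositionalEquality using (_≡_)

proposition3p1 : (m t κ : ℕ) .{{_ : NonZero m}} .{{_ : NonZero t}} .{{_ : NonZero κ}} →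
    ( (p q r : ℕ) →
    2 ≤ p → 2 ≤ q → SquareFree p → SquareFree q →
    p % 4 ≡ 2 → q % 4 ≡ 3 →
    r * gcd p q ^ 2 ≡ p * q →
    p < q → q < r →
    (⌈κ√r⌉ : ℕ) .{{_ : NonZero ⌈κ√r⌉}} → IsCeiling (ℕ→ℝ κ *ʳ √ r) (+ ⌈κ√r⌉) →
    ℕ→ℚ m ℚ.≤ _/_ (+ r) (4 * ⌈κ√r⌉) {{m*n≢0 4 ⌈κ√r⌉}} ⊓ ℕ→ℚ p ⊓ ℕ→ℚ q →
    I₁ m κ t (√ p) → I₁ m κ t (√ q) →
    ¬ (∀ (β : K p q) → m ·𝒪⁺∋ β → SumOfSquares β) )
    ×
    ( _/ʳ_ (ℕ→ℝ (4 * t * (t ∸ 1)) *ʳ (ℕ→ℝ (2 * t ∸ 1) +ʳ ℕ→ℝ 2 *ʳ √ (t * (t ∸ 1)))) (κ ^ 2) {{m^n≢0 κ 2}} ≤ʳ ℕ→ℝ m →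
    ∃ λ (x : ℝ) → I₁ m κ t x )
proposition3p1 m t κ =
    (λ p q r 2≤p _ p-sf q-sf p%4≡2 q%4≡3 rg²≡pq p<q q<r R κ√r-ceiling m≤ √p∈I₁ _ →
      not-all-sums m t κ p q r 2≤p p-sf q-sf p%4≡2 q%4≡3 rg²≡pq (ℕP.<-trans p<q q<r) R (proj₂ κ√r-ceiling)
        (≤-/⇒*-≤ m r (4 * R) {{m*n≢0 4 R}} (ℚP.p≤q⊓r⇒p≤q _ (ℕ→ℚ p) (ℚP.p≤q⊓r⇒p≤q _ (ℕ→ℚ q) m≤))) √p∈I₁)
  , I₁-nonEmpty m t κ
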